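{- In the non-collaborative variant of the concurrent interpolation search tree (IST), the insertion and deletion operations are lock-free, and the lookup operation is wait-free.
   Context: MODEL. Finitely many (at most $p$) asynchronous threads take arbitrarily interleaved atomic steps on a shared memory; nodes are freshly allocated and never reused. Atomic primitives: READ, WRITE, CAS, FETCH_AND_ADD, and $\mathrm{DCSS}(x,o,w,y,o')$, which atomically writes $w$ to address $x$ and returns SUCCESS if $x$ holds $o$ and $y$ holds $o'$, and otherwise changes nothing and returns FAILED_MAIN_ADDRESS (if $x$ did not match) or FAILED_AUX_ADDRESS (if $y$ did not match). Entries of children arrays are read atomically (primitive DCSS_READ). An operation is wait-free if every invocation completes within a finite number of the invoking thread's own steps, regardless of the other threads; operations are lock-free if, whenever threads executing them keep taking steps, some operation completes after a finite number of steps. DATA. Keys come from a totally ordered set $\mathbb{K}$. A node is one of: Empty; Single(key, val); Inner(initSize, degree $d$, keys $k_0<\dots<k_{d-2}$, children[$0..d-1$], status, count), where status is a triple (integer, boolean, boolean), initially $[0,\bot,\bot]$, count is initially $0$, initSize is the number of keys in the subtree at the node's creation, and all fields other than the children entries, status and count are immutable; Rebuild(target: Inner, parent: Inner, index: int). An IST $I$ has a field root, pointing to a permanent sentinel Inner node of degree 1 (no keys) whose single child is Empty in a newly created IST. An ideal IST on $n$ keys is: Empty if $n=0$, Single if $n=1$, and otherwise an Inner node of degree $\lfloor\sqrt n\rfloor$ or $\lceil\sqrt n\rceil$ whose child subtrees are ideal ISTs each with $\lfloor\sqrt n\rfloor$ or $\lceil\sqrt n\rceil$ keys. In each Inner node,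 children[$i$] is responsible for the keys in $[k_{i-1},k_i)$ (within the parent's interval). $R>0$ is a fixed constant (the rebuild threshold). interpolationSearch($k,n$) returns the index $i$ with $k_{i-1}\le k<k_i$ in $n$'s keys (with $k_{ -1}=-\infty$, $k_{d-1}=+\infty$). OPERATIONS. insert($I,k,v$): path := empty list; $n:=I.\mathrm{root}$; loop: $i:=$ interpolationSearch($k,n$); $c:=n.\mathrm{children}[i]$. If $c$ is Inner: $n:=c$ and append $(c,i)$ to path. If $c$ is Rebuild: helpRebuild($c$), then restart insert from the root. If $c$ is Empty or Single: create $r$, which is Single($k,v$) if $c$ is Empty or has key $k$, and otherwise an Inner node of degree 2, initSize 2, with the two Single children holding the key of $c$ and the key $k$ in order; execute DCSS($n$.children[$i$], $c$, $r$, $n$.status, $[0,\bot,\bot]$). On FAILED_MAIN_ADDRESS repeat the loop from the same $n$; on FAILED_AUX_ADDRESS restart from the root; on SUCCESS, FETCH_AND_ADD($m$.count, 1) for every $m$ in path, then going down the path find the first $(m,j)$ with $m.\mathrm{count}\ge R\cdot m.\mathrm{initSize}$, if any, and call rebuild($m$, parent, $j$), where parent is the predecessor of $m$ on the path ($I$.root for the first); return. delete($I,k$): the same, except that if $c$ is Empty or a Single with key $\ne k$ it returns without changing anything, and if $c$ is a Single with key $k$ then $r$ is a new Empty node. lookup($I,k$): $n:=I.\mathrm{root}$; loop: if $n$ is Inner, $n:=n.\mathrm{children}[\text{interpolationSearch}(k,n)]$; if $n$ is Single, return its value if its key is $k$ and null otherwise; if $n$ is Empty return null; if $n$ is Rebuild,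 $n:=n.\mathrm{target}$. rebuild($u,q,i$): op := new Rebuild($u,q,i$); if DCSS($q$.children[$i$], $u$, op, $q$.status, $[0,\bot,\bot]$) succeeds then helpRebuild(op). helpRebuild(op): keyCount := markAndCount(op.target); ideal := createIdeal(op.target, keyCount), a newly allocated ideal IST holding exactly the keys (with values) in the subtree of op.target; $q$ := op.parent; DCSS($q$.children[op.index], op, ideal, $q$.status, $[0,\bot,\bot]$). markAndCount($u$): if $u$ is Empty return 0; if Single return 1; if Rebuild return markAndCount($u$.target). Otherwise ($u$ Inner): CAS($u$.status, $[0,\bot,\bot]$, $[0,\bot,\top]$); keyCount := 0; for each index read the child $c$: if $c$ is Inner, read its status $[\text{count},\text{finished},\text{started}]$ and add count if finished, else add markAndCount($c$); if $c$ is Rebuild add markAndCount($c$); if $c$ is Single add 1. Then CAS($u$.status, $[0,\bot,\top]$, $[\text{keyCount},\top,\top]$) and return keyCount. -}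

module Defs where

open import Level using (0ℓ)
open import Data.Bool using (Bool; true; false; if_then_else_)
open import Data.Fin using (Fin)
open import Data.Integer using (+_)
open import Data.List using (List; []; _∷_; _++_; _∷ʳ_; length; upTo)
open import Data.List.Relation.Unary.All using (All)
open import Data.List.Relation.Unary.Linked using (Linked)
open import Data.Maybe using (Maybe; just; nothing)
open import Data.Nat using (ℕ; zero; suc; pred; _+_; _*_; _≤_; _<_; _≡ᵇ_)
open import Data.Product using (_×_; _,_; proj₁; ∃; ∃-syntax)
open import Data.Rational as ℚ using (ℚ; 0ℚ; _/_)
open import Data.Sum using (_⊎_)
open import Data.Unit using (⊤; tt)
open import Relation.Binary.Bundles using (StrictTotalOrder)
open import Relation.Binary.Definitions using (tri<; tri≈; tri>)
open import Relation.Binary.PropositionalEquality using (_≡_; _≢_)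
open import Relation.Nullary using (¬_; Dec; does)

-- A positive real constant R, given by its set of rational upper bounds
-- ({ q ∣ R ≤ q }).  Every real R > 0 arises in this way, and the algorithm
-- uses R only to compare it with fractions.
record PositiveReal : Set₁ where
  field
    R≤_      : ℚ → Set
    R≤?_     : ∀ q → Dec (R≤ q)
    upward   : ∀ {q r} → q ℚ.≤ r → R≤ q → R≤ r
    bounded  : ∃[ q ] R≤ q
    positive : ∃[ q ] 0ℚ ℚ.< q × ¬ (R≤ q)

-- c ≥ R · n; for n > 0 this is R ≤ c / n.
atLeast : PositiveReal → ℕ → ℕ → Bool
atLeast R c zero    = true
atLeast R c (suc n) = does (PositiveReal.R≤?_ R (+ c / suc n))

-- m is ⌊√n⌋ or ⌈√n⌉ (for n ≥ 1).
RoundedSqrt : ℕ → ℕ → Set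
RoundedSqrt n m = (m * m ≤ n × n < suc m * suc m)
                ⊎ (pred m * pred m < n × n ≤ m * m)

module IST (𝕂 : StrictTotalOrder 0ℓ 0ℓ 0ℓ) (V : Set) where

  open StrictTotalOrder 𝕂
    using (_<?_; _≟_; compare) renaming (Carrier to K; _<_ to _<ᴷ_)

  KeyValues : Set
  KeyValues = List (K × V)

  ----------------------------------------------------------------------
  -- Ideal ISTs

  data Tree : Set where
    empty  : Tree
    single : K → V → Tree
    inner  : (initSize : ℕ) (keys : List K) (children : List Tree) → Tree

  contents  : Tree → KeyValues
  contents* : List Tree → KeyValues
  contents empty          = []
  contents (single k v)   = (k , v) ∷ []
  contents (inner _ _ ts) = contents* ts
  contents* []            = []
  contents* (t ∷ ts)      = contents t ++ contents* ts

  -- There is one more child than there are keys, and the keys of child i lie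
  -- in [ kᵢ₋₁ , kᵢ ).
  data Separates : List K → List Tree → Set where
    last : ∀ {t} → Separates [] (t ∷ [])
    cons : ∀ {k ks t ts} →
           All (λ kv → proj₁ kv <ᴷ k) (contents t) →
           All (λ kv → ¬ (proj₁ kv <ᴷ k)) (contents* ts) →
           Separates ks ts →
           Separates (k ∷ ks) (t ∷ ts)

  data Ideal : ℕ → Tree → Set where
    empty  : Ideal 0 empty
    single : ∀ {k v} → Ideal 1 (single k v)
    inner  : ∀ {n ks ts} →
             2 ≤ n →
             length (contents* ts) ≡ n →
             RoundedSqrt n (length ts) →
             All (λ t → ∃[ m ] RoundedSqrt n m × Ideal m t) ts →
             Linked _<ᴷ_ ks →
             Separates ks ts →
             Ideal n (inner n ks ts)

  -- Ideal ISTs on n keys are not unique; this is a choice of one for each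
  -- sorted list of keys and values.
  record IdealConstruction : Set where
    field
      construct : KeyValues → Tree
      ideal     : ∀ kvs → Linked (λ x y → proj₁ x <ᴷ proj₁ y) kvs →
                  Ideal (length kvs) (construct kvs)
      complete  : ∀ kvs → Linked (λ x y → proj₁ x <ᴷ proj₁ y) kvs →
                  contents (construct kvs) ≡ kvs

  ----------------------------------------------------------------------
  -- Nodes and shared memory

  Address : Set
  Address = ℕ

  record Status : Set where
    constructor ⟨_,_,_⟩
    field
      count             : ℕ
      finished started  : Bool

  clean : Status
  clean = ⟨ 0 , false , false ⟩

  -- A reference to a node carries the immutable fields of that node; the
  -- mutable fields of an Inner node are found in memory at its address.
  record Inner : Set where
    constructor mkInner
    field
      address  : Address
      initSize : ℕ
      keys     : List K

    degree : ℕ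
    degree = suc (length keys)

  record Rebuild : Set where
    constructor mkRebuild
    field
      address       : Address
      target parent : Inner
      index         : ℕ

  data Node : Set where
    empty   : Address → Node
    single  : Address → K → V → Node
    inner   : Inner → Node
    rebuild : Rebuild → Node

  address : Node → Address
  address (empty a)      = a
  address (single a _ _) = a
  address (inner u)      = Inner.address u
  address (rebuild op)   = Rebuild.address op

  -- Comparing node references is comparing addresses.
  _≐_ : Node → Node → Set
  c ≐ d = address c ≡ address d

  -- Addresses from `next` on are not allocated yet; a cell child a i with i
  -- beyond the degree of the node at a is meaningless.
  record Memory : Set where
    field
      child  : Address → ℕ → Node
      status : Address → Status
      count  : Address → ℕ
      next   : Address
  open Memory

  setChild : Address → ℕ → Node → Memory → Memory
  setChild a i c μ = record μ
    { child = λ b j → if a ≡ᵇ b then (if i ≡ᵇ j then c else child μ b j)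
                                else child μ b j }

  setStatus : Address → Status → Memory → Memory
  setStatus a s μ = record μ
    { status = λ b → if a ≡ᵇ b then s else status μ b }

  setCount : Address → ℕ → Memory → Memory
  setCount a n μ = record μ
    { count = λ b → if a ≡ᵇ b then n else count μ b }

  setChildren : Address → ℕ → List Node → Memory → Memory
  setChildren a i []       μ = μ
  setChildren a i (c ∷ cs) μ = setChildren a (suc i) cs (setChild a i c μ)

  bump : Memory → Memory
  bump μ = record μ { next = suc (next μ) }

  initInner : Address → List Node → Memory → Memory
  initInner a cs μ = setChildren a 0 cs (setStatus a clean (setCount a 0 μ))

  ----------------------------------------------------------------------
  -- Atomic primitives

  data DCSSResult : Set where
    SUCCESS FAILED_MAIN_ADDRESS FAILED_AUX_ADDRESS : DCSSResult

  -- Each `new…` allocates and initialises one node, private to the thread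
  -- until a reference to it is written to a children array.
  data Prim : Set where
    readChild    : (u : Inner) (i : ℕ) → Prim
    readStatus   : (u : Inner) → Prim
    readCount    : (u : Inner) → Prim
    casStatus    : (u : Inner) (old new : Status) → Prim
    fetchAddCount : (u : Inner) (n : ℕ) → Prim
    dcss         : (u : Inner) (i : ℕ) (old new : Node)
                   (w : Inner) (old′ : Status) → Prim
    newEmpty     : Prim
    newSingle    : K → V → Prim
    newInner     : (initSize : ℕ) (keys : List K) (children : List Node) → Prim
    newRebuild   : (target parent : Inner) (index : ℕ) → Prim

  Result : Prim → Set
  Result (readChild _ _)       = Node
  Result (readStatus _)        = Status
  Result (readCount _)         = ℕ
  Result (casStatus _ _ _)     = Bool
  Result (fetchAddCount _ _)   = ℕ
  Result (dcss _ _ _ _ _ _)    = DCSSResult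
  Result newEmpty              = Node
  Result (newSingle _ _)       = Node
  Result (newInner _ _ _)      = Node
  Result (newRebuild _ _ _)    = Rebuild

  -- μ ⊢ π ⇓ x ⊣ μ′: executing π in μ returns x and leaves μ′.  If both
  -- addresses of a DCSS mismatch, either failure may be reported.
  data _⊢_⇓_⊣_ (μ : Memory) : (π : Prim) → Result π → Memory → Set where
    readChild  : ∀ {u i} →
      μ ⊢ readChild u i ⇓ child μ (Inner.address u) i ⊣ μ
    readStatus : ∀ {u} →
      μ ⊢ readStatus u ⇓ status μ (Inner.address u) ⊣ μ
    readCount  : ∀ {u} →
      μ ⊢ readCount u ⇓ count μ (Inner.address u) ⊣ μ
    cas-success : ∀ {u old new} →
      status μ (Inner.address u) ≡ old →
      μ ⊢ casStatus u old new ⇓ true ⊣ setStatus (Inner.address u) new μ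
    cas-failure : ∀ {u old new} →
      status μ (Inner.address u) ≢ old →
      μ ⊢ casStatus u old new ⇓ false ⊣ μ
    fetchAddCount : ∀ {u n} →
      μ ⊢ fetchAddCount u n ⇓ count μ (Inner.address u)
        ⊣ setCount (Inner.address u) (count μ (Inner.address u) + n) μ
    dcss-success : ∀ {u i old new w old′} →
      child μ (Inner.address u) i ≐ old →
      status μ (Inner.address w) ≡ old′ →
      μ ⊢ dcss u i old new w old′ ⇓ SUCCESS
        ⊣ setChild (Inner.address u) i new μ
    dcss-main : ∀ {u i old new w old′} →
      ¬ (child μ (Inner.address u) i ≐ old) →
      μ ⊢ dcss u i old new w old′ ⇓ FAILED_MAIN_ADDRESS ⊣ μ
    dcss-aux : ∀ {u i old new w old′} →
      status μ (Inner.address w) ≢ old′ →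
      μ ⊢ dcss u i old new w old′ ⇓ FAILED_AUX_ADDRESS ⊣ μ
    newEmpty : μ ⊢ newEmpty ⇓ empty (next μ) ⊣ bump μ
    newSingle : ∀ {k v} →
      μ ⊢ newSingle k v ⇓ single (next μ) k v ⊣ bump μ
    newInner : ∀ {n ks cs} →
      μ ⊢ newInner n ks cs ⇓ inner (mkInner (next μ) n ks)
        ⊣ bump (initInner (next μ) cs μ)
    newRebuild : ∀ {u q i} →
      μ ⊢ newRebuild u q i ⇓ mkRebuild (next μ) u q i ⊣ bump μ

  -- The sentinel has address 0 and the initial Empty node address 1.
  root : Inner
  root = mkInner 0 0 []

  initialMemory : Memory
  initialMemory = record
    { child  = λ _ _ → empty 1
    ; status = λ _ → clean
    ; count  = λ _ → 0
    ; next   = 2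
    }

  ----------------------------------------------------------------------
  -- Operations and procedures

  data Update : Set where
    insert : K → V → Update
    delete : K → Update

  data Op : Set where
    update : Update → Op
    lookup : K → Op

  data IsUpdate : Op → Set where
    update : ∀ {a} → IsUpdate (update a)

  data IsLookup : Op → Set where
    lookup : ∀ {k} → IsLookup (lookup k)

  OpResult : Op → Set
  OpResult (update _) = ⊤
  OpResult (lookup _) = Maybe V

  -- The Inner nodes below the root visited so far, topmost first, each with
  -- its index in its predecessor.
  Path : Set
  Path = List (Inner × ℕ)

  -- `descend` and `search` are the loops of the updates and of lookup, at a
  -- given current node.
  data Proc : Set where
    operation    : Op → Proc
    descend      : Update → Inner → Path → Proc
    search       : K → Node → Proc
    rebuild      : (u q : Inner) (i : ℕ) → Proc
    helpRebuild  : Rebuild → Proc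
    markAndCount : Node → Proc
    collect      : Node → Proc

  Returns : Proc → Set
  Returns (operation o)    = OpResult o
  Returns (descend _ _ _)  = ⊤
  Returns (search _ _)     = Maybe V
  Returns (rebuild _ _ _)  = ⊤
  Returns (helpRebuild _)  = ⊤
  Returns (markAndCount _) = ℕ
  Returns (collect _)      = KeyValues

  -- Programs; all unbounded iteration and recursion goes through `call`.
  data Cmd (A : Set) : Set where
    return : A → Cmd A
    prim   : (π : Prim) → (Result π → Cmd A) → Cmd A
    call   : (f : Proc) → (Returns f → Cmd A) → Cmd A

  infixl 1 _>>=_ _>>_

  _>>=_ : ∀ {A B} → Cmd A → (A → Cmd B) → Cmd B
  return x >>= h = h x
  prim π g >>= h = prim π λ x → g x >>= h
  call f g >>= h = call f λ x → g x >>= h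

  _>>_ : ∀ {A B} → Cmd A → Cmd B → Cmd B
  c >> d = c >>= λ _ → d

  exec : (π : Prim) → Cmd (Result π)
  exec π = prim π return

  run : (f : Proc) → Cmd (Returns f)
  run f = call f return

  -- The index i with kᵢ₋₁ ≤ k < kᵢ in the increasing list of keys.
  interpolationSearch : K → List K → ℕ
  interpolationSearch k []        = 0
  interpolationSearch k (k₀ ∷ ks) =
    if does (k <? k₀) then 0 else suc (interpolationSearch k ks)

  keyOf : Update → K
  keyOf (insert k _) = k
  keyOf (delete k)   = k

  pair : K → V → K → V → Cmd Node
  pair k v k′ v′ = do
    c ← exec (newSingle k v)
    d ← exec (newSingle k′ v′)
    exec (newInner 2 (k′ ∷ []) (c ∷ d ∷ []))

  -- How an update replaces an Empty child, resp. a Single(k′, v′) child;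
  -- `nothing` if it leaves it unchanged.
  atEmpty : Update → Maybe (Cmd Node)
  atEmpty (insert k v) = just (exec (newSingle k v))
  atEmpty (delete k)   = nothing

  atSingle : Update → K → V → Maybe (Cmd Node)
  atSingle (insert k v) k′ v′ with compare k k′
  ... | tri< _ _ _ = just (pair k v k′ v′)
  ... | tri≈ _ _ _ = just (exec (newSingle k v))
  ... | tri> _ _ _ = just (pair k′ v′ k v)
  atSingle (delete k) k′ v′ =
    if does (k ≟ k′) then just (exec newEmpty) else nothing

  incrementCounts : Path → Cmd ⊤
  incrementCounts []             = return tt
  incrementCounts ((m , _) ∷ ms) = do
    _ ← exec (fetchAddCount m 1)
    incrementCounts ms

  allocate  : Tree → Cmd Node
  allocate* : List Tree → Cmd (List Node)
  allocate empty           = exec newEmpty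
  allocate (single k v)    = exec (newSingle k v)
  allocate (inner n ks ts) = do
    cs ← allocate* ts
    exec (newInner n ks cs)
  allocate* []       = return []
  allocate* (t ∷ ts) = do
    c  ← allocate t
    cs ← allocate* ts
    return (c ∷ cs)

  -- The for-loops over the indices of a children array.
  countChildren : Inner → List ℕ → ℕ → Cmd ℕ
  countChildren u []       n = return n
  countChildren u (i ∷ is) n = do
    c ← exec (readChild u i)
    m ← countChild c
    countChildren u is (n + m)
    where
    countChild : Node → Cmd ℕ
    countChild (empty _)      = return 0
    countChild (single _ _ _) = return 1
    countChild (rebuild op)   = run (markAndCount (rebuild op))
    countChild (inner c)      = do
      ⟨ n , finished , _ ⟩ ← exec (readStatus c)
      if finished then return n else run (markAndCount (inner c))

  collectChildren : Inner → List ℕ → Cmd KeyValues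
  collectChildren u []       = return []
  collectChildren u (i ∷ is) = do
    c    ← exec (readChild u i)
    kvs  ← run (collect c)
    kvs′ ← collectChildren u is
    return (kvs ++ kvs′)

  module Algorithm (R : PositiveReal) (I : IdealConstruction) where

    open IdealConstruction I using (construct)

    -- The second argument of `rebuildFirst` is the predecessor of the path.
    rebuildFirst : Inner → Path → Cmd ⊤
    rebuildFirst q []             = return tt
    rebuildFirst q ((m , j) ∷ ms) = do
      n ← exec (readCount m)
      if atLeast R n (Inner.initSize m)
        then run (rebuild m q j)
        else rebuildFirst m ms

    replace : Update → Inner → Path → ℕ → Node → Maybe (Cmd Node) → Cmd ⊤
    replace a n path i c nothing       = return tt
    replace a n path i c (just create) = do
      r      ← create
      result ← exec (dcss n i c r n clean)
      continue result
      where
      continue : DCSSResult → Cmd ⊤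
      continue FAILED_MAIN_ADDRESS = run (descend a n path)
      continue FAILED_AUX_ADDRESS  = run (operation (update a))
      continue SUCCESS             = do
        _ ← incrementCounts path
        rebuildFirst root path

    visit : Update → Inner → Path → ℕ → Node → Cmd ⊤
    visit a n path i (inner c)          = run (descend a c (path ∷ʳ (c , i)))
    visit a n path i (rebuild op)       = do
      _ ← run (helpRebuild op)
      run (operation (update a))
    visit a n path i c@(empty _)        = replace a n path i c (atEmpty a)
    visit a n path i c@(single _ k′ v′) = replace a n path i c (atSingle a k′ v′)

    -- Once marked, the subtree no longer changes, so keyCount is the length of
    -- the collected list; the sizes in the ideal IST come from that list.
    createIdeal : Inner → (keyCount : ℕ) → Cmd Node
    createIdeal u _ = do
      kvs ← run (collect (inner u))
      allocate (construct kvs)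

    body : (f : Proc) → Cmd (Returns f)

    body (operation (update a)) = run (descend a root [])
    body (operation (lookup k)) = run (search k (inner root))

    body (descend a n path) = do
      let i = interpolationSearch (keyOf a) (Inner.keys n)
      c ← exec (readChild n i)
      visit a n path i c

    body (search k (inner n)) = do
      c ← exec (readChild n (interpolationSearch k (Inner.keys n)))
      run (search k c)
    body (search k (single _ k′ v)) =
      return (if does (k ≟ k′) then just v else nothing)
    body (search k (empty _))    = return nothing
    body (search k (rebuild op)) = run (search k (inner (Rebuild.target op)))

    body (rebuild u q i) = do
      op     ← exec (newRebuild u q i)
      result ← exec (dcss q i (inner u) (rebuild op) q clean)
      continue op result
      where
      continue : Rebuild → DCSSResult → Cmd ⊤
      continue op SUCCESS             = run (helpRebuild op)
      continue op FAILED_MAIN_ADDRESS = return tt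
      continue op FAILED_AUX_ADDRESS  = return tt

    body (helpRebuild op) = do
      let q = Rebuild.parent op
      keyCount ← run (markAndCount (inner (Rebuild.target op)))
      ideal    ← createIdeal (Rebuild.target op) keyCount
      _        ← exec (dcss q (Rebuild.index op) (rebuild op) ideal q clean)
      return tt

    body (markAndCount (empty _))      = return 0
    body (markAndCount (single _ _ _)) = return 1
    body (markAndCount (rebuild op))   = run (markAndCount (inner (Rebuild.target op)))
    body (markAndCount (inner u))      = do
      _        ← exec (casStatus u clean ⟨ 0 , false , true ⟩)
      keyCount ← countChildren u (upTo (Inner.degree u)) 0
      _        ← exec (casStatus u ⟨ 0 , false , true ⟩ ⟨ keyCount , true , true ⟩)
      return keyCount

    body (collect (empty _))      = return []
    body (collect (single _ k v)) = return ((k , v) ∷ [])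
    body (collect (rebuild op))   = run (collect (inner (Rebuild.target op)))
    body (collect (inner u))      = collectChildren u (upTo (Inner.degree u))

    --------------------------------------------------------------------
    -- Executions

    data Thread : Set where
      idle    : Thread
      running : (o : Op) → Cmd (OpResult o) → Thread

    data Event : Set where
      invoked internal completed : Op → Event

    op : Event → Op
    op (invoked o)   = o
    op (internal o)  = o
    op (completed o) = o

    -- Entering a procedure counts as a step, so that a thread cannot loop
    -- without taking steps.
    data ThreadStep (μ : Memory) : Thread → Event → Memory → Thread → Set where
      invoke   : ∀ {o} →
        ThreadStep μ idle (invoked o) μ (running o (body (operation o)))
      prim     : ∀ {o π x μ′} {g : Result π → Cmd (OpResult o)} →
        μ ⊢ π ⇓ x ⊣ μ′ →
        ThreadStep μ (running o (prim π g)) (internal o) μ′ (running o (g x))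
      call     : ∀ {o f} {g : Returns f → Cmd (OpResult o)} →
        ThreadStep μ (running o (call f g)) (internal o) μ
                     (running o (body f >>= g))
      complete : ∀ {o x} →
        ThreadStep μ (running o (return x)) (completed o) μ idle

    record Config (p : ℕ) : Set where
      field
        memory  : Memory
        threads : Fin p → Thread
    open Config

    record Step {p : ℕ} (C : Config p) (θ : Fin p) (e : Event)
                (C′ : Config p) : Set where
      field
        moves  : ThreadStep (memory C) (threads C θ) e (memory C′) (threads C′ θ)
        others : ∀ θ′ → θ′ ≢ θ → threads C′ θ′ ≡ threads C θ′

    -- The invoked operations and the interleaving are arbitrary; a thread that
    -- eventually takes no more steps has crashed.
    record Execution (p : ℕ) : Set where
      field
        config         : ℕ → Config p
        thread         : ℕ → Fin p
        event          : ℕ → Event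
        step           : ∀ n → Step (config n) (thread n) (event n)
                                    (config (suc n))
        initial-memory : memory (config 0) ≡ initialMemory
        initial-idle   : ∀ θ → threads (config 0) θ ≡ idle
    open Execution

    InfinitelyOften : (ℕ → Set) → Set
    InfinitelyOften P = ∀ n → ∃[ m ] n ≤ m × P m

    LockFree : ℕ → (Op → Set) → Set
    LockFree p P = (E : Execution p) →
      InfinitelyOften (λ n → P (op (event E n))) →
      InfinitelyOften (λ n → ∃[ o ] P o × event E n ≡ completed o)

    -- The operation o invoked in step n completes in step m.
    record CompletedAt {p : ℕ} (E : Execution p) (o : Op) (n m : ℕ) : Set where
      field
        later     : n < m
        by        : thread E m ≡ thread E n
        completes : event E m ≡ completed o
        meanwhile : ∀ j → n < j → j < m → thread E j ≡ thread E n →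
                    event E j ≡ internal o

    WaitFree : ℕ → (Op → Set) → Set
    WaitFree p P = (E : Execution p) → ∀ n o → P o → event E n ≡ invoked o →
      InfinitelyOften (λ m → thread E m ≡ thread E n) →
      ∃[ m ] CompletedAt E o n m

{-# OPTIONS --safe #-}

-- An Inner node has only one parent cell ever, so a node whose cell has been
-- overwritten is cut off from the root for good, and only such nodes are ever
-- marked.  Hence a DCSS at a node reachable from the root can fail only if the
-- child cell has changed since it was read.
--
-- Lock-freedom: until the next update completes, every thread replaces at most
-- one leaf and installs at most one Rebuild node, and every Rebuild node is
-- replaced at most once, so only finitely many DCSS succeed.  Between two of
-- these, every update terminates, since the tree is finite and an update
-- restarts at most once: a descent from the root meets no failing DCSS.
--
-- Wait-freedom: a lookup goes from the root to some child x of the root.  As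
-- long as x is attached to the root, every update below x increments the count
-- of x, and once this count is large enough, every thread that reads it
-- detaches x.  Afterwards only the threads that are already below x can change
-- the tree below x, each of them at most twice.  So there are finitely many
-- changes below x, and between two of them the lookup descends a finite tree.

module Submission where

open import Level using (0ℓ)
open import Data.Bool using (Bool; true; false; if_then_else_; T; _∧_)
open import Data.Empty using (⊥)
open import Data.Fin using (Fin; zero; suc)
import Data.Fin.Properties as Fin
import Data.Integer as ℤ
import Data.Integer.Properties as ℤ
open import Data.List using (List; []; _∷_; upTo)
open import Data.List.Membership.Propositional using (_∈_)
open import Data.List.Relation.Unary.All as All using (All; []; _∷_)
open import Data.List.Relation.Unary.All.Properties using (++⁺)
open import Data.List.Relation.Unary.AllPairs using (AllPairs; []; _∷_)
open import Data.List.Relation.Unary.Any using (here; there)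
open import Data.Maybe using (Maybe; just; nothing)
open import Data.Nat
open import Data.Nat.Induction using (<-wellFounded)
open import Data.Nat.Properties
open import Data.Product using (Σ; _×_; _,_; proj₁; proj₂; ∃-syntax)
import Data.Rational as ℚ
import Data.Rational.Properties as ℚ
import Data.Rational.Unnormalised as ℚᵘ
import Data.Rational.Unnormalised.Properties as ℚᵘ
open import Data.Sum using (_⊎_; inj₁; inj₂; [_,_]′)
open import Data.Unit using (⊤; tt)
open import Function using (_∘_; id; case_of_)
open import Induction.WellFounded using (Acc; acc; WellFounded)
open import Relation.Binary.Bundles using (StrictTotalOrder)
open import Relation.Binary.Definitions using (tri<; tri≈; tri>)
open import Relation.Binary.PropositionalEquality
open import Relation.Nullary using (¬_; yes; no; does; contradiction)
open import Relation.Nullary.Decidable using (dec-true)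
open import Data.Nat.Tactic.RingSolver using (solve-∀)
open import Defs

-- No single number bounds the steps of a lookup: while `x` is attached, threads may return to it
-- from the root again and again. But a thread that has replaced a leaf below `x` must increment the
-- count of `x` before it can replace another. Hence the measure is lexicographic: whether `x` is
-- attached, then the number of increments missing up to a safe threshold, then a sum of ranks that
-- bounds the remaining changes as long as the first two stand still.
--
-- Being below `x` must not depend on reachability, since subtrees are cut off while threads are
-- still inside. So every node receives a permanent ghost label when it is published, inherited from
-- its parent below the root.
--
-- The procedures are mutually recursive and may restart, so safety and termination are separated.
-- Rely/guarantee triples limit what a thread does to the memory, whatever its running time.
-- Termination is proved only relative to frozen cells, which form a well-founded graph; every
-- relevant change instead lowers a measure, after which the runs are taken afresh.

≡ᵇ-refl : ∀ n → (n ≡ᵇ n) ≡ true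
≡ᵇ-refl zero    = refl
≡ᵇ-refl (suc n) = ≡ᵇ-refl n

≢⇒≡ᵇ-false : ∀ {m n} → m ≢ n → (m ≡ᵇ n) ≡ false
≢⇒≡ᵇ-false {m} {n} m≢n with m ≡ᵇ n in eq
... | false = refl
... | true  = contradiction (≡ᵇ⇒≡ m n (subst T (sym eq) tt)) m≢n

≡ᵇ-true⇒≡ : ∀ {m n} → (m ≡ᵇ n) ≡ true → m ≡ n
≡ᵇ-true⇒≡ {m} {n} eq = ≡ᵇ⇒≡ m n (subst T (sym eq) tt)

-- Function updates, filtered lists and sums over threads

module _ {A : Set} where

  _[_↦_] : (ℕ → A) → ℕ → A → ℕ → A
  (f [ a ↦ x ]) b = if a ≡ᵇ b then x else f b

  ↦-same : ∀ (f : ℕ → A) a {x} → (f [ a ↦ x ]) a ≡ x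
  ↦-same f a rewrite ≡ᵇ-refl a = refl

  ↦-other : ∀ (f : ℕ → A) {a b x} → a ≢ b → (f [ a ↦ x ]) b ≡ f b
  ↦-other f a≢b rewrite ≢⇒≡ᵇ-false a≢b = refl

module _ {A : Set} where

  countᵇ : (A → Bool) → List A → ℕ
  countᵇ f []       = 0
  countᵇ f (x ∷ xs) = if f x then suc (countᵇ f xs) else countᵇ f xs

  removeᵇ : (A → Bool) → List A → List A
  removeᵇ g []       = []
  removeᵇ g (x ∷ xs) = if g x then removeᵇ g xs else x ∷ removeᵇ g xs

  countᵇ-removeᵇ : ∀ f g xs → countᵇ f (removeᵇ g xs) ≤ countᵇ f xs
  countᵇ-removeᵇ f g []       = z≤n
  countᵇ-removeᵇ f g (x ∷ xs) with g x | f x in eq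
  ... | true  | true  = m≤n⇒m≤1+n (countᵇ-removeᵇ f g xs)
  ... | true  | false = countᵇ-removeᵇ f g xs
  ... | false | true  rewrite eq = s≤s (countᵇ-removeᵇ f g xs)
  ... | false | false rewrite eq = countᵇ-removeᵇ f g xs

  countᵇ-removeᵇ-∈ : ∀ f g {x xs} → x ∈ xs → f x ≡ true → g x ≡ true →
                     countᵇ f (removeᵇ g xs) < countᵇ f xs
  countᵇ-removeᵇ-∈ f g {xs = x ∷ xs} (here refl) fx gx rewrite gx | fx =
    s≤s (countᵇ-removeᵇ f g xs)
  countᵇ-removeᵇ-∈ f g {xs = y ∷ xs} (there x∈xs) fx gx with g y | f y in eq
  ... | true  | true  = m≤n⇒m≤1+n (countᵇ-removeᵇ-∈ f g x∈xs fx gx)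
  ... | true  | false = countᵇ-removeᵇ-∈ f g x∈xs fx gx
  ... | false | true  rewrite eq = s≤s (countᵇ-removeᵇ-∈ f g x∈xs fx gx)
  ... | false | false rewrite eq = countᵇ-removeᵇ-∈ f g x∈xs fx gx

  ∈-removeᵇ : ∀ g {x xs} → x ∈ xs → g x ≡ false → x ∈ removeᵇ g xs
  ∈-removeᵇ g (here refl) gx rewrite gx = here refl
  ∈-removeᵇ g {xs = y ∷ xs} (there x∈xs) gx with g y
  ... | true  = ∈-removeᵇ g x∈xs gx
  ... | false = there (∈-removeᵇ g x∈xs gx)

∑ : ∀ {p} → (Fin p → ℕ) → ℕ
∑ {zero}  f = 0
∑ {suc p} f = f zero + ∑ (f ∘ suc)

∑-cong : ∀ {p} {f g : Fin p → ℕ} → (∀ i → f i ≡ g i) → ∑ f ≡ ∑ g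
∑-cong {zero}  f≗g = refl
∑-cong {suc p} f≗g = cong₂ _+_ (f≗g zero) (∑-cong (f≗g ∘ suc))

∑-update : ∀ {p} {f g : Fin p → ℕ} i → (∀ j → j ≢ i → g j ≡ f j) →
           ∑ g + f i ≡ ∑ f + g i
∑-update {suc p} {f} {g} zero same = begin
  g zero + ∑ (g ∘ suc) + f zero   ≡⟨ cong (λ n → g zero + n + f zero) (∑-cong λ j →
      same (suc j) λ ()) ⟩
  g zero + ∑ (f ∘ suc) + f zero   ≡⟨ +-assoc (g zero) _ _ ⟩
  g zero + (∑ (f ∘ suc) + f zero) ≡⟨ +-comm (g zero) _ ⟩
  ∑ (f ∘ suc) + f zero + g zero   ≡⟨ cong (_+ g zero) (+-comm _ (f zero)) ⟩
  f zero + ∑ (f ∘ suc) + g zero   ∎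
  where open ≡-Reasoning
∑-update {suc p} {f} {g} (suc i) same = begin
  g zero + ∑ (g ∘ suc) + f (suc i)   ≡⟨ +-assoc (g zero) _ _ ⟩
  g zero + (∑ (g ∘ suc) + f (suc i)) ≡⟨ cong₂ _+_ (same zero λ ()) (∑-update i λ j j≢i →
      same (suc j) λ { refl → j≢i refl }) ⟩
  f zero + (∑ (f ∘ suc) + g (suc i)) ≡⟨ +-assoc (f zero) _ _ ⟨
  f zero + ∑ (f ∘ suc) + g (suc i)   ∎
  where open ≡-Reasoning

-- Passes from the thread that moves to the total potential: `a` and `b` are the shares held by the
-- memory before and after, and `k` is the guaranteed decrease. Adding `f i + g i` on both sides
-- avoids subtraction.
∑-shift-≤ : ∀ {p} {f g : Fin p → ℕ} i {a b} → (∀ j → j ≢ i → g j ≡ f j) →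
            ∀ k → k + (g i + b) ≤ f i + a → k + (∑ g + b) ≤ ∑ f + a
∑-shift-≤ {f = f} {g} i {a} {b} same k le = +-cancelʳ-≤ (f i + g i) _ _ (begin
  k + (∑ g + b) + (f i + g i)   ≡⟨ shuffle k (∑ g) b (f i) (g i) ⟩
  (∑ g + f i) + (k + (g i + b)) ≤⟨ +-mono-≤ (≤-reflexive (∑-update i same)) le ⟩
  (∑ f + g i) + (f i + a)       ≡⟨ shuffle′ (∑ f) (g i) (f i) a ⟩
  ∑ f + a + (f i + g i)         ∎)
  where
  open ≤-Reasoning
  shuffle : ∀ k s b x y → k + (s + b) + (x + y) ≡ (s + x) + (k + (y + b))
  shuffle = solve-∀
  shuffle′ : ∀ s y x a → (s + y) + (x + a) ≡ s + a + (x + y)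
  shuffle′ = solve-∀

-- Well-founded descent of a tuple, one coordinate at a time

module _ {A : Set} (_≺_ : A → A → Set) where

  OneBelow : ∀ {p} → (Fin p → A) → (Fin p → A) → Set
  OneBelow g f = ∃[ i ] g i ≺ f i × (∀ j → j ≢ i → g j ≡ f j)

  private
    acc-resp : ∀ {p} {f g : Fin p → A} → (∀ i → g i ≡ f i) → Acc OneBelow f → Acc OneBelow g
    acc-resp g≗f (acc rs) = acc λ { (i , lt , same) →
      rs (i , subst (_ ≺_) (g≗f i) lt , λ j j≢i → trans (same j j≢i) (g≗f j)) }

    -- Head and tail descend independently, so the induction is on both accessibility proofs. Tuples
    -- are functions, so `f` is tied to `x` and `g` only pointwise.
    cons : ∀ {p} {x : A} {g : Fin p → A} → Acc _≺_ x → Acc OneBelow g →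
           (f : Fin (suc p) → A) → f zero ≡ x → (∀ j → f (suc j) ≡ g j) → Acc OneBelow f
    cons {g = g} (acc rx) (acc rg) f refl f≗g = acc λ
      { {h} (zero  , lt , same) →
          cons (rx lt) (acc rg) h refl λ j → trans (same (suc j) λ ()) (f≗g j)
      ; {h} (suc i , lt , same) →
          cons (acc rx)
               (rg (i , subst (_ ≺_) (f≗g i) lt ,
                    λ j j≢i → trans (same (suc j) λ { refl → j≢i refl }) (f≗g j)))
               h (same zero λ ()) λ j → refl }

  -- Finitely many terminating processes terminate under any interleaving: a step of one thread
  -- lowers its own coordinate and leaves the others alone.
  oneBelow-acc : ∀ {p} (f : Fin p → A) → (∀ i → Acc _≺_ (f i)) → Acc OneBelow f
  oneBelow-acc {zero}  f acc-f = acc λ { (() , _) }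
  oneBelow-acc {suc p} f acc-f =
    cons (acc-f zero) (oneBelow-acc (f ∘ suc) (acc-f ∘ suc)) f refl λ j → refl

_[_≔_] : ∀ {a p} {A : Set a} → (Fin p → A) → Fin p → A → Fin p → A
(f [ i ≔ x ]) j = if does (j Fin.≟ i) then x else f j

≔-same : ∀ {a p} {A : Set a} (f : Fin p → A) i {x} → (f [ i ≔ x ]) i ≡ x
≔-same f i rewrite dec-true (i Fin.≟ i) refl = refl

≔-other : ∀ {a p} {A : Set a} (f : Fin p → A) {i j x} → j ≢ i → (f [ i ≔ x ]) j ≡ f j
≔-other f {i} {j} j≢i with j Fin.≟ i
... | yes j≡i = contradiction j≡i j≢i
... | no  _   = refl

-- R has a rational upper bound `q`, and `q` is at most the absolute value of its numerator. So once
-- `c` is at least `suc n` times that value, `R ≤ q ≤ c / suc n`.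
threshold : ∀ R n → ∃[ N ] (∀ c → N ≤ c → atLeast R c n ≡ true)
threshold R zero    = 0 , λ _ _ → refl
threshold R (suc n) = let q , R≤q = PositiveReal.bounded R in
  suc n * ℤ.∣ ℚ.↥ q ∣ , λ c le →
    dec-true (PositiveReal.R≤?_ R _) (PositiveReal.upward R (below q c le) R≤q)
  where
  below : ∀ q c → suc n * ℤ.∣ ℚ.↥ q ∣ ≤ c → q ℚ.≤ (ℤ.+ c) ℚ./ suc n
  -- The comparison is moved to unnormalised rationals, because the fraction on the right is reduced
  -- to lowest terms and its numerator is not `c` itself.
  below q@record{} c le = ℚ.toℚᵘ-cancel-≤
    (ℚᵘ.≤-respʳ-≃ (ℚᵘ.≃-sym (ℚ.toℚᵘ-fromℚᵘ (ℚᵘ.mkℚᵘ (ℤ.+ c) n)))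
      (ℚᵘ.*≤* (ℤ.≤-trans (ℤ.*-monoʳ-≤-nonNeg (ℤ.+ suc n) (below-abs (ℚ.↥ q)))
                (subst₂ ℤ._≤_ (ℤ.pos-* ℤ.∣ ℚ.↥ q ∣ (suc n)) (ℤ.pos-* c (ℚ.↧ₙ q))
                  (ℤ.+≤+ (≤-trans (≤-trans (≤-reflexive (*-comm ℤ.∣ ℚ.↥ q ∣ (suc n))) le)
                                  (m≤m*n c (ℚ.↧ₙ q))))))))
    where
    below-abs : ∀ i → i ℤ.≤ ℤ.+ ℤ.∣ i ∣
    below-abs (ℤ.+ _)    = ℤ.≤-refl
    below-abs ℤ.-[1+ _ ] = ℤ.-≤+

module Progress (𝕂 : StrictTotalOrder 0ℓ 0ℓ 0ℓ) (V : Set) (R : PositiveReal)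
                (I : IST.IdealConstruction 𝕂 V) (p : ℕ) where

  open IST 𝕂 V
  open Algorithm R I
  open StrictTotalOrder 𝕂 using () renaming (Carrier to K; _≟_ to _≟ᴷ_; compare to compareᴷ)
  open Memory

  -- Ghost state and invariant

  data Tag : Set where
    own : Fin p → Tag
    shared   : Address → Tag

  record Cell : Set where
    constructor ⟪_,_,_⟫
    field
      holder : Address
      index  : ℕ
      label  : Address

  -- Ghost state: `nodeAt` records the allocated nodes.  A node is private to the
  -- thread that allocated it until a successful DCSS of that thread; from then
  -- on it is public, labelled with the address of the child of the root below
  -- which it was put (the root has label 0).  `rebuilds` lists the cells of
  -- public nodes that hold Rebuild nodes.
  record World : Set where
    field
      mem      : Memory
      nodeAt   : Address → Node
      tag      : Address → Tag
      rebuilds : List Cell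
  open World

  -- A successful DCSS publishes all private nodes of the thread under one tag, leftovers of failed
  -- attempts included. As the new tag depends on the old tag only, equal tags of parent and child
  -- stay equal, and nobody has to compute which nodes became reachable.
  publish : Fin p → Tag → Tag → Tag
  publish θ t (shared ℓ)    = shared ℓ
  publish θ t (own θ′) = if does (θ Fin.≟ θ′) then t else own θ′

  publish-private : ∀ θ t → publish θ t (own θ) ≡ t
  publish-private θ t rewrite dec-true (θ Fin.≟ θ) refl = refl

  publish-other : ∀ {θ θ′} t → θ′ ≢ θ → publish θ t (own θ′) ≡ own θ′
  publish-other {θ} {θ′} t θ′≢θ with θ Fin.≟ θ′
  ... | yes θ≡θ′ = contradiction (sym θ≡θ′) θ′≢θ
  ... | no  _    = refl

  publicTag : World → Address → Node → Tag
  publicTag w n c = if n ≡ᵇ 0 then shared (address c) else tag w n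

  labelOf : Tag → Address
  labelOf (own _) = 0
  labelOf (shared ℓ)   = ℓ

  inCell : Address → ℕ → Cell → Bool
  inCell n i ⟪ b , j , _ ⟫ = (n ≡ᵇ b) ∧ (i ≡ᵇ j)

  -- The invariant demands only that each cell holding a Rebuild node be listed. An overestimate
  -- would do no harm: the list serves as an upper bound for the replacements still to come.
  recordWrite : World → Address → ℕ → Node → List Cell
  recordWrite w n i (rebuild _) = ⟪ n , i , labelOf (tag w n) ⟫ ∷ rebuilds w
  recordWrite w n i (inner _)      = removeᵇ (inCell n i) (rebuilds w)
  recordWrite w n i (empty _)      = removeᵇ (inCell n i) (rebuilds w)
  recordWrite w n i (single _ _ _) = removeᵇ (inCell n i) (rebuilds w)

  allocated : Fin p → World → Node → Memory → World
  allocated θ w c μ′ = record w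
    { mem    = μ′
    ; nodeAt = nodeAt w [ next (mem w) ↦ c ]
    ; tag    = tag w [ next (mem w) ↦ own θ ]
    }

  written : Fin p → World → Inner → ℕ → Node → Memory → World
  written θ w u i c μ′ = record w
    { mem      = μ′
    ; tag      = λ a → publish θ (publicTag w (Inner.address u) c) (tag w a)
    ; rebuilds = recordWrite w (Inner.address u) i c
    }

  after : Fin p → World → (π : Prim) → Result π → Memory → World
  after θ w (readChild _ _)        _       μ′ = record w { mem = μ′ }
  after θ w (readStatus _)         _       μ′ = record w { mem = μ′ }
  after θ w (readCount _)          _       μ′ = record w { mem = μ′ }
  after θ w (casStatus _ _ _)      _       μ′ = record w { mem = μ′ }
  after θ w (fetchAddCount _ _)    _       μ′ = record w { mem = μ′ }
  after θ w (dcss u i _ c _ _)     SUCCESS μ′ = written θ w u i c μ′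
  after θ w (dcss _ _ _ _ _ _)     FAILED_MAIN_ADDRESS μ′ = record w { mem = μ′ }
  after θ w (dcss _ _ _ _ _ _)     FAILED_AUX_ADDRESS  μ′ = record w { mem = μ′ }
  after θ w newEmpty               c       μ′ = allocated θ w c μ′
  after θ w (newSingle _ _)        c       μ′ = allocated θ w c μ′
  after θ w (newInner _ _ _)       c       μ′ = allocated θ w c μ′
  after θ w (newRebuild _ _ _)     op      μ′ = allocated θ w (rebuild op) μ′

  after-mem : ∀ θ w π x μ′ → mem (after θ w π x μ′) ≡ μ′
  after-mem θ w (readChild _ _)        _       μ′ = refl
  after-mem θ w (readStatus _)         _       μ′ = refl
  after-mem θ w (readCount _)          _       μ′ = refl
  after-mem θ w (casStatus _ _ _)      _       μ′ = refl
  after-mem θ w (fetchAddCount _ _)    _       μ′ = refl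
  after-mem θ w (dcss u i _ c _ _)     SUCCESS μ′ = refl
  after-mem θ w (dcss _ _ _ _ _ _)     FAILED_MAIN_ADDRESS μ′ = refl
  after-mem θ w (dcss _ _ _ _ _ _)     FAILED_AUX_ADDRESS  μ′ = refl
  after-mem θ w newEmpty               c       μ′ = refl
  after-mem θ w (newSingle _ _)        c       μ′ = refl
  after-mem θ w (newInner _ _ _)       c       μ′ = refl
  after-mem θ w (newRebuild _ _ _)     op      μ′ = refl

  record Known (w : World) (c : Node) : Set where
    constructor known
    field
      isAllocated : address c < next (mem w)
      isNodeAt    : nodeAt w (address c) ≡ c
  open Known

  -- A DCSS compares addresses only. Since `nodeAt` fixes one node per address and addresses are
  -- never reused, a match identifies the whole reference with its immutable fields.
  known-unique : ∀ {w c d} → Known w c → Known w d → c ≐ d → c ≡ d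
  known-unique {w} (known _ p) (known _ q) e = trans (sym p) (trans (cong (nodeAt w) e) q)

  Public : World → Address → Set
  Public w a = ∃[ ℓ ] tag w a ≡ shared ℓ

  -- The tag of b if b is a child, or the target of a Rebuild child, of a.
  record Below (w : World) (a b : Address) : Set where
    constructor below
    field
      at-root : a ≡ 0 → tag w b ≡ shared b
      deeper  : a ≢ 0 → tag w b ≡ tag w a
  open Below

  Heap : Set
  Heap = Address → ℕ → Node

  heap : World → Heap
  heap w = child (mem w)

  -- Paths go through Inner children only. A Rebuild node in a cell thus closes everything below it
  -- at once, which is what makes the subsequent marking safe.
  data Open (h : Heap) : Address → Set where
    top  : Open h 0
    down : ∀ {a i b} → Open h a → h a i ≡ inner b → Open h (Inner.address b)

  Orphan : Heap → Address → Set
  Orphan h a = ∀ {b i u} → h b i ≡ inner u → Inner.address u ≢ a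

  -- Unlike `Open`, these edges cross Rebuild nodes: marking, collecting and lookups follow them, so
  -- it is along them that the heap must be well-founded.
  data Points : Node → Address → Set where
    inner   : ∀ {u} → Points (inner u) (Inner.address u)
    rebuild : ∀ {op} → Points (rebuild op) (Inner.address (Rebuild.target op))

  Edge : Heap → Address → Address → Set
  Edge h b a = ∃[ i ] Points (h a i) b

  record RebuildOK (w : World) (op : Rebuild) : Set where
    field
      target-known  : Known w (inner (Rebuild.target op))
      target-public : Public w (Inner.address (Rebuild.target op))
      target-nonroot : Inner.address (Rebuild.target op) ≢ 0
      parent-known  : Known w (inner (Rebuild.parent op))
      parent-public : Public w (Inner.address (Rebuild.parent op))
      target-below  : Below w (Inner.address (Rebuild.parent op))
                              (Inner.address (Rebuild.target op))

  record Placed (w : World) (a : Address) (i : ℕ) (op : Rebuild) : Set where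
    field
      parent   : Inner.address (Rebuild.parent op) ≡ a
      index    : Rebuild.index op ≡ i
      closed   : ¬ Open (heap w) (Inner.address (Rebuild.target op))
      recorded : ⟪ a , i , labelOf (tag w a) ⟫ ∈ rebuilds w
      holder   : Public w a

  record Inv (w : World) : Set where
    field
      knowns      : ∀ a i → Known w (heap w a i)
      -- A new Inner node gets only the listed children; its remaining cells keep their initial
      -- content, which must therefore be known to be harmless.
      unallocated : ∀ {a i} → next (mem w) ≤ a → heap w a i ≡ empty 1
      root-known  : Known w (inner root)
      root-tag    : tag w 0 ≡ shared 0
      unique      : ∀ {a i u b j v} → heap w a i ≡ inner u → heap w b j ≡ inner v →
                    Inner.address u ≡ Inner.address v → a ≡ b × i ≡ j
      nonroot     : ∀ {a i u} → heap w a i ≡ inner u → Inner.address u ≢ 0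
      belows      : ∀ {a i u} → heap w a i ≡ inner u → Below w a (Inner.address u)
      rebuildOK   : ∀ {a op} → a < next (mem w) → nodeAt w a ≡ rebuild op → RebuildOK w op
      placed      : ∀ {a i op} → heap w a i ≡ rebuild op → Placed w a i op
      -- Publicity and allocation are included because `shut` keeps only allocated public nodes
      -- closed.
      marked      : ∀ {a} → status (mem w) a ≢ clean → ¬ Open (heap w) a × Public w a × a < next
          (mem w)
      wf          : WellFounded (Edge (heap w))
  open Inv

  below-public : ∀ {w a b} → Below w a b → Public w a → Public w b
  below-public {a = a} (below at-root deeper) (ℓ , t) with a ≟ 0
  ... | yes a≡0 = _ , at-root a≡0
  ... | no  a≢0 = ℓ , trans (deeper a≢0) t

  open-public : ∀ {w a} → Inv w → Open (heap w) a → Public w a × a < next (mem w)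
  open-public inv top = (0 , root-tag inv) , isAllocated (root-known inv)
  open-public inv (down {a} {i} o e) =
    below-public (belows inv e) (proj₁ (open-public {_} inv o)) ,
    subst (λ c → address c < _) e (isAllocated (knowns inv a i))

  -- An open path to the child must enter it through its only parent cell, hence pass through `a`.
  closed-child : ∀ {w a i u} → Inv w → heap w a i ≡ inner u → ¬ Open (heap w) a →
                 ¬ Open (heap w) (Inner.address u)
  closed-child {w} {a} {i} {u} inv e closed o = go o refl
    where
    go : ∀ {b} → Open (heap w) b → b ≡ Inner.address u → ⊥
    go top         eq = nonroot inv e (sym eq)
    go (down o e′) eq = closed (subst (Open (heap w)) (proj₁ (unique inv e′ e eq)) o)

  child-known : ∀ {w a i c} → Inv w → heap w a i ≡ c → Known w c
  child-known {a = a} {i} inv refl = knowns inv a i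

  placed-known : ∀ {w a i op} → Inv w → heap w a i ≡ rebuild op → RebuildOK w op
  placed-known inv e = let known lt eq = child-known inv e in rebuildOK inv lt eq

  points-below : ∀ {w a i c b} → Inv w → heap w a i ≡ c → Points c b → Below w a b
  points-below inv e inner   = belows inv e
  points-below {w} inv e rebuild =
    subst (λ a → Below w a _) (Placed.parent (placed inv e))
        (RebuildOK.target-below (placed-known inv e))

  points-known : ∀ {w a i c b} → Inv w → heap w a i ≡ c → Points c b → b < next (mem w)
  points-known inv e inner   = isAllocated (child-known inv e)
  points-known inv e rebuild = isAllocated (RebuildOK.target-known (placed-known inv e))

  -- Relations between a world and later worlds

  record Mono (w w′ : World) : Set where
    field
      next-≤ : next (mem w) ≤ next (mem w′)
      nodes  : ∀ {a} → a < next (mem w) → nodeAt w′ a ≡ nodeAt w a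
      tags   : ∀ {a ℓ} → a < next (mem w) → tag w a ≡ shared ℓ → tag w′ a ≡ shared ℓ
      -- Private nodes are excluded: they are closed now but may become open when published.
      shut   : ∀ {a} → a < next (mem w) → Public w a → ¬ Open (heap w) a → ¬ Open (heap w′) a
  open Mono

  record Keep (θ : Fin p) (w w′ : World) : Set where
    field
      stays  : ∀ {a} → a < next (mem w) → tag w a ≡ own θ → tag w′ a ≡ own θ
      orphan : ∀ {a} → a < next (mem w) → tag w a ≡ own θ → Orphan (heap w) a → Orphan (heap w′) a
  open Keep

  -- What thread θ may rely on while other threads take steps.
  Later : Fin p → World → World → Set
  Later θ w w′ = Mono w w′ × Keep θ w w′

  -- `P` selects nodes by their tag: all public nodes when updates are shown to terminate, the nodes
  -- with one fixed label for a lookup.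
  record SameCells (P : Tag → Set) (w w′ : World) : Set where
    constructor sameCells
    field
      same : ∀ {a} i → a < next (mem w) → P (tag w a) → heap w′ a i ≡ heap w a i
  open SameCells

  IsPublic : Tag → Set
  IsPublic t = ∃[ ℓ ] t ≡ shared ℓ

  Calm : World → World → Set
  Calm w w′ = Mono w w′ × SameCells IsPublic w w′

  mono-refl : ∀ {w} → Mono w w
  mono-refl = record { next-≤ = ≤-refl ; nodes = λ _ → refl ; tags = λ _ t → t ; shut = λ _ _ c →
      c }

  mono-trans : ∀ {u v w} → Mono u v → Mono v w → Mono u w
  mono-trans m n = record
    { next-≤ = ≤-trans (next-≤ m) (next-≤ n)
    ; nodes  = λ lt → trans (nodes n (<-≤-trans lt (next-≤ m))) (nodes m lt)
    ; tags   = λ lt t → tags n (<-≤-trans lt (next-≤ m)) (tags m lt t)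
    ; shut   = λ { lt (ℓ , t) c → shut n (<-≤-trans lt (next-≤ m)) (ℓ ,
        tags m lt t) (shut m lt (ℓ , t) c) }
    }

  keep-refl : ∀ {θ w} → Keep θ w w
  keep-refl = record { stays = λ _ t → t ; orphan = λ _ _ o → o }

  later-refl : ∀ {θ w} → Later θ w w
  later-refl = mono-refl , keep-refl

  later-trans : ∀ {θ u v w} → Later θ u v → Later θ v w → Later θ u w
  later-trans (m , k) (n , l) = mono-trans m n , record
    { stays  = λ lt t → stays l (<-≤-trans lt (next-≤ m)) (stays k lt t)
    ; orphan = λ lt t o → orphan l (<-≤-trans lt (next-≤ m)) (stays k lt t) (orphan k lt t o)
    }

  sameCells-trans : ∀ {u v w} (P : Tag → Set) → (∀ {t} → P t → ∃[ ℓ ] t ≡ shared ℓ) →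
    Mono u v → SameCells P u v → SameCells P v w → SameCells P u w
  sameCells-trans P P⇒public m s s′ = sameCells λ i lt t → let ℓ , e = P⇒public t in
    trans (same s′ i (<-≤-trans lt (next-≤ m)) (subst P (trans e (sym (tags m lt e))) t))
        (same s i lt t)

  calm-refl : ∀ {w} → Calm w w
  calm-refl = mono-refl , sameCells λ _ _ _ → refl

  calm-trans : ∀ {u v w} → Calm u v → Calm v w → Calm u w
  calm-trans (m , s) (n , s′) = mono-trans m n , sameCells-trans IsPublic id m s s′

  known-mono : ∀ {w w′ c} → Mono w w′ → Known w c → Known w′ c
  known-mono m (known lt e) = known (<-≤-trans lt (next-≤ m)) (trans (nodes m lt) e)

  public-mono : ∀ {w w′ a} → Mono w w′ → a < next (mem w) → Public w a → Public w′ a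
  public-mono m lt (ℓ , t) = ℓ , tags m lt t

  below-mono : ∀ {w w′ a b} → Mono w w′ → a < next (mem w) → b < next (mem w) → Public w a →
               Below w a b → Below w′ a b
  below-mono m a< b< (ℓ , t) (below at-root deeper) = below
    (λ a≡0 → tags m b< (at-root a≡0))
    (λ a≢0 → trans (tags m b< (trans (deeper a≢0) t)) (sym (tags m a< t)))

  rebuildOK-mono : ∀ {w w′ op} → Mono w w′ → RebuildOK w op → RebuildOK w′ op
  rebuildOK-mono m r = record
    { target-known  = known-mono m target-known
    ; target-public = public-mono m (isAllocated target-known) target-public
    ; target-nonroot = target-nonroot
    ; parent-known  = known-mono m parent-known
    ; parent-public = public-mono m (isAllocated parent-known) parent-public
    ; target-below  = below-mono m (isAllocated parent-known) (isAllocated target-known)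
        parent-public target-below
    }
    where open RebuildOK r

  open-calm : ∀ {w w′ a} → Inv w → SameCells IsPublic w w′ → Open (heap w) a → Open (heap w′) a
  open-calm inv s top = top
  open-calm {w} {w′} inv s (down {i = i} o e) = let pub , lt = open-public {w} inv o in
    down (open-calm {w} {w′} inv s o) (trans (same s i lt pub) e)

  open-calm⁻¹ : ∀ {w w′ a} → Inv w → SameCells IsPublic w w′ → Open (heap w′) a → Open (heap w) a
  open-calm⁻¹ inv s top = top
  open-calm⁻¹ {w} {w′} inv s (down {i = i} o e) =
    let o′ = open-calm⁻¹ {w} {w′} inv s o
        pub , lt = open-public {w} inv o′
    in down o′ (trans (sym (same s i lt pub)) e)

  -- Preservation of the invariant

  mono-same : ∀ {w w′} → Inv w → next (mem w) ≤ next (mem w′) →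
    (∀ {a} → a < next (mem w) → nodeAt w′ a ≡ nodeAt w a) →
    (∀ {a ℓ} → a < next (mem w) → tag w a ≡ shared ℓ → tag w′ a ≡ shared ℓ) →
    SameCells IsPublic w w′ → Calm w w′
  mono-same {w} {w′} inv n≤ ns ts s = record
    { next-≤ = n≤ ; nodes = ns ; tags = ts
    ; shut = λ _ _ closed o → closed (open-calm⁻¹ {w} {w′} inv s o) } , s

  inv-relabel : ∀ {w} s n → Inv w →
    (∀ {a} → s a ≢ clean → status (mem w) a ≢ clean ⊎
               (¬ Open (heap w) a × Public w a × a < next (mem w))) →
    Inv (record w { mem = record (mem w) { status = s ; count = n } })
  inv-relabel {w} s n inv ok = record
    { knowns = λ a i → let known lt e = knowns inv a i in known lt e
    ; unallocated = unallocated inv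
    ; root-known = let known lt e = root-known inv in known lt e
    ; root-tag = root-tag inv
    ; unique = unique inv
    ; nonroot = nonroot inv
    ; belows = λ e → let below r d = belows inv e in below r d
    ; rebuildOK = λ lt e → lift (rebuildOK inv lt e)
    ; placed = λ e → let r = placed inv e in record
        { parent = Placed.parent r ; index = Placed.index r ; closed = Placed.closed r
        ; recorded = Placed.recorded r ; holder = Placed.holder r }
    ; marked = λ ne → [ marked inv , id ]′ (ok ne)
    ; wf = wf inv
    }
    where
    w′ = record w { mem = record (mem w) { status = s ; count = n } }
    lift : ∀ {op} → RebuildOK w op → RebuildOK w′ op
    lift r = record
      { target-known = let known lt e = target-known in known lt e
      ; target-public = target-public
      ; target-nonroot = target-nonroot
      ; parent-known = let known lt e = parent-known in known lt e
      ; parent-public = parent-public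
      ; target-below = let below r d = target-below in below r d
      }
      where open RebuildOK r

  calm-relabel : ∀ {w} s n → Calm w (record w { mem = record (mem w) { status = s ; count = n } })
  calm-relabel s n = record
    { next-≤ = ≤-refl ; nodes = λ _ → refl ; tags = λ _ t → t ; shut = λ _ _ c → c } ,
    sameCells λ _ _ _ → refl

  keep-relabel : ∀ {w} s n {θ} → Keep θ w (record w { mem = record (mem w) { status = s ; count =
      n } })
  keep-relabel s n = record { stays = λ _ t → t ; orphan = λ _ _ o → o }

  setChild-hit : ∀ a i c μ → child (setChild a i c μ) a i ≡ c
  setChild-hit a i c μ rewrite ≡ᵇ-refl a | ≡ᵇ-refl i = refl

  setChild-miss : ∀ a i c μ {b j} → ¬ (a ≡ b × i ≡ j) → child (setChild a i c μ) b j ≡ child μ b j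
  setChild-miss a i c μ {b} {j} ne with a ≡ᵇ b in eq₁ | i ≡ᵇ j in eq₂
  ... | false | _     = refl
  ... | true  | false = refl
  ... | true  | true  = contradiction (≡ᵇ-true⇒≡ eq₁ , ≡ᵇ-true⇒≡ eq₂) ne

  -- The content `d` is an index, so that abstracting a cell together with its view lets a match
  -- replace the content throughout the goal.
  data CellView (a : Address) (i : ℕ) (c : Node) (h : Heap) (b : Address) (j : ℕ) (d : Node) : Set
      where
    hit  : a ≡ b → i ≡ j → d ≡ c → CellView a i c h b j d
    miss : ¬ (a ≡ b × i ≡ j) → d ≡ h b j → CellView a i c h b j d

  cellView : ∀ a i c μ b j → CellView a i c (child μ) b j (child (setChild a i c μ) b j)
  cellView a i c μ b j with a ≟ b | i ≟ j
  ... | yes refl | yes refl = hit refl refl (setChild-hit a i c μ)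
  ... | yes _    | no i≢j   = miss (i≢j ∘ proj₂) (setChild-miss a i c μ (i≢j ∘ proj₂))
  ... | no a≢b   | _        = miss (a≢b ∘ proj₁) (setChild-miss a i c μ (a≢b ∘ proj₁))

  data At : List Node → ℕ → Node → Set where
    here  : ∀ {c cs} → At (c ∷ cs) 0 c
    there : ∀ {c d cs i} → At cs i c → At (d ∷ cs) (suc i) c

  at-all : ∀ {P : Node → Set} {cs i c} → All P cs → At cs i c → P c
  at-all (px ∷ _)   here       = px
  at-all (_  ∷ pxs) (there at) = at-all pxs at

  Distinct : List Node → Set
  Distinct = AllPairs λ c d → address c ≢ address d

  at-unique : ∀ {cs i j c d} → Distinct cs → At cs i c → At cs j d → address c ≡ address d → i ≡ j
  at-unique _        here       here       _ = refl
  at-unique (ne ∷ _) here       (there at) e = contradiction e (at-all ne at)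
  at-unique (ne ∷ _) (there at) here       e = contradiction (sym e) (at-all ne at)
  at-unique (_ ∷ ds) (there at) (there bt) e = cong suc (at-unique ds at bt e)

  setChildren-other : ∀ a k cs μ {b j} → a ≢ b → child (setChildren a k cs μ) b j ≡ child μ b j
  setChildren-other a k []       μ a≢b = refl
  setChildren-other a k (c ∷ cs) μ a≢b =
    trans (setChildren-other a (suc k) cs (setChild a k c μ) a≢b)
        (setChild-miss a k c μ (a≢b ∘ proj₁))

  setChildren-view : ∀ a k cs μ j → child (setChildren a k cs μ) a j ≡ child μ a j ⊎
    ∃[ i ] j ≡ k + i × At cs i (child (setChildren a k cs μ) a j)
  setChildren-view a k []       μ j = inj₁ refl
  setChildren-view a k (c ∷ cs) μ j with setChildren-view a (suc k) cs (setChild a k c μ) j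
  ... | inj₂ (i , e , at) = inj₂ (suc i , trans e (sym (+-suc k i)) , there at)
  ... | inj₁ e with cellView a k c μ a j
  ...   | miss _ e′      = inj₁ (trans e e′)
  ...   | hit _ k≡j e′ = inj₂ (0 , trans (sym k≡j) (sym (+-identityʳ k)) ,
                                  subst (At (c ∷ cs) 0) (sym (trans e e′)) here)

  setChildren-next : ∀ a k cs μ → next (setChildren a k cs μ) ≡ next μ
  setChildren-next a k []       μ = refl
  setChildren-next a k (c ∷ cs) μ = setChildren-next a (suc k) cs _

  setChildren-status : ∀ a k cs μ → status (setChildren a k cs μ) ≡ status μ
  setChildren-status a k []       μ = refl
  setChildren-status a k (c ∷ cs) μ = setChildren-status a (suc k) cs _

  setChildren-count : ∀ a k cs μ → count (setChildren a k cs μ) ≡ count μ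
  setChildren-count a k []       μ = refl
  setChildren-count a k (c ∷ cs) μ = setChildren-count a (suc k) cs _

  -- Leaves are immutable, so sharing them is harmless. An Inner node must be private and lie in no
  -- cell, for otherwise writing it would give it a second parent cell.
  data Own (θ : Fin p) (w : World) : Node → Set where
    empty  : ∀ {a} → Known w (empty a) → Own θ w (empty a)
    single : ∀ {a k v} → Known w (single a k v) → Own θ w (single a k v)
    inner  : ∀ {u} → Known w (inner u) → tag w (Inner.address u) ≡ own θ →
             Orphan (heap w) (Inner.address u) → Own θ w (inner u)

  own-known : ∀ {θ w c} → Own θ w c → Known w c
  own-known (empty k)     = k
  own-known (single k)    = k
  own-known (inner k _ _) = k

  own-later : ∀ {θ w w′ c} → Later θ w w′ → Own θ w c → Own θ w′ c
  own-later (m , k) (empty kn)  = empty (known-mono m kn)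
  own-later (m , k) (single kn) = single (known-mono m kn)
  own-later (m , k) (inner kn t o) =
    inner (known-mono m kn) (stays k (isAllocated kn) t) (orphan k (isAllocated kn) t o)

  -- Allocation of one node

  record Alloc (θ : Fin p) (w : World) (c : Node) (cs : List Node) (μ′ : Memory) : Set where
    field
      next′    : next μ′ ≡ suc (next (mem w))
      fresh    : address c ≡ next (mem w)
      old      : ∀ {a} i → a ≢ next (mem w) → child μ′ a i ≡ heap w a i
      new      : ∀ i → child μ′ (next (mem w)) i ≡ heap w (next (mem w)) i ⊎
                       At cs i (child μ′ (next (mem w)) i)
      status′  : ∀ {a} → status μ′ a ≢ clean → status (mem w) a ≢ clean
      count′   : ∀ {a} → a < next (mem w) → count μ′ a ≡ count (mem w) a
      owned    : All (Own θ w) cs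
      distinct : Distinct cs
      rebuilt  : ∀ {op} → c ≡ rebuild op → RebuildOK w op

  alloc-calm : ∀ {θ w c μ′} → Inv w → next μ′ ≡ suc (next (mem w)) →
    (∀ {a} i → a ≢ next (mem w) → child μ′ a i ≡ heap w a i) → Calm w (allocated θ w c μ′)
  alloc-calm {w = w} inv next′ old = mono-same inv (≤-trans (n≤1+n _) (≤-reflexive (sym next′)))
    (λ lt → ↦-other (nodeAt w) (>⇒≢ lt)) (λ lt t → trans (↦-other (tag w) (>⇒≢ lt)) t)
    (sameCells λ i lt _ → old i (<⇒≢ lt))

  module Allocation {θ : Fin p} {w : World} {c : Node} {cs : List Node} {μ′ : Memory}
                    (inv : Inv w) (al : Alloc θ w c cs μ′) where
    open Alloc al

    w′ = allocated θ w c μ′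
    a₀ = next (mem w)

    new′ : ∀ i → child μ′ a₀ i ≡ empty 1 ⊎ At cs i (child μ′ a₀ i)
    new′ i with new i
    ... | inj₁ e  = inj₁ (trans e (unallocated inv ≤-refl))
    ... | inj₂ at = inj₂ at

    tags′ : ∀ {a} → a < a₀ → tag w′ a ≡ tag w a
    tags′ lt = ↦-other (tag w) (>⇒≢ lt)

    mono : Mono w w′
    mono = proj₁ (alloc-calm inv next′ old)

    new-known : Known w′ c
    new-known = known (≤-reflexive (trans (cong suc fresh) (sym next′)))
                      (trans (cong (nodeAt w′) fresh) (↦-same (nodeAt w) a₀))

    new-tag : tag w′ (address c) ≡ own θ
    new-tag = trans (cong (tag w′) fresh) (↦-same (tag w) a₀)

    data View (a : Address) (i : ℕ) : Node → Set where
      isOld : a ≢ a₀ → View a i (heap w a i)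
      isNil : a ≡ a₀ → View a i (empty 1)
      isNew : ∀ {d} → a ≡ a₀ → At cs i d → Own θ w d → View a i d

    view : ∀ a i → View a i (child μ′ a i)
    view a i with a ≟ a₀
    ... | no a≢a₀ = subst (View a i) (sym (old i a≢a₀)) (isOld a≢a₀)
    ... | yes refl with new′ i
    ...   | inj₁ e  = subst (View a i) (sym e) (isNil refl)
    ...   | inj₂ at = isNew refl at (at-all owned at)

    private
      allocated< : ∀ {a i u} → heap w a i ≡ inner u → Inner.address u < a₀
      allocated< e = isAllocated (child-known inv e)

      own≢0 : ∀ {u} → Own θ w (inner u) → Inner.address u ≢ 0
      own≢0 (inner _ t _) refl with () ← trans (sym t) (root-tag inv)

      a₀≢0 : a₀ ≢ 0
      a₀≢0 e with () ← subst (0 <_) e (isAllocated (root-known inv))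

      knowns′ : ∀ a i → Known w′ (child μ′ a i)
      knowns′ a i with child μ′ a i | view a i
      ... | _ | isOld _       = known-mono mono (knowns inv a i)
      ... | _ | isNil _       =
        known-mono mono (subst (Known w) (unallocated inv ≤-refl) (knowns inv a₀ 0))
      ... | _ | isNew _ _ o = known-mono mono (own-known o)

      unique′ : ∀ {a i u b j v} → child μ′ a i ≡ inner u → child μ′ b j ≡ inner v →
                Inner.address u ≡ Inner.address v → a ≡ b × i ≡ j
      unique′ {a} {i} {u} {b} {j} {v} e f eq with child μ′ a i | view a i | child μ′ b j | view b j
      ... | _ | isOld _ | _ | isOld _ = unique inv e f eq
      ... | _ | isOld _ | _ | isNew _ _ (inner _ _ o) with refl ← f = contradiction eq (o e)
      ... | _ | isNew _ _ (inner _ _ o) | _ | isOld _ with refl ← e = contradiction (sym eq) (o f)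
      ... | _ | isNew a≡ at _ | _ | isNew b≡ bt _ with refl ← e | refl ← f =
        trans a≡ (sym b≡) , at-unique distinct at bt eq
      unique′ () _ _ | _ | isNil _ | _ | _
      unique′ _ () _ | _ | _ | _ | isNil _

      nonroot′ : ∀ {a i u} → child μ′ a i ≡ inner u → Inner.address u ≢ 0
      nonroot′ {a} {i} e with child μ′ a i | view a i
      ... | _ | isOld _       = nonroot inv e
      ... | _ | isNew _ _ o with refl ← e = own≢0 o
      nonroot′ () | _ | isNil _

      belows′ : ∀ {a i u} → child μ′ a i ≡ inner u → Below w′ a (Inner.address u)
      belows′ {a} {i} e with child μ′ a i | view a i
      ... | _ | isOld a≢a₀ = let below r d = belows inv e in
        below (λ a≡0 → trans (tags′ (allocated< e)) (r a≡0))
              (λ a≢0 → trans (tags′ (allocated< e))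
                         (trans (d a≢0) (sym (↦-other (tag w) (≢-sym a≢a₀)))))
      ... | _ | isNew refl _ (inner k t _) with refl ← e =
        below (λ a≡0 → contradiction a≡0 a₀≢0)
              (λ _ → trans (tags′ (isAllocated k)) (trans t (sym (↦-same (tag w) a₀))))
      belows′ () | _ | isNil _

      rebuildOK′ : ∀ {a op} → a < next μ′ → nodeAt w′ a ≡ rebuild op → RebuildOK w′ op
      rebuildOK′ {a} lt e with a ≟ a₀
      ... | yes refl = rebuildOK-mono mono (rebuilt (trans (sym (↦-same (nodeAt w) a₀)) e))
      ... | no a≢a₀  = rebuildOK-mono mono (rebuildOK inv
        (≤∧≢⇒< (≤-pred (subst (a <_) next′ lt)) a≢a₀)
        (trans (sym (↦-other (nodeAt w) (≢-sym a≢a₀))) e))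

      placed′ : ∀ {a i op} → child μ′ a i ≡ rebuild op → Placed w′ a i op
      placed′ {a} {i} e with child μ′ a i | view a i
      ... | _ | isOld a≢a₀ = let
          open Placed (placed inv e)
          r = placed-known inv e
          t = ↦-other (tag w) (≢-sym a≢a₀)
        in record
        { parent = parent ; index = index
        ; closed = shut mono (isAllocated (RebuildOK.target-known r)) (RebuildOK.target-public r)
            closed
        ; recorded = subst (λ t → ⟪ a , i , labelOf t ⟫ ∈ rebuilds w) (sym t) recorded
        ; holder = proj₁ holder , trans t (proj₂ holder)
        }
      placed′ () | _ | isNil _
      placed′ refl | _ | isNew _ _ ()

      -- Old nodes point only to allocated nodes, so the new node is not met below them. The new
      -- node in turn points only to old ones.
      acc-old : ∀ {a} → a ≢ a₀ → Acc (Edge (heap w)) a → Acc (Edge (heap w′)) a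
      acc-old {a} a≢a₀ (acc rs) = acc λ { (i , pts) →
        let pts′ = subst (λ c → Points c _) (old i a≢a₀) pts in
        acc-old (<⇒≢ (points-known inv refl pts′)) (rs (i , pts′)) }

      wf′ : WellFounded (Edge (heap w′))
      wf′ a with a ≟ a₀
      ... | no a≢a₀ = acc-old a≢a₀ (wf inv a)
      ... | yes refl = acc λ { (i , pts) → below-new i pts }
        where
        below-new : ∀ {b} i → Points (child μ′ a₀ i) b → Acc (Edge (heap w′)) b
        below-new i pts with child μ′ a₀ i | view a₀ i
        below-new i pts | _ | isOld ne = contradiction refl ne
        below-new i inner | _ | isNew _ _ (inner k _ _) = acc-old (<⇒≢ (isAllocated k)) (wf inv _)

      marked′ : ∀ {a} → status μ′ a ≢ clean → ¬ Open (heap w′) a × Public w′ a × a < next μ′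
      marked′ ne = let closed , pub , lt = marked inv (status′ ne) in
        shut mono lt pub closed , public-mono mono lt pub , <-≤-trans lt (next-≤ mono)

    inv′ : Inv w′
    inv′ = record
      { knowns = knowns′
      ; unallocated = λ le → let lt = subst (_≤ _) next′ le in
          trans (old _ (>⇒≢ lt)) (unallocated inv (<⇒≤ lt))
      ; root-known = known-mono mono (root-known inv)
      ; root-tag = tags mono (isAllocated (root-known inv)) (root-tag inv)
      ; unique = unique′
      ; nonroot = nonroot′
      ; belows = belows′
      ; rebuildOK = rebuildOK′
      ; placed = placed′
      ; marked = marked′
      ; wf = wf′
      }

    orphan′ : ∀ {a} → All (λ d → ∀ {u} → d ≡ inner u → Inner.address u ≢ a) cs → Orphan (heap w) a →
        Orphan (heap w′) a
    orphan′ {a} ne o {b} {i} e with child μ′ b i | view b i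
    ... | _ | isOld _     = o e
    ... | _ | isNew _ at _ with refl ← e = at-all ne at refl
    orphan′ ne o () | _ | isNil _

    new-orphan : Orphan (heap w′) (address c)
    new-orphan {b} {i} e eq with child μ′ b i | view b i
    ... | _ | isOld _ = <⇒≢ (allocated< e) (trans eq fresh)
    ... | _ | isNew _ _ (inner k _ _) with refl ← e = <⇒≢ (isAllocated k) (trans eq fresh)
    new-orphan () _ | _ | isNil _

    rely′ : ∀ {θ′} → θ′ ≢ θ → Keep θ′ w w′
    rely′ θ′≢θ = record
      { stays  = λ lt t → trans (tags′ lt) t
      ; orphan = λ lt t → orphan′ (All.map (λ { (inner _ s _) refl refl →
                   contradiction (own-inj t s) θ′≢θ }) owned)
      }
      where
      own-inj : ∀ {a θ₁ θ₂} → tag w a ≡ own θ₁ → tag w a ≡ own θ₂ → θ₁ ≡ θ₂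
      own-inj e f with refl ← trans (sym e) f = refl

  -- Successful DCSS on a cell of a public node

  data Writable (θ : Fin p) (w : World) (n : Address) (i : ℕ) : Node → Set where
    fresh   : ∀ {c} → Own θ w c → Writable θ w n i c
    rebuild : ∀ {op} → Known w (rebuild op) → heap w n i ≡ inner (Rebuild.target op) →
              Inner.address (Rebuild.parent op) ≡ n → Rebuild.index op ≡ i →
              Writable θ w n i (rebuild op)

  module Writing {θ : Fin p} {w : World} {q : Inner} {i : ℕ} {c : Node}
                 (inv : Inv w) (n< : Inner.address q < next (mem w))
                 (holder : Public w (Inner.address q))
                 (value : Writable θ w (Inner.address q) i c) where

    n  = Inner.address q
    μ′ = setChild n i c (mem w)
    w′ = written θ w q i c μ′
    t₀ = publicTag w n c

    value-known : Known w c
    value-known = go value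
      where
      go : ∀ {d} → Writable θ w n i d → Known w d
      go (fresh o)         = own-known o
      go (rebuild k _ _ _) = k

    private
      tags′ : ∀ {a ℓ} → tag w a ≡ shared ℓ → tag w′ a ≡ shared ℓ
      tags′ {a} e = cong (publish θ t₀) e

      below-n : ∀ {u} → c ≡ inner u → Below w′ n (Inner.address u)
      below-n e = go value e refl
        where
        go : ∀ {d u} → Writable θ w n i d → d ≡ inner u → d ≡ c → Below w′ n (Inner.address u)
        go (fresh (inner k t _)) refl refl = below
          (λ n≡0 → trans (cong (publish θ t₀) t) (trans (publish-private θ t₀)
            (cong (λ b → if b then shared (address c) else tag w n) (cong (_≡ᵇ 0) n≡0))))
          (λ n≢0 → trans (cong (publish θ t₀) t) (trans (publish-private θ t₀)
            (trans (cong (λ b → if b then shared (address c) else tag w n) (≢⇒≡ᵇ-false n≢0))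
                   (trans (proj₂ holder) (sym (tags′ (proj₂ holder)))))))

      view : ∀ a j → CellView n i c (heap w) a j (heap w′ a j)
      view = cellView n i c (mem w)

      data Unpublished (a : Address) : Set where
        unpublished : tag w a ≡ own θ → Unpublished a

      not-n : ∀ {a} → Unpublished a → a ≢ n
      not-n (unpublished t) refl with () ← trans (sym t) (proj₂ holder)

      nonzero : ∀ {a} → Unpublished a → a ≢ 0
      nonzero (unpublished t) refl with () ← trans (sym t) (root-tag inv)

      -- A write never reopens a public node. An open path that uses the written cell enters a
      -- private node, and children of private nodes carry the same tag, so the rest of the path is
      -- private too.
      open-old : ∀ {a} → Open (heap w′) a → Open (heap w) a ⊎ Unpublished a
      open-old top = inj₁ top
      open-old (down {a} {j} o e) with heap w′ a j | view a j
      ... | _ | hit _ _ refl = inj₂ (from-value value e)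
        where
        from-value : ∀ {c u} → Writable θ w n i c → c ≡ inner u → Unpublished (Inner.address u)
        from-value (fresh (inner _ t _)) refl = unpublished t
      ... | _ | miss _ refl with open-old o
      ...   | inj₁ o′ = inj₁ (down o′ e)
      ...   | inj₂ u@(unpublished t) = inj₂ (unpublished (trans (deeper (belows inv e) (nonzero u))
          t))

    mono : Mono w w′
    mono = record
      { next-≤ = ≤-refl ; nodes = λ _ → refl ; tags = λ _ → tags′
      ; shut = λ { _ (_ , t) closed o → [ closed , (λ { (unpublished t′) →
          case trans (sym t) t′ of λ () }) ]′ (open-old o) }
      }

    cell : heap w′ n i ≡ c
    cell = setChild-hit n i c (mem w)

    elsewhere : ∀ {a j} → ¬ (n ≡ a × i ≡ j) → heap w′ a j ≡ heap w a j
    elsewhere = setChild-miss n i c (mem w)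

    private
      lift : ∀ {d} → Known w d → Known w′ d
      lift = known-mono mono

      knowns′ : ∀ a j → Known w′ (heap w′ a j)
      knowns′ a j with heap w′ a j | view a j
      ... | _ | hit _ _ refl = lift value-known
      ... | _ | miss _ refl  = lift (knowns inv a j)

      fresh-orphan : ∀ {u} → c ≡ inner u → Orphan (heap w) (Inner.address u) × Unpublished
          (Inner.address u)
      fresh-orphan e = go value e
        where
        go : ∀ {d u} → Writable θ w n i d → d ≡ inner u →
             Orphan (heap w) (Inner.address u) × Unpublished (Inner.address u)
        go (fresh (inner _ t o)) refl = o , unpublished t

      unique′ : ∀ {a j u b k v} → heap w′ a j ≡ inner u → heap w′ b k ≡ inner v →
                Inner.address u ≡ Inner.address v → a ≡ b × j ≡ k
      unique′ {a} {j} {u} {b} {k} {v} e f eq with heap w′ a j | view a j | heap w′ b k | view b k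
      ... | _ | miss _ refl | _ | miss _ refl = unique inv e f eq
      ... | _ | hit _ _ refl | _ | miss _ refl =
        contradiction (sym eq) (proj₁ (fresh-orphan e) f)
      ... | _ | miss _ refl | _ | hit _ _ refl =
        contradiction eq (proj₁ (fresh-orphan f) e)
      ... | _ | hit refl refl _ | _ | hit refl refl _ = refl , refl

      nonroot′ : ∀ {a j u} → heap w′ a j ≡ inner u → Inner.address u ≢ 0
      nonroot′ {a} {j} e with heap w′ a j | view a j
      ... | _ | hit _ _ refl = nonzero (proj₂ (fresh-orphan e))
      ... | _ | miss _ refl  = nonroot inv e

      belows′ : ∀ {a j u} → heap w′ a j ≡ inner u → Below w′ a (Inner.address u)
      belows′ {a} {j} e with heap w′ a j | view a j
      ... | _ | hit refl _ refl = below-n e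
      ... | _ | miss _ refl = let below r d = belows inv e in
        below (tags′ ∘ r) (cong (publish θ t₀) ∘ d)

      label′ : ∀ {a} → Public w a → labelOf (tag w′ a) ≡ labelOf (tag w a)
      label′ (_ , t) = cong labelOf (trans (tags′ t) (sym t))

      inCell-other : ∀ {a j ℓ} → ¬ (n ≡ a × i ≡ j) → inCell n i ⟪ a , j , ℓ ⟫ ≡ false
      inCell-other {a} {j} ne with n ≡ᵇ a in eq | i ≡ᵇ j in eq′
      ... | false | _     = refl
      ... | true  | false = refl
      ... | true  | true  = contradiction (≡ᵇ-true⇒≡ eq , ≡ᵇ-true⇒≡ eq′) ne

      recorded′ : ∀ {a j ℓ} → ¬ (n ≡ a × i ≡ j) → ⟪ a , j , ℓ ⟫ ∈ rebuilds w →
          ⟪ a , j , ℓ ⟫ ∈ rebuilds w′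
      recorded′ {ℓ = ℓ} ne m = go c m (inCell-other {ℓ = ℓ} ne)
        where
        go : ∀ c {x} → x ∈ rebuilds w → inCell n i x ≡ false → x ∈ recordWrite w n i c
        go (rebuild _) m e = there m
        go (inner _) m e = ∈-removeᵇ (inCell n i) m e
        go (empty _) m e = ∈-removeᵇ (inCell n i) m e
        go (single _ _ _) m e = ∈-removeᵇ (inCell n i) m e

      placed′ : ∀ {a j op} → heap w′ a j ≡ rebuild op → Placed w′ a j op
      placed′ {a} {j} e with heap w′ a j | view a j
      ... | _ | miss ne refl = let
          open Placed (placed inv e) renaming (holder to holder₀)
          r = placed-known inv e
        in record
        { parent = parent ; index = index
        ; closed = shut mono (isAllocated (RebuildOK.target-known r)) (RebuildOK.target-public r)
            closed
        ; recorded = subst (λ ℓ → ⟪ a , j , ℓ ⟫ ∈ rebuilds w′) (sym (label′ holder₀))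
            (recorded′ ne recorded)
        ; holder = _ , tags′ (proj₂ holder₀)
        }
      ... | _ | hit refl refl refl = go value e refl
        where
        go : ∀ {d op} → Writable θ w n i d → d ≡ rebuild op → d ≡ c → Placed w′ n i op
        go (fresh (empty _)) () _
        go (fresh (single _)) () _
        go (fresh (inner _ _ _)) () _
        go (rebuild {op} k at parent index) refl refl = record
          { parent = parent ; index = index
          ; closed = λ o → closed o refl
          ; recorded = here (cong ⟪ n , i ,_⟫ (label′ holder))
          ; holder = _ , tags′ (proj₂ holder)
          }
          where
          -- The last cell of an open path to the target would hold the target. By `unique` this is
          -- the cell just overwritten, which now holds `op`.
          closed : ∀ {b} → Open (heap w′) b → b ≢ Inner.address (Rebuild.target op)
          closed top eq = nonroot inv at (sym eq)
          closed (down {a} {j} o e) eq with heap w′ a j | view a j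
          closed (down {a} {j} o ()) eq | _ | hit _ _ refl
          ... | _ | miss ne refl = ne (unique inv at e (sym eq))

      -- The written cell belongs to a public node, and whatever a private node points to is
      -- private, so nothing changes along these edges.
      acc-unpublished : ∀ {a} → Unpublished a → Acc (Edge (heap w)) a → Acc (Edge (heap w′)) a
      acc-unpublished {a} u@(unpublished t) (acc rs) = acc λ { (j , pts) →
        let e    = elsewhere {a} {j} (not-n u ∘ sym ∘ proj₁)
            pts′ = subst (λ d → Points d _) e pts
        in acc-unpublished (unpublished (trans (deeper (points-below inv refl pts′) (nonzero u)) t))
                           (rs (j , pts′)) }

      acc-any : ∀ {a} → Acc (Edge (heap w)) a → Acc (Edge (heap w′)) a
      acc-any {a} (acc rs) = acc λ { (j , pts) → go j pts }
        where
        go : ∀ {b} j → Points (heap w′ a j) b → Acc (Edge (heap w′)) b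
        go j pts with heap w′ a j | view a j
        ... | _ | miss _ refl = acc-any (rs (j , pts))
        ... | _ | hit refl refl refl = from-value value pts
          where
          from-value : ∀ {d b} → Writable θ w n i d → Points d b → Acc (Edge (heap w′)) b
          from-value (fresh (inner _ t _)) inner = acc-unpublished (unpublished t) (wf inv _)
          -- The edge to the target is not new: the cell held the target itself before.
          from-value (rebuild _ at _ _) rebuild  = acc-any (rs (i ,
              subst (λ d → Points d _) (sym at) inner))

    inv′ : Inv w′
    inv′ = record
      { knowns = knowns′
      ; unallocated = λ le → trans (elsewhere λ { (refl , _) → <⇒≱ n< le }) (unallocated inv le)
      ; root-known = lift (root-known inv)
      ; root-tag = tags′ (root-tag inv)
      ; unique = unique′
      ; nonroot = nonroot′
      ; belows = belows′
      ; rebuildOK = λ lt e → rebuildOK-mono mono (rebuildOK inv lt e)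
      ; placed = placed′
      ; marked = λ ne → let closed , pub , lt = marked inv ne in
          shut mono lt pub closed , public-mono mono lt pub , lt
      ; wf = λ a → acc-any (wf inv a)
      }

    rely′ : ∀ {θ′} → θ′ ≢ θ → Keep θ′ w w′
    rely′ θ′≢θ = record
      { stays  = λ lt t → trans (cong (publish θ t₀) t) (publish-other t₀ θ′≢θ)
      ; orphan = λ lt t o {b} {j} → keeps t o {b} {j}
      }
      where
      own-inj : ∀ {a θ₁ θ₂} → tag w a ≡ own θ₁ → tag w a ≡ own θ₂ → θ₁ ≡ θ₂
      own-inj e f with refl ← trans (sym e) f = refl
      keeps : ∀ {a} → tag w a ≡ own _ → Orphan (heap w) a → Orphan (heap w′) a
      keeps t o {b} {j} e eq with heap w′ b j | view b j
      ... | _ | miss _ refl  = o e eq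
      ... | _ | hit _ _ refl with unpublished t′ ← proj₂ (fresh-orphan e) | refl ← eq =
        θ′≢θ (own-inj t t′)

  -- Phases and potentials

  -- The phases of a thread: `away` when idle or in a lookup; `seeking ℓ` when
  -- descending, at a node labelled ℓ; `pending ℓ` from its successful update
  -- below ℓ until it increments the count of ℓ; `reading ℓ` until it reads that
  -- count; then `closing ℓ` if it rebuilds ℓ itself and `rebuilding ℓ` if it may
  -- rebuild a node strictly below ℓ.
  data Phase : Set where
    away done : Phase
    seeking pending reading closing rebuilding : (ℓ : Address) → Phase

  phaseLabel : Phase → Address
  phaseLabel away           = 0
  phaseLabel done           = 0
  phaseLabel (seeking ℓ)    = ℓ
  phaseLabel (pending ℓ)    = ℓ
  phaseLabel (reading ℓ)    = ℓ
  phaseLabel (closing ℓ)    = ℓ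
  phaseLabel (rebuilding ℓ) = ℓ

  -- An update replaces at most one leaf and installs at most one Rebuild node,
  -- and each Rebuild node is replaced at most once.
  credit : Phase → ℕ
  credit away           = 4
  credit (seeking _)    = 3
  credit (pending _)    = 2
  credit (reading _)    = 2
  credit (closing _)    = 2
  credit (rebuilding _) = 2
  credit done           = 0

  total : World → ℕ
  total w = countᵇ (λ _ → true) (rebuilds w)

  cost : Bool → ℕ
  cost b = if b then 1 else 0

  Paid : Bool → World → Phase → World → Phase → Set
  Paid b w φ w′ φ′ = cost b + (credit φ′ + total w′) ≤ credit φ + total w

  -- The share of a thread that is not below the top node: one leaf replacement while it may still
  -- enter from the root, nothing after the detachment.
  outside : Bool → ℕ
  outside b = if b then 1 else 0

  -- `rank x b s φ` is the part of a thread in phase φ in the number of changes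
  -- that may still be made below the top node x.  Here b tells whether x is
  -- still the child of the root, and s is the number of increments after which
  -- the count of x exceeds the rebuild threshold for sure; once s is 0, every
  -- thread that is about to read the count of x detaches x.
  mine : Bool → ℕ → Phase → ℕ
  mine true  s       (seeking _)    = 1
  mine true  s       (pending _)    = 0
  mine true  zero    (reading _)    = 0
  mine true  (suc s) (reading _)    = 3
  mine true  s       (closing _)    = 0
  mine true  s       (rebuilding _) = 3
  mine true  s       away           = 1
  mine true  s       done           = 1
  mine false s       (seeking _)    = 3
  mine false s       (pending _)    = 2
  mine false s       (reading _)    = 2
  mine false s       (closing _)    = 2
  mine false s       (rebuilding _) = 2
  mine false s       away           = 0
  mine false s       done           = 0

  rank : Address → Bool → ℕ → Phase → ℕ
  rank x b s φ = if phaseLabel φ ≡ᵇ x then mine b s φ else outside b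

  rank-mine : ∀ {x b s φ} → phaseLabel φ ≡ x → rank x b s φ ≡ mine b s φ
  rank-mine {φ = φ} refl rewrite ≡ᵇ-refl (phaseLabel φ) = refl

  rank-outside : ∀ {x b s φ} → phaseLabel φ ≢ x → rank x b s φ ≡ outside b
  rank-outside ne rewrite ≢⇒≡ᵇ-false ne = refl

  attached : Inner → World → Bool
  attached u w = address (heap w 0 0) ≡ᵇ Inner.address u

  -- Truncated subtraction is intended: once the count has reached `N`, further increments leave the
  -- slack at 0.
  slack : ℕ → Inner → World → ℕ
  slack N u w = N ∸ count (mem w) (Inner.address u)

  labelled : Address → Cell → Bool
  labelled x ⟪ _ , _ , ℓ ⟫ = ℓ ≡ᵇ x

  pendingBelow : Inner → World → ℕ
  pendingBelow u w = countᵇ (labelled (Inner.address u)) (rebuilds w)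

  -- Defined by the label and not by the current child of the root, so a detached node remains a top
  -- node and the lookup can go on referring to it.
  record TopNode (w : World) (u : Inner) : Set where
    field
      isKnown  : Known w (inner u)
      isTop    : tag w (Inner.address u) ≡ shared (Inner.address u)
      notRoot  : Inner.address u ≢ 0
  open TopNode

  topNode-mono : ∀ {w w′ u} → Mono w w′ → TopNode w u → TopNode w′ u
  topNode-mono m t = record
    { isKnown = known-mono m (isKnown t) ; isTop = tags m (isAllocated (isKnown t)) (isTop t)
    ; notRoot = notRoot t }

  Threshold : Inner → ℕ → Set
  Threshold u N = ∀ c → N ≤ c → atLeast R c (Inner.initSize u) ≡ true

  SameBelow : Inner → World → World → Set
  SameBelow u = SameCells (_≡ shared (Inner.address u))

  -- One step in the lexicographic order: detaching leaves slack and ranks unconstrained, counting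
  -- leaves the ranks unconstrained. Only `keeps` has to promise unchanged cells below `u`. The
  -- variables `x`, `b`, `s` come with equations so that proofs can split on them.
  data Moves (u : Inner) (N : ℕ) (w : World) (φ : Phase) (w′ : World) (φ′ : Phase) : Set where
    detaches : attached u w ≡ true → attached u w′ ≡ false → Moves u N w φ w′ φ′
    counts   : attached u w′ ≡ attached u w → slack N u w′ < slack N u w → Moves u N w φ w′ φ′
    spends   : attached u w′ ≡ attached u w → slack N u w′ ≡ slack N u w →
               (∀ {x b s} → x ≡ Inner.address u → b ≡ attached u w → s ≡ slack N u w →
                 rank x b s φ′ + pendingBelow u w′ < rank x b s φ + pendingBelow u w) →
               Moves u N w φ w′ φ′
    keeps    : attached u w′ ≡ attached u w → slack N u w′ ≡ slack N u w →
               (∀ {x b s} → x ≡ Inner.address u → b ≡ attached u w → s ≡ slack N u w →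
                 rank x b s φ′ + pendingBelow u w′ ≤ rank x b s φ + pendingBelow u w) →
               SameBelow u w w′ →
               Moves u N w φ w′ φ′

  record Improves (w : World) (φ φ′ : Phase) : Set where
    constructor improves
    field
      rank-≤ : ∀ {u N x b s} → TopNode w u → Threshold u N →
               x ≡ Inner.address u → b ≡ attached u w → s ≡ slack N u w →
               rank x b s φ′ ≤ rank x b s φ
  open Improves

  record Tr (θ : Fin p) (w : World) (φ : Phase) (w′ : World) (φ′ : Phase) : Set where
    field
      tr-inv   : Inv w′
      tr-mono  : Mono w w′
      tr-rely  : ∀ {θ′} → θ′ ≢ θ → Keep θ′ w w′
      tr-moves : ∀ {u N} → TopNode w u → Threshold u N → Moves u N w φ w′ φ′
  open Tr

  improves-refl : ∀ {w φ} → Improves w φ φ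
  improves-refl = improves λ _ _ _ _ _ → ≤-refl

  -- No top node has label 0.
  improves-leave : ∀ {w φ φ′} → phaseLabel φ′ ≡ 0 →
    (∀ {u N b s} → TopNode w u → Threshold u N → phaseLabel φ ≡ Inner.address u →
       b ≡ attached u w → s ≡ slack N u w → outside b ≤ mine b s φ) →
    Improves w φ φ′
  improves-leave {w} {φ} {φ′} e h = improves λ {u} {N} {x} {b} {s} → go {u} {N} {x} {b} {s}
    where
    go : ∀ {u N x b s} → TopNode w u → Threshold u N → x ≡ Inner.address u →
         b ≡ attached u w → s ≡ slack N u w → rank x b s φ′ ≤ rank x b s φ
    go {x = x} {b} {s} tn th refl eb es
      rewrite rank-outside {x} {b} {s} {φ′} (λ eq → notRoot tn (trans (sym eq) e))
      with phaseLabel φ ≟ x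
    ... | yes eq rewrite rank-mine {x} {b} {s} {φ} eq = h tn th eq eb es
    ... | no  ne rewrite rank-outside {x} {b} {s} {φ} ne = ≤-refl

  improves-stay : ∀ {w φ φ′} → phaseLabel φ′ ≡ phaseLabel φ →
    (∀ {u N b s} → TopNode w u → Threshold u N → phaseLabel φ ≡ Inner.address u →
       b ≡ attached u w → s ≡ slack N u w → mine b s φ′ ≤ mine b s φ) →
    Improves w φ φ′
  improves-stay {w} {φ} {φ′} e h = improves λ {u} {N} {x} {b} {s} → go {u} {N} {x} {b} {s}
    where
    go : ∀ {u N x b s} → TopNode w u → Threshold u N → x ≡ Inner.address u →
         b ≡ attached u w → s ≡ slack N u w → rank x b s φ′ ≤ rank x b s φ
    go {x = x} {b} {s} tn th refl eb es with phaseLabel φ ≟ x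
    ... | yes eq rewrite rank-mine {x} {b} {s} {φ} eq | rank-mine {x} {b} {s} {φ′} (trans e eq) =
      h tn th eq eb es
    ... | no  ne rewrite rank-outside {x} {b} {s} {φ} ne
                       | rank-outside {x} {b} {s} {φ′} (λ eq → ne (trans (sym e) eq)) = ≤-refl

  improves-restart : ∀ {w ℓ} → Improves w (seeking ℓ) (seeking 0)
  improves-restart {ℓ = ℓ} = improves-leave refl λ { {b = true} _ _ _ _ _ →
      ≤-refl ; {b = false} _ _ _ _ _ → z≤n }

  improves-stop : ∀ {w ℓ} → Improves w (seeking ℓ) done
  improves-stop = improves-leave refl λ { {b = true} _ _ _ _ _ → ≤-refl ; {b = false} _ _ _ _ _ →
      z≤n }

  -- Entering is free: the node was just read from the cell of the root, hence is attached, and then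
  -- `seeking` has the same rank 1 as a thread outside.
  improves-enter : ∀ {w c} → heap w 0 0 ≡ inner c → Improves w (seeking 0)
      (seeking (Inner.address c))
  improves-enter {w} {c} e = improves λ {u} {N} {x} {b} {s} → go {u} {N} {x} {b} {s}
    where
    go : ∀ {u N x b s} → TopNode w u → Threshold u N → x ≡ Inner.address u →
         b ≡ attached u w → s ≡ slack N u w →
         rank x b s (seeking (Inner.address c)) ≤ rank x b s (seeking 0)
    go {x = x} {b} {s} tn th refl eb es
      rewrite rank-outside {x} {b} {s} {seeking 0} (λ eq → notRoot tn (sym eq))
      with Inner.address c ≟ x
    ... | no ne rewrite rank-outside {x} {b} {s} {seeking (Inner.address c)} ne = ≤-refl
    ... | yes refl rewrite rank-mine {x} {b} {s} {seeking x} refl | e | ≡ᵇ-refl x | eb = ≤-refl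

  improves-close : ∀ {w ℓ} → Improves w (reading ℓ) (closing ℓ)
  improves-close = improves-stay refl λ { {b = true} _ _ _ _ _ → z≤n ; {b = false} _ _ _ _ _ →
      ≤-refl }

  -- Equal addresses mean equal `initSize`, so the threshold of `u` applies to the count read at
  -- `m`.
  below-threshold : ∀ {w m u N} → Known w (inner m) → TopNode w u → Threshold u N →
    Inner.address m ≡ Inner.address u →
    atLeast R (count (mem w) (Inner.address m)) (Inner.initSize m) ≡ false → slack N u w ≢ 0
  below-threshold kn tn th eq small s≡0
    with refl ← known-unique kn (isKnown tn) eq
    with () ← trans (sym small) (th _ (m∸n≡0⇒m≤n s≡0))

  -- At an attached node without slack, `reading` has rank 0 and could not afford to go on without
  -- detaching. A count below the threshold proves that slack is left, and then its rank is 3.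
  improves-descend : ∀ {w m φ′} → Known w (inner m) → φ′ ≡ rebuilding (Inner.address m) ⊎ φ′
      ≡ done →
    atLeast R (count (mem w) (Inner.address m)) (Inner.initSize m) ≡ false →
    Improves w (reading (Inner.address m)) φ′
  improves-descend {w} {m} kn (inj₁ refl) small = improves-stay refl
    λ { {b = true} {zero}  tn th eq _ es → contradiction (sym es)
        (below-threshold kn tn th eq small)
      ; {b = true} {suc s} _   _  _  _ _  → ≤-refl
      ; {b = false}        _   _  _  _ _  → ≤-refl }
  improves-descend {w} {m} kn (inj₂ refl) small = improves-leave refl
    λ { {b = true} {zero}  tn th eq _ es → contradiction (sym es)
        (below-threshold kn tn th eq small)
      ; {b = true} {suc s} _   _  _  _ _  → s≤s z≤n
      ; {b = false}        _   _  _  _ _  → z≤n }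

  -- While ℓ is attached, `closing` has rank 0 and `done` has rank 1. The failed comparison at the
  -- root shows that ℓ is attached no more, and then `done` has rank 0.
  improves-closed : ∀ {w ℓ} → address (heap w 0 0) ≢ ℓ → Improves w (closing ℓ) done
  improves-closed {w} {ℓ} ne = improves-leave refl
    λ { {b = true} _ _ eq eb _ → contradiction (trans (≡ᵇ-true⇒≡ (sym eb)) (sym eq)) ne
      ; {b = false} _ _ _ _ _ → z≤n }

  improves-rebuilt : ∀ {w ℓ} → Improves w (rebuilding ℓ) done
  improves-rebuilt = improves-leave refl λ { {b = true} _ _ _ _ _ →
      s≤s z≤n ; {b = false} _ _ _ _ _ → z≤n }

  -- Transitions and their effect on the potentials

  tr-read : ∀ {θ w φ φ′} → Inv w → Improves w φ φ′ → Tr θ w φ w φ′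
  tr-read inv imp = record
    { tr-inv = inv ; tr-mono = mono-refl ; tr-rely = λ _ → keep-refl
    ; tr-moves = λ tn th → keeps refl refl (λ ex eb es → +-monoˡ-≤ _ (rank-≤ imp tn th ex eb es))
        (sameCells λ _ _ _ → refl)
    }

  tr-mark : ∀ {θ w φ} {u : Inner} s → Inv w → let a = Inner.address u in
    ¬ Open (heap w) a → Public w a → a < next (mem w) →
    Tr θ w φ (record w { mem = setStatus a s (mem w) }) φ
  tr-mark {w = w} {u = u} s inv closed pub lt = record
    { tr-inv = inv-relabel _ _ inv marked′
    ; tr-mono = proj₁ (calm-relabel _ _) ; tr-rely = λ _ → keep-relabel _ _
    ; tr-moves = λ _ _ → keeps refl refl (λ _ _ _ → ≤-refl) (sameCells λ _ _ _ → refl)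
    }
    where
    marked′ : ∀ {b} → status (setStatus (Inner.address u) s (mem w)) b ≢ clean →
              status (mem w) b ≢ clean ⊎ (¬ Open (heap w) b × Public w b × b < next (mem w))
    marked′ {b} ne with Inner.address u ≟ b
    ... | yes refl = inj₂ (closed , pub , lt)
    ... | no a≢b rewrite ≢⇒≡ᵇ-false a≢b = inj₁ ne

  data Increment (m : Inner) : Phase → Phase → Set where
    first : Increment m (pending (Inner.address m)) (reading (Inner.address m))
    again : ∀ {ℓ} → Increment m (reading ℓ) (reading ℓ)

  tr-increment : ∀ {θ w m φ φ′} → Inv w → Increment m φ φ′ → let a = Inner.address m in
    Tr θ w φ (record w { mem = setCount a (count (mem w) a + 1) (mem w) }) φ′
  tr-increment {w = w} {m} {φ} {φ′} inv incr = record
    { tr-inv = inv-relabel _ _ inv inj₁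
    ; tr-mono = proj₁ (calm-relabel _ _) ; tr-rely = λ _ → keep-relabel _ _
    ; tr-moves = moves
    }
    where
    a = Inner.address m
    w′ = record w { mem = setCount a (count (mem w) a + 1) (mem w) }
    unchanged : ∀ {u} → SameBelow u w w′
    unchanged = sameCells λ _ _ _ → refl
    -- Without slack, `pending` and `reading` have equal rank, so an increment beyond the threshold,
    -- which lowers no slack, costs nothing.
    rank-zero : ∀ {x b} φ φ′ → Increment m φ φ′ → x ≡ Inner.address m → rank x b 0 φ′ ≤ rank x b 0 φ
    rank-zero {b = true} _ _ first refl rewrite ≡ᵇ-refl (Inner.address m) = ≤-refl
    rank-zero {b = false} _ _ first refl rewrite ≡ᵇ-refl (Inner.address m) = ≤-refl
    rank-zero _ _ again _ = ≤-refl
    rank-other : ∀ {x b s} φ φ′ → Increment m φ φ′ → Inner.address m ≢ x →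
        rank x b s φ′ ≤ rank x b s φ
    rank-other _ _ first ne rewrite ≢⇒≡ᵇ-false ne = ≤-refl
    rank-other _ _ again _ = ≤-refl
    moves : ∀ {u N} → TopNode w u → Threshold u N → Moves u N w φ w′ φ′
    moves {u} {N} tn th with a ≟ Inner.address u
    ... | no ne = keeps refl (cong (N ∸_) (↦-other (count (mem w)) ne))
                    (λ { refl _ _ → +-monoˡ-≤ _ (rank-other _ _ incr ne) }) (unchanged {u})
    ... | yes a≡u with slack N u w in es
    ...   | suc s = counts refl (subst₂ _<_ (sym slack′) refl (∸-monoʳ-< ≤-refl slack>0))
      where
      slack′ : slack N u w′ ≡ N ∸ suc (count (mem w) (Inner.address u))
      slack′ = cong (N ∸_) (trans (trans (cong (count (mem w′)) (sym a≡u))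
          (↦-same (count (mem w)) a))
        (trans (+-comm _ 1) (cong (suc ∘ count (mem w)) a≡u)))
      slack>0 : count (mem w) (Inner.address u) < N
      slack>0 = m∸n≢0⇒n<m λ e → case trans (sym es) e of λ ()
    ...   | zero = keeps refl (trans slack′ (sym es))
                     (λ { {x} {b} refl _ refl → +-monoˡ-≤ _ (subst (λ s →
                         rank x b s φ′ ≤ rank x b s φ)
                          (sym es) (rank-zero _ _ incr (sym a≡u))) }) (unchanged {u})
      where
      slack′ : slack N u w′ ≡ 0
      slack′ = m≤n⇒m∸n≡0 (≤-trans (m∸n≡0⇒m≤n es) (≤-trans (m≤m+n _ 1) (≤-reflexive
        (trans (cong (λ b → count (mem w) b + 1) (sym a≡u)) (trans (sym (↦-same (count (mem w)) a))
            (cong (count (mem w′)) a≡u))))))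

  tr-alloc : ∀ {θ w φ c cs μ′} → Inv w → Alloc θ w c cs μ′ → Tr θ w φ (allocated θ w c μ′) φ
  tr-alloc {w = w} inv al = record
    { tr-inv = inv′ ; tr-mono = mono ; tr-rely = rely′
    ; tr-moves = λ {u} {N} tn _ → keeps
        (cong (λ c → address c ≡ᵇ Inner.address u) (Alloc.old al 0
            (<⇒≢ (isAllocated (root-known inv)))))
        (cong (N ∸_) (Alloc.count′ al (isAllocated (isKnown tn))))
        (λ _ _ _ → ≤-refl)
        (sameCells λ i lt _ → Alloc.old al i (<⇒≢ lt))
    }
    where open Allocation inv al

  module Changing {θ : Fin p} {w : World} {q : Inner} {i : ℕ} {c : Node}
                  (inv : Inv w) (n< : Inner.address q < next (mem w))
                  {ℓ : Address} (holder : tag w (Inner.address q) ≡ shared ℓ)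
                  (value : Writable θ w (Inner.address q) i c) where

    open Writing {q = q} inv n< (ℓ , holder) value

    -- Neither a leaf, a Rebuild node nor a private Inner node is a top node.
    NotTop : Node → Set
    NotTop d = ∀ {u} → TopNode w u → address d ≢ Inner.address u

    leaf-notTop : ∀ {d} → Known w d → (∀ {u} → d ≢ inner u) → NotTop d
    leaf-notTop kn leaf tn e = leaf (known-unique kn (isKnown tn) e)

    own-notTop : ∀ {d} → Own θ w d → NotTop d
    own-notTop (empty kn)  = leaf-notTop kn λ ()
    own-notTop (single kn) = leaf-notTop kn λ ()
    own-notTop (inner _ t _) tn e with () ← trans (sym t) (trans (cong (tag w) e) (isTop tn))

    attached-unchanged : ∀ u → address (heap w n i) ≢ Inner.address u →
        address c ≢ Inner.address u →
                         attached u w′ ≡ attached u w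
    attached-unchanged u old≢u new≢u = go refl refl
      where
      -- The cell of the root is generalised to variables, so that `hit` can identify it with the
      -- written cell.
      go : ∀ {a j} → a ≡ 0 → j ≡ 0 →
           (address (heap w′ a j) ≡ᵇ Inner.address u) ≡ (address (heap w a j) ≡ᵇ Inner.address u)
      go {a} {j} _ _ with heap w′ a j | cellView n i c (mem w) a j
      ... | _ | miss _ refl = refl
      ... | _ | hit refl refl refl = trans (≢⇒≡ᵇ-false new≢u) (sym (≢⇒≡ᵇ-false old≢u))

    attached-elsewhere : ∀ u → n ≢ 0 → attached u w′ ≡ attached u w
    attached-elsewhere u n≢0 = cong (λ d → address d ≡ᵇ Inner.address u)
        (elsewhere {0} {0} (n≢0 ∘ proj₁))

    same-below : ∀ u → ℓ ≢ Inner.address u → SameBelow u w w′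
    same-below u ne = sameCells λ { {a} j _ t → elsewhere λ { (refl , _) →
        ne (shared-inj (trans (sym holder) t)) } }
      where
      shared-inj : ∀ {a b} → shared a ≡ shared b → a ≡ b
      shared-inj refl = refl

  tr-write : ∀ {θ w φ q i c φ′ ℓ} (inv : Inv w) (n< : Inner.address q < next (mem w))
    (holder : tag w (Inner.address q) ≡ shared ℓ) (value : Writable θ w (Inner.address q) i c) →
    (∀ {u N} → TopNode w u → Threshold u N →
       Moves u N w φ (written θ w q i c (setChild (Inner.address q) i c (mem w))) φ′) →
    Tr θ w φ (written θ w q i c (setChild (Inner.address q) i c (mem w))) φ′
  tr-write {q = q} inv n< holder value moves = record
    { tr-inv = inv′ ; tr-mono = mono ; tr-rely = rely′ ; tr-moves = moves }
    where open Writing {q = q} inv n< (_ , holder) value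

  data Leaf : Node → Set where
    empty  : ∀ {a} → Leaf (empty a)
    single : ∀ {a k v} → Leaf (single a k v)

  rank-other : ∀ {x b s} φ φ′ → phaseLabel φ ≢ x → phaseLabel φ′ ≢ x → rank x b s φ′ ≤ rank x b s φ
  rank-other φ φ′ ne ne′ rewrite ≢⇒≡ᵇ-false ne | ≢⇒≡ᵇ-false ne′ = ≤-refl

  own-removes : ∀ {θ w c} → Own θ w c → ∀ n i → recordWrite w n i c
      ≡ removeᵇ (inCell n i) (rebuilds w)
  own-removes (empty _)     n i = refl
  own-removes (single _)    n i = refl
  own-removes (inner _ _ _) n i = refl

  module _ {θ : Fin p} {w : World} {q : Inner} {i : ℕ} {c : Node}
           (inv : Inv w) (n< : Inner.address q < next (mem w))
           {ℓ : Address} (holder : tag w (Inner.address q) ≡ shared ℓ) (o : Own θ w c) where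

    private
      n  = Inner.address q
      w₁ = written θ w q i c (setChild n i c (mem w))

      open Changing {q = q} inv n< holder (fresh {i = i} o)

      fewer : ∀ f → countᵇ f (rebuilds w₁) ≤ countᵇ f (rebuilds w)
      fewer f = subst (λ l → countᵇ f l ≤ countᵇ f (rebuilds w)) (sym (own-removes o n i))
                  (countᵇ-removeᵇ f (inCell n i) (rebuilds w))

    -- A leaf that is the child of the root has an empty path above it: there is nothing to count or
    -- rebuild, and the update is done at once.
    data Replacement : Phase → Phase → Set where
      replace-at-root : ℓ ≡ 0 → Replacement (seeking 0) done
      replace-below   : n ≢ 0 → Replacement (seeking ℓ) (pending ℓ)

    tr-update : ∀ {φ φ′} → Leaf (heap w n i) → Replacement φ φ′ → Tr θ w φ w₁ φ′
    tr-update leaf repl = tr-write {q = q} inv n< holder (fresh o) (moves repl)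
      where
      notTop : NotTop (heap w n i)
      notTop = leaf-notTop (knowns inv n i) (go leaf)
        where
        go : ∀ {d} → Leaf d → ∀ {u} → d ≢ inner u
        go empty ()
        go single ()
      moves : ∀ {φ φ′} → Replacement φ φ′ → ∀ {u N} → TopNode w u → Threshold u N →
          Moves u N w φ w₁ φ′
      moves (replace-at-root refl) {u} tn th = keeps (attached-unchanged u (notTop tn)
          (own-notTop o tn)) refl
        (λ ex eb es → +-mono-≤ (rank-≤ (improves-stop {w} {0}) tn th ex eb es) (fewer _))
        (same-below u (notRoot tn ∘ sym))
      moves (replace-below n≢0) {u} {N} tn th with ℓ ≟ Inner.address u
      ... | no ne = keeps (attached-elsewhere u n≢0) refl
        (λ { {x} {b} {s} refl _ _ → +-mono-≤ (rank-other {x} {b} {s} (seeking ℓ) (pending ℓ) ne ne)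
            (fewer _) })
        (same-below u ne)
      ... | yes refl = spends (attached-elsewhere u n≢0) refl
        (λ { {x} {b} {s} refl _ _ → +-mono-<-≤ (subst₂ _<_ (sym
            (rank-mine {x} {b} {s} {pending x} refl))
               (sym (rank-mine {x} {b} {s} {seeking x} refl)) (strict b)) (fewer _) })
        where
        strict : ∀ b {s x} → mine b s (pending x) < mine b s (seeking x)
        strict true  = ≤-refl
        strict false = ≤-refl

    paid-update : ∀ {φ φ′} → Replacement φ φ′ → Paid true w φ w₁ φ′
    paid-update (replace-at-root _) = +-mono-≤ {1} {3} (s≤s z≤n) (fewer _)
    paid-update (replace-below _)   = +-mono-≤ {3} {3} ≤-refl (fewer _)

    module _ {op : Rebuild} (at : heap w n i ≡ rebuild op) where

      private
        cell∈ : ⟪ n , i , ℓ ⟫ ∈ rebuilds w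
        cell∈ = subst (λ t → ⟪ n , i , labelOf t ⟫ ∈ rebuilds w) holder
            (Placed.recorded (placed inv at))

        fewer′ : ∀ f → f ⟪ n , i , ℓ ⟫ ≡ true → countᵇ f (rebuilds w₁) < countᵇ f (rebuilds w)
        fewer′ f e = subst (λ l → countᵇ f l < countᵇ f (rebuilds w)) (sym (own-removes o n i))
          (countᵇ-removeᵇ-∈ f (inCell n i) cell∈ e in-cell)
          where
          in-cell : ((n ≡ᵇ n) ∧ (i ≡ᵇ i)) ≡ true
          in-cell rewrite ≡ᵇ-refl n | ≡ᵇ-refl i = refl

      -- Any thread may help, in any phase: the change is paid by the recorded cell that it removes,
      -- not by the helper.
      tr-remove : ∀ {φ} → Tr θ w φ w₁ φ
      tr-remove {φ} = tr-write {q = q} inv n< holder (fresh o) moves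
        where
        notTop : NotTop (heap w n i)
        notTop = leaf-notTop (knowns inv n i) (λ e → case trans (sym at) e of λ ())
        moves : ∀ {u N} → TopNode w u → Threshold u N → Moves u N w φ w₁ φ
        moves {u} tn th with ℓ ≟ Inner.address u
        ... | no ne = keeps (attached-unchanged u (notTop tn) (own-notTop o tn)) refl
          (λ _ _ _ → +-monoʳ-≤ _ (fewer _)) (same-below u ne)
        ... | yes e = spends (attached-unchanged u (notTop tn) (own-notTop o tn)) refl
          (λ {x} {b} {s} _ _ _ → +-monoʳ-< (rank x b s φ) (fewer′ _
              (trans (cong (_≡ᵇ Inner.address u) e) (≡ᵇ-refl (Inner.address u)))))

      paid-remove : ∀ {φ} → Paid true w φ w₁ φ
      paid-remove {φ} = ≤-trans (≤-reflexive (sym (+-suc (credit φ) _)))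
          (+-monoʳ-≤ (credit φ) (fewer′ _ refl))

  module _ {θ : Fin p} {w : World} {q : Inner} {i : ℕ} {m : Inner} {op : Rebuild}
           (inv : Inv w) (n< : Inner.address q < next (mem w))
           {ℓ : Address} (holder : tag w (Inner.address q) ≡ shared ℓ)
           (kn : Known w (rebuild op)) (at : heap w (Inner.address q) i ≡ inner m)
           (target : Rebuild.target op ≡ m) (parent : Rebuild.parent op ≡ q)
           (index : Rebuild.index op ≡ i) where

    private
      n  = Inner.address q
      w₁ = written θ w q i (rebuild op) (setChild n i (rebuild op) (mem w))

      value : Writable θ w n i (rebuild op)
      value = rebuild kn (trans at (cong inner (sym target))) (cong Inner.address parent) index

      open Changing {q = q} inv n< holder value

      op-notTop : NotTop (rebuild op)
      op-notTop = leaf-notTop kn λ ()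

    data Installation : Phase → Phase → Set where
      install-at-root : n ≡ 0 → i ≡ 0 → ℓ ≡ 0 → Installation (closing (Inner.address m)) done
      install-below   : n ≢ 0 → Installation (rebuilding ℓ) done

    tr-install : ∀ {φ φ′} → Installation φ φ′ → Tr θ w φ w₁ φ′
    tr-install inst = tr-write {q = q} inv n< holder value (moves inst)
      where
      recorded : ∀ u {b} → (ℓ ≡ᵇ Inner.address u) ≡ b →
                 pendingBelow u w₁ ≡ (if b then suc (pendingBelow u w) else pendingBelow u w)
      recorded u e = trans
        (cong (λ t → if labelOf t ≡ᵇ Inner.address u then suc (pendingBelow u w) else pendingBelow u
            w) holder)
        (cong (λ b → if b then suc (pendingBelow u w) else pendingBelow u w) e)

      unlabelled : ∀ {u} → ℓ ≢ Inner.address u → pendingBelow u w₁ ≡ pendingBelow u w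
      unlabelled {u} ne = recorded u (≢⇒≡ᵇ-false ne)

      moves : ∀ {φ φ′} → Installation φ φ′ → ∀ {u N} → TopNode w u → Threshold u N →
          Moves u N w φ w₁ φ′
      moves (install-at-root n≡0 i≡0 refl) {u} tn th with Inner.address m ≟ Inner.address u
      ... | yes e = detaches
        (trans (cong₂ (λ a j → address (heap w a j) ≡ᵇ Inner.address u) (sym n≡0) (sym i≡0))
          (trans (cong (λ d → address d ≡ᵇ Inner.address u) at)
              (trans (cong (_≡ᵇ Inner.address u) e) (≡ᵇ-refl (Inner.address u)))))
        (trans (cong₂ (λ a j → address (heap w₁ a j) ≡ᵇ Inner.address u) (sym n≡0) (sym i≡0))
          (trans (cong (λ d → address d ≡ᵇ Inner.address u) (setChild-hit n i (rebuild op) (mem w)))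
              (≢⇒≡ᵇ-false (op-notTop tn))))
      ... | no ne = keeps (attached-unchanged u (λ e → ne (trans (cong address (sym at)) e))
          (op-notTop tn)) refl
        (λ { {x} {b} {s} refl _ _ → +-mono-≤ (rank-other {x} {b} {s} (closing (Inner.address m))
            done ne (notRoot tn ∘ sym))
                                      (≤-reflexive (unlabelled {u} (notRoot tn ∘ sym))) })
        (same-below u (notRoot tn ∘ sym))
      moves (install-below n≢0) {u} tn th with ℓ ≟ Inner.address u
      ... | no ne = keeps (attached-elsewhere u n≢0) refl
        (λ { {x} {b} {s} refl _ _ → +-mono-≤ (rank-other {x} {b} {s} (rebuilding ℓ) done ne
            (notRoot tn ∘ sym))
                                      (≤-reflexive (unlabelled {u} ne)) })
        (same-below u ne)
      ... | yes refl = spends (attached-elsewhere u n≢0) refl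
        (λ { {x} {b} {s} refl _ _ → subst₂ (λ r r′ → r + pendingBelow u w₁ < r′ + pendingBelow u w)
               (sym (rank-outside {x} {b} {s} {done} (notRoot tn ∘ sym)))
               (sym (rank-mine {x} {b} {s} {rebuilding x} refl)) (strict b) })
        where
        one-more : pendingBelow u w₁ ≡ suc (pendingBelow u w)
        one-more = recorded u (≡ᵇ-refl ℓ)
        -- The origin of the ranks of `rebuilding`: one unit for this DCSS and one for the recorded
        -- Rebuild node, to be replaced later. While `u` is attached a third is kept, because the
        -- thread may come back from the root.
        strict : ∀ b {s x} → outside b + pendingBelow u w₁ < mine b s (rebuilding x) + pendingBelow
            u w
        strict true  rewrite one-more = ≤-refl
        strict false rewrite one-more = ≤-refl

    -- The last two credits pay for this DCSS and for the replacement of the Rebuild node, which is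
    -- from now on counted in `total`.
    paid-install : ∀ {φ φ′} → Installation φ φ′ → Paid true w φ w₁ φ′
    paid-install (install-at-root _ _ _) = ≤-refl
    paid-install (install-below _)       = ≤-refl

  -- Admissible commands

  loud : (π : Prim) → Result π → Bool
  loud (dcss _ _ _ _ _ _) SUCCESS = true
  loud _                  _       = false

  record OnPath (w : World) (ℓ : Address) (m : Inner) : Set where
    constructor onPath
    field
      path-known : Known w (inner m)
      path-tag   : tag w (Inner.address m) ≡ shared ℓ
  open OnPath

  -- Below the root the path begins with a top node, whose address labels all nodes on it. The index
  -- is 0 since the root has a single child.
  data Position (w : World) : Address → Inner → Path → Set where
    atRoot : Position w 0 root []
    inside : ∀ {x ms n} → Inner.address x ≢ 0 → OnPath w (Inner.address x) x →
             All (OnPath w (Inner.address x) ∘ proj₁) ms → OnPath w (Inner.address x) n →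
             Position w (Inner.address x) n ((x , 0) ∷ ms)

  data Overflowing (w : World) : Inner → Inner → ℕ → Phase → Set where
    atRoot : ∀ {u} → Inner.address u ≢ 0 → OnPath w (Inner.address u) u →
             Overflowing w u root 0 (closing (Inner.address u))
    inside : ∀ {u q i ℓ} → ℓ ≢ 0 → OnPath w ℓ u → OnPath w ℓ q →
             Overflowing w u q i (rebuilding ℓ)

  record Sealed (w : World) (u : Inner) : Set where
    constructor sealed
    field
      sealed-known  : Known w (inner u)
      sealed-public : Public w (Inner.address u)
      sealed-closed : ¬ Open (heap w) (Inner.address u)
  open Sealed

  data Markable (w : World) : Node → Set where
    empty   : ∀ {a} → Markable w (empty a)
    single  : ∀ {a k v} → Markable w (single a k v)
    inner   : ∀ {u} → Sealed w u → Markable w (inner u)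
    rebuild : ∀ {op} → Sealed w (Rebuild.target op) → Markable w (rebuild op)

  Collectable : World → Node → Set
  Collectable w c = Known w c × (∀ {u} → c ≡ inner u → Public w (Inner.address u))

  Pre : Proc → World → Phase → Set
  Pre (operation (update _))   w φ = φ ≡ seeking 0
  -- Lookups write nothing; they are followed by `LookupState` instead of the triples.
  Pre (operation (lookup _))   w φ = ⊥
  Pre (descend _ n path)       w φ = ∃[ ℓ ] φ ≡ seeking ℓ × Position w ℓ n path
  Pre (search _ _)             w φ = ⊥
  Pre (rebuild u q i)          w φ = Overflowing w u q i φ
  Pre (helpRebuild op)         w φ = Known w (rebuild op) × Sealed w (Rebuild.target op)
  Pre (markAndCount c)         w φ = Markable w c
  Pre (collect c)              w φ = Collectable w c

  Post : Proc → Phase → Phase → Set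
  Post (helpRebuild _)  φ φ′ = φ′ ≡ φ
  Post (markAndCount _) φ φ′ = φ′ ≡ φ
  Post (collect _)      φ φ′ = φ′ ≡ φ
  Post _                φ φ′ = φ′ ≡ done

  -- Rely/guarantee triples: starting in phase φ in a world later than w, thread
  -- θ only takes admissible steps and returns in a state satisfying Q.
  OK : ∀ {A} → Fin p → World → Phase → (World → Phase → A → Set) → Cmd A → Set
  OK θ w φ Q (return x) = Q w φ x
  OK θ w φ Q (prim π g) = ∀ w′ → Later θ w w′ → Inv w′ → ∀ {x μ′} → mem w′ ⊢ π ⇓ x ⊣ μ′ →
    let w″ = after θ w′ π x μ′ in
    ∃[ φ′ ] Tr θ w′ φ w″ φ′ × Paid (loud π x) w′ φ w″ φ′ × OK θ w″ φ′ Q (g x)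
  OK θ w φ Q (call f g) = ∀ w′ → Later θ w w′ → Inv w′ →
    Pre f w′ φ × (∀ {w″ φ′ x} → Mono w′ w″ → Post f φ φ′ → OK θ w″ φ′ Q (g x))

  -- Only `Mono` reaches the continuation, for the command may have published private nodes. Facts
  -- about nodes that are still private must travel in `Q`.
  ok-bind : ∀ {A B θ w φ} {Q : World → Phase → A → Set} {Q′ : World → Phase → B → Set}
    {g : A → Cmd B} (c : Cmd A) → OK θ w φ Q c →
    (∀ {w′ φ′ x} → Mono w w′ → Q w′ φ′ x → OK θ w′ φ′ Q′ (g x)) → OK θ w φ Q′ (c >>= g)
  ok-bind (return x) ok k = k mono-refl ok
  ok-bind (prim π g) ok k w′ le inv st =
    let φ′ , tr , paid , ok′ = ok w′ le inv st in
    φ′ , tr , paid , ok-bind (g _) ok′ λ m → k (mono-trans (mono-trans (proj₁ le) (tr-mono tr)) m)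
  ok-bind (call f g) ok k w′ le inv =
    let pre , ok′ = ok w′ le inv in
    pre , λ m post → ok-bind (g _) (ok′ m post) λ m′ → k (mono-trans (mono-trans (proj₁ le) m) m′)

  ok-later : ∀ {A θ w w′ φ} {Q : Phase → A → Set} (c : Cmd A) →
    OK θ w φ (λ _ → Q) c → Later θ w w′ → OK θ w′ φ (λ _ → Q) c
  ok-later (return x) ok le = ok
  ok-later (prim π g) ok le w″ le′ = ok w″ (later-trans le le′)
  ok-later (call f g) ok le w″ le′ = ok w″ (later-trans le le′)

  onPath-mono : ∀ {w w′ ℓ m} → Mono w w′ → OnPath w ℓ m → OnPath w′ ℓ m
  onPath-mono m (onPath k t) = onPath (known-mono m k) (tags m (isAllocated k) t)

  position-mono : ∀ {w w′ ℓ n path} → Mono w w′ → Position w ℓ n path → Position w′ ℓ n path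
  position-mono m atRoot = atRoot
  position-mono m (inside x≢0 x ms n) =
    inside x≢0 (onPath-mono m x) (All.map (onPath-mono m) ms) (onPath-mono m n)

  overflowing-mono : ∀ {w w′ u q i φ} → Mono w w′ → Overflowing w u q i φ → Overflowing w′ u q i φ
  overflowing-mono m (atRoot u≢0 u)  = atRoot u≢0 (onPath-mono m u)
  overflowing-mono m (inside ℓ≢0 u q) = inside ℓ≢0 (onPath-mono m u) (onPath-mono m q)

  sealed-mono : ∀ {w w′ u} → Mono w w′ → Sealed w u → Sealed w′ u
  sealed-mono m (sealed k pub closed) =
    sealed (known-mono m k) (public-mono m (isAllocated k) pub) (shut m (isAllocated k) pub closed)

  collectable-mono : ∀ {w w′ c} → Mono w w′ → Collectable w c → Collectable w′ c
  collectable-mono m (kn , pub) = known-mono m kn ,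
    λ { refl → public-mono m (isAllocated kn) (pub refl) }

  below-root≢0 : ∀ {w ℓ n} → Inv w → ℓ ≢ 0 → OnPath w ℓ n → Inner.address n ≢ 0
  below-root≢0 inv ℓ≢0 (onPath _ t) refl with refl ← trans (sym t) (root-tag inv) = ℓ≢0 refl

  rebuild-known : ∀ {w op} → Inv w → Known w (rebuild op) → RebuildOK w op
  rebuild-known inv kn = rebuildOK inv (isAllocated kn) (isNodeAt kn)

  child-sealed : ∀ {w u a i} → Inv w → heap w a i ≡ inner u → Public w a → ¬ Open (heap w) a →
      Sealed w u
  child-sealed {w} {a = a} inv e pub closed = sealed (child-known inv e)
      (below-public (belows inv e) pub)
    (closed-child {w} inv e closed)

  target-sealed : ∀ {w op} → Inv w → Known w (rebuild op) →
    ¬ Open (heap w) (Inner.address (Rebuild.target op)) → Sealed w (Rebuild.target op)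
  target-sealed inv kn closed = let open RebuildOK (rebuild-known inv kn) in
    sealed target-known target-public closed

  -- Allocation of whole trees as private nodes

  alloc-leaf : ∀ {θ w} c → address c ≡ next (mem w) → (∀ {op} → c ≡ rebuild op → RebuildOK w op) →
               Alloc θ w c [] (bump (mem w))
  alloc-leaf c e r = record
    { next′ = refl ; fresh = e ; old = λ _ _ → refl ; new = λ _ → inj₁ refl ; status′ = id
    ; count′ = λ _ → refl ; owned = [] ; distinct = [] ; rebuilt = r }

  alloc-inner : ∀ {θ w} n ks {cs} → All (Own θ w) cs → Distinct cs →
    Alloc θ w (inner (mkInner (next (mem w)) n ks)) cs (bump (initInner (next (mem w)) cs (mem w)))
  alloc-inner {w = w} n ks {cs} os ds = record
    { next′ = cong suc (setChildren-next a 0 cs _)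
    ; fresh = refl
    ; old = λ i a′≢a → setChildren-other a 0 cs _ (≢-sym a′≢a)
    ; new = λ i → [ inj₁ , (λ { (j , refl , at) → inj₂ at }) ]′ (setChildren-view a 0 cs _ i)
    ; status′ = λ {b} ne → status-old {b} (subst (λ s → s b ≢ clean) (setChildren-status a 0 cs _)
        ne)
    ; count′ = λ {b} b<a → trans (cong (λ h → h b) (setChildren-count a 0 cs _))
        (↦-other (count (mem w)) (>⇒≢ b<a))
    ; owned = os ; distinct = ds ; rebuilt = λ () }
    where
    a = next (mem w)
    status-old : ∀ {b} → status (setStatus a clean (setCount a 0 (mem w))) b ≢ clean →
        status (mem w) b ≢ clean
    status-old {b} ne with a ≡ᵇ b
    ... | true  = contradiction refl ne
    ... | false = ne

  -- The bound on the address says that the node was allocated after `w`, hence differs from every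
  -- node the thread held before.
  Fresh : Fin p → World → World → Node → Set
  Fresh θ w w′ c = Later θ w w′ × Own θ w′ c × next (mem w) ≤ address c

  -- Allocating a parent ends the orphanhood of its children. As these were all allocated since
  -- `w₀`, the orphans from before `w₀` are not among them.
  alloc-later : ∀ {θ w₀ w c cs μ′} → Later θ w₀ w → Inv w → Alloc θ w c cs μ′ →
    All (λ d → next (mem w₀) ≤ address d) cs → Later θ w₀ (allocated θ w c μ′)
  alloc-later {θ} {w₀} {w} (m , k) inv al new = mono-trans m mono , record
    { stays  = λ lt t → trans (tags′ (<-≤-trans lt (next-≤ m))) (stays k lt t)
    ; orphan = λ lt t o → orphan′ (All.map (λ { le refl refl → <⇒≱ lt le }) new) (orphan k lt t o)
    }
    where open Allocation inv al

  leaf-own : ∀ {θ w₀ w} c → Leaf c → address c ≡ next (mem w) → Later θ w₀ w → Inv w →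
             Fresh θ w₀ (allocated θ w c (bump (mem w))) c
  leaf-own {θ} {w = w} c leaf e le inv =
    alloc-later le inv al [] , go leaf new-known , ≤-trans (next-≤ (proj₁ le)) (≤-reflexive (sym e))
    where
    al = alloc-leaf c e (λ eq → contradiction eq (not-rebuild leaf))
      where
      not-rebuild : ∀ {c op} → Leaf c → c ≢ rebuild op
      not-rebuild empty ()
      not-rebuild single ()
    open Allocation inv al
    go : ∀ {c w} → Leaf c → Known w c → Own θ w c
    go empty  kn = empty kn
    go single kn = single kn

  allocate-ok  : ∀ t {θ w φ} → OK θ w φ (λ w′ φ′ c → φ′ ≡ φ × Fresh θ w w′ c) (allocate t)
  allocate*-ok : ∀ ts {θ w φ} → OK θ w φ (λ w′ φ′ cs → φ′ ≡ φ × Later θ w w′ × All (Own θ w′) cs ×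
                   Distinct cs × All (λ c → next (mem w) ≤ address c) cs) (allocate* ts)
  allocate-ok empty {φ = φ} _ le inv newEmpty =
    φ , tr-alloc inv (alloc-leaf _ refl λ ()) , ≤-refl , refl , leaf-own _ empty refl le inv
  allocate-ok (single k v) {φ = φ} _ le inv newSingle =
    φ , tr-alloc inv (alloc-leaf _ refl λ ()) , ≤-refl , refl , leaf-own _ single refl le inv
  allocate-ok (inner n ks ts) {θ} {w} {φ} = ok-bind (allocate* ts) (allocate*-ok ts) λ where
    _ (refl , le , os , ds , new) _ le′ inv newInner → let
        al = alloc-inner n ks (All.map (own-later le′) os) ds
        open Allocation inv al
      in φ , tr-alloc inv al , ≤-refl , refl ,
         alloc-later (later-trans le le′) inv al new ,
         inner new-known new-tag new-orphan ,
         ≤-trans (next-≤ (proj₁ le)) (next-≤ (proj₁ le′))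
  allocate*-ok [] = refl , later-refl , [] , [] , []
  allocate*-ok (t ∷ ts) = ok-bind (allocate t) (allocate-ok t) λ where
    _ (refl , le , o , new) → ok-bind (allocate* ts) (allocate*-ok ts) λ where
      _ (refl , le′ , os , ds , news) →
        refl , later-trans le le′ , own-later le′ o ∷ os ,
        -- The siblings were allocated after the subtree of `c`, so their addresses lie beyond that
        -- of `c`.
        All.map (λ le″ e → <⇒≱ (isAllocated (own-known o)) (subst (_ ≤_) (sym e) le″)) news ∷ ds ,
        new ∷ All.map (≤-trans (next-≤ (proj₁ le))) news

  -- Updates and rebuilds are admissible

  Finished : ∀ {A : Set} → World → Phase → A → Set
  Finished _ φ _ = φ ≡ done

  Unmoved : ∀ {A : Set} → Phase → World → Phase → A → Set
  Unmoved φ _ φ′ _ = φ′ ≡ φ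

  cell-is : ∀ {w a i c} → Inv w → Known w c → heap w a i ≐ c → heap w a i ≡ c
  cell-is inv kn e = known-unique (knowns inv _ _) kn e

  increments-ok : ∀ ms {θ w ℓ} → OK θ w (reading ℓ) (Unmoved (reading ℓ)) (incrementCounts ms)
  increments-ok []             = refl
  increments-ok ((m , _) ∷ ms) {ℓ = ℓ} _ le inv fetchAddCount =
    reading ℓ , tr-increment {m = m} inv again , ≤-refl , increments-ok ms

  rebuildBelow-ok : ∀ {θ w ℓ} q m j ms → ℓ ≢ 0 → OnPath w ℓ q → OnPath w ℓ m →
      All (OnPath w ℓ ∘ proj₁) ms →
    OK θ w (rebuilding ℓ) Finished (rebuildFirst q ((m , j) ∷ ms))
  rebuildBelow-ok {ℓ = ℓ} q m j ms ℓ≢0 on-q on-m on-ms w le inv readCount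
    with atLeast R (count (mem w) (Inner.address m)) (Inner.initSize m)
  ... | true = rebuilding ℓ , tr-read inv improves-refl , ≤-refl , λ _ le′ _ →
    overflowing-mono (mono-trans (proj₁ le) (proj₁ le′)) (inside ℓ≢0 on-m on-q) , λ _ post → post
  ... | false with ms | on-ms
  ...   | []            | []             = done , tr-read inv improves-rebuilt , m≤n+m _ 2 , refl
  ...   | (m′ , j′) ∷ ms′ | on-m′ ∷ on-ms′ = rebuilding ℓ , tr-read inv improves-refl , ≤-refl ,
    rebuildBelow-ok m m′ j′ ms′ ℓ≢0 (onPath-mono (proj₁ le) on-m) (onPath-mono (proj₁ le) on-m′)
      (All.map (onPath-mono (proj₁ le)) on-ms′)

  rebuildFirst-ok : ∀ {θ w} x ms → Inner.address x ≢ 0 → OnPath w (Inner.address x) x →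
    All (OnPath w (Inner.address x) ∘ proj₁) ms →
    OK θ w (reading (Inner.address x)) Finished (rebuildFirst root ((x , 0) ∷ ms))
  rebuildFirst-ok x ms x≢0 on-x on-ms w le inv readCount
    with atLeast R (count (mem w) (Inner.address x)) (Inner.initSize x) in small
  ... | true = closing (Inner.address x) , tr-read inv improves-close , ≤-refl , λ _ le′ _ →
    overflowing-mono (mono-trans (proj₁ le) (proj₁ le′)) (atRoot x≢0 on-x) , λ _ post → post
  ... | false with ms | on-ms
  ...   | []           | []            = done ,
    tr-read inv (improves-descend (known-mono (proj₁ le) (path-known on-x)) (inj₂ refl) small) ,
        m≤n+m _ 2 , refl
  ...   | (m , j) ∷ ms′ | on-m ∷ on-ms′ = rebuilding (Inner.address x) ,
    tr-read inv (improves-descend (known-mono (proj₁ le) (path-known on-x)) (inj₁ refl) small) ,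
        ≤-refl ,
    rebuildBelow-ok x m j ms′ x≢0 (onPath-mono (proj₁ le) on-x) (onPath-mono (proj₁ le) on-m)
      (All.map (onPath-mono (proj₁ le)) on-ms′)

  -- Every replacement is the allocation of a small tree, so the lemmas on `allocate` serve updates
  -- and ideal ISTs alike.
  atEmpty-creates : ∀ a → atEmpty a ≡ nothing ⊎ ∃[ t ] atEmpty a ≡ just (allocate t)
  atEmpty-creates (insert k v) = inj₂ (single k v , refl)
  atEmpty-creates (delete k)   = inj₁ refl

  atSingle-creates : ∀ a k v → atSingle a k v ≡ nothing ⊎ ∃[ t ] atSingle a k v ≡ just (allocate t)
  atSingle-creates (insert k v) k′ v′ with compareᴷ k k′
  ... | tri< _ _ _ = inj₂ (inner 2 (k′ ∷ []) (single k v ∷ single k′ v′ ∷ []) , refl)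
  ... | tri≈ _ _ _ = inj₂ (single k v , refl)
  ... | tri> _ _ _ = inj₂ (inner 2 (k ∷ []) (single k′ v′ ∷ single k v ∷ []) , refl)
  atSingle-creates (delete k) k′ v′ with does (k ≟ᴷ k′)
  ... | true  = inj₂ (empty , refl)
  ... | false = inj₁ refl

  restart-ok : ∀ {θ w a} → OK θ w (seeking 0) Finished (run (operation (update a)))
  restart-ok _ le inv = refl , λ _ post → post

  retry-ok : ∀ {θ w a n path ℓ} → Position w ℓ n path → OK θ w (seeking ℓ) Finished
      (run (descend a n path))
  retry-ok pos _ le inv = (_ , refl , position-mono (proj₁ le) pos) , λ _ post → post

  position-holder : ∀ {w ℓ n path} → Inv w → Position w ℓ n path →
                    Inner.address n < next (mem w) × tag w (Inner.address n) ≡ shared ℓ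
  position-holder inv atRoot = isAllocated (root-known inv) , root-tag inv
  position-holder inv (inside _ _ _ (onPath kn t)) = isAllocated kn , t

  succeeded-ok : ∀ {θ w x ms} → Inner.address x ≢ 0 → OnPath w (Inner.address x) x →
    All (OnPath w (Inner.address x) ∘ proj₁) ms →
    OK θ w (pending (Inner.address x)) Finished
      (incrementCounts ((x , 0) ∷ ms) >>= λ _ → rebuildFirst root ((x , 0) ∷ ms))
  succeeded-ok {x = x} {ms} x≢0 on-x on-ms _ le inv fetchAddCount =
    reading (Inner.address x) , tr-increment {m = x} inv first , ≤-refl ,
    ok-bind (incrementCounts ms) (increments-ok ms) λ where
      m refl → finish (mono-trans (mono-trans (proj₁ le) (proj₁ (calm-relabel _ _))) m)
    where
    finish : ∀ {w′} → Mono _ w′ →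
      OK _ w′ (reading (Inner.address x)) Finished (rebuildFirst root ((x , 0) ∷ ms))
    finish m = rebuildFirst-ok x ms x≢0 (onPath-mono m on-x) (All.map (onPath-mono m) on-ms)

  leaf-at : ∀ {w a i c} → Inv w → Known w c → Leaf c → heap w a i ≐ c → Leaf (heap w a i)
  leaf-at inv kn leaf e = subst Leaf (sym (cell-is inv kn e)) leaf

  replace-ok : ∀ {θ w ℓ n path i c a} m → m ≡ nothing ⊎ ∃[ t ] m ≡ just (allocate t) →
    Inv w → Position w ℓ n path → Known w c → Leaf c →
    ∃[ φ′ ] Tr θ w (seeking ℓ) w φ′ × Paid false w (seeking ℓ) w φ′ ×
            OK θ w φ′ Finished (replace a n path i c m)
  replace-ok .nothing (inj₁ refl) inv pos kn leaf = done , tr-read inv improves-stop , m≤n+m _ 3 ,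
      refl
  replace-ok {θ} {w} {ℓ} {n} {path} {i} {c} {a} .(just (allocate t)) (inj₂ (t , refl)) inv pos kn
      leaf =
    seeking ℓ , tr-read inv improves-refl , ≤-refl , ok-bind (allocate t) (allocate-ok t) λ where
      _ (refl , le , o , _) _ le′ inv′ (dcss-success e _) →
        let m   = mono-trans (proj₁ le) (proj₁ le′)
            pos = position-mono m pos
            n< , t = position-holder inv′ pos
            leaf′ = leaf-at inv′ (known-mono m kn) leaf e
        in install pos inv′ n< t (own-later le′ o) leaf′
      _ (refl , le , _) _ le′ inv′ (dcss-main _) →
        seeking ℓ , tr-read inv′ improves-refl , ≤-refl ,
        retry-ok {a = a} (position-mono (mono-trans (proj₁ le) (proj₁ le′)) pos)
      _ (refl , _) _ _ inv′ (dcss-aux _) →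
        seeking 0 , tr-read inv′ improves-restart , ≤-refl , restart-ok {a = a}
    where
    install : ∀ {w r n path ℓ} → Position w ℓ n path → (inv : Inv w)
        (n< : Inner.address n < next (mem w)) →
      (t : tag w (Inner.address n) ≡ shared ℓ) → Own θ w r → Leaf (heap w (Inner.address n) i) →
      let w″ = written θ w n i r (setChild (Inner.address n) i r (mem w)) in
      ∃[ φ′ ] Tr θ w (seeking ℓ) w″ φ′ × Paid true w (seeking ℓ) w″ φ′ ×
        OK θ w″ φ′ Finished (incrementCounts path >>= λ _ → rebuildFirst root path)
    install atRoot inv n< t o leaf =
      done , tr-update {q = root} inv n< t o leaf (replace-at-root refl) ,
      paid-update {q = root} inv n< t o (replace-at-root refl) , refl
    install {n = n} (inside x≢0 on-x on-ms on-n) inv n< t o leaf =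
      let repl = replace-below (below-root≢0 inv x≢0 on-n)
          tr   = tr-update {q = n} inv n< t o leaf repl
          m    = tr-mono tr
      in _ , tr , paid-update {q = n} inv n< t o repl ,
         succeeded-ok x≢0 (onPath-mono m on-x) (All.map (onPath-mono m) on-ms)

  visit-ok : ∀ {θ w ℓ n path a i} c → Inv w → Position w ℓ n path →
    (Inner.address n ≡ 0 → i ≡ 0) → heap w (Inner.address n) i ≡ c →
    ∃[ φ′ ] Tr θ w (seeking ℓ) w φ′ × Paid false w (seeking ℓ) w φ′ ×
            OK θ w φ′ Finished (visit a n path i c)
  visit-ok {a = a} c@(empty _) inv pos _ e = replace-ok {a =
      a} _ (atEmpty-creates a) inv pos (child-known inv e) empty
  visit-ok {a = a} c@(single _ k v) inv pos _ e =
    replace-ok {a = a} _ (atSingle-creates a k v) inv pos (child-known inv e) single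
  visit-ok {a = a} (rebuild op) inv pos _ e =
    seeking 0 , tr-read inv improves-restart , ≤-refl , λ _ le inv′ →
    (known-mono (proj₁ le) (child-known inv e) , sealed-mono (proj₁ le) target) ,
    λ { _ refl → restart-ok {a = a} }
    where
    target = target-sealed inv (child-known inv e) (Placed.closed (placed inv e))
  visit-ok {w = w} {a = a} {i = i} (inner c) inv atRoot i≡0 e with refl ← i≡0 refl =
    seeking (Inner.address c) , tr-read inv (improves-enter e) , ≤-refl , retry-ok {a = a}
      (inside (nonroot inv e) on-c [] on-c)
    where
    on-c : OnPath w (Inner.address c) c
    on-c = onPath (child-known inv e) (at-root (belows inv e) refl)
  visit-ok {w = w} {n = n} {a = a} {i = i} (inner c) inv (inside {x} x≢0 on-x on-ms on-n) _ e =
    seeking (Inner.address x) , tr-read inv improves-refl , ≤-refl , retry-ok {a = a}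
      (inside x≢0 on-x (++⁺ on-ms (on-c ∷ [])) on-c)
    where
    on-c : OnPath w (Inner.address x) c
    on-c = onPath (child-known inv e)
      (trans (deeper (belows inv e) (below-root≢0 inv x≢0 on-n)) (path-tag on-n))

  searched-at-root : ∀ {w ℓ n path} k → Inv w → Position w ℓ n path → Inner.address n ≡ 0 →
                     interpolationSearch k (Inner.keys n) ≡ 0
  searched-at-root k inv atRoot _ = refl
  searched-at-root k inv (inside x≢0 _ _ on-n) e = contradiction e (below-root≢0 inv x≢0 on-n)

  descend-ok : ∀ {θ w ℓ n path a} → Position w ℓ n path →
               OK θ w (seeking ℓ) Finished (body (descend a n path))
  descend-ok {a = a} pos _ le inv readChild = let pos′ = position-mono (proj₁ le) pos in
    visit-ok {a = a} _ inv pos′ (searched-at-root (keyOf a) inv pos′) refl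

  rebuild-ok : ∀ {θ w u q i φ} → Overflowing w u q i φ → OK θ w φ Finished (body (rebuild u q i))
  rebuild-ok {θ} {u = u} {q} {i} {φ} over w le inv newRebuild =
    φ , tr-alloc inv al , ≤-refl , λ where
      _ le′ inv′ (dcss-success e _) → let over′ = over-at le′ in
        help over′ refl refl refl (known-mono (proj₁ le′) new-known) inv′
            (cell-is inv′ (target-known over′) e)
      _ le′ inv′ (dcss-main e) → let tr , paid = give-up-main (over-at le′) inv′ e in
        done , tr , paid , refl
      _ le′ inv′ (dcss-aux e) → let tr , paid = give-up-aux (over-at le′) inv′ e in
        done , tr , paid , refl
    where
    over₀ = overflowing-mono (proj₁ le) over
    target-ok : ∀ {w u q i φ} → Inv w → Overflowing w u q i φ →
        RebuildOK w (mkRebuild (next (mem w)) u q i)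
    target-ok inv (atRoot u≢0 (onPath kn t)) = record
      { target-nonroot = u≢0 ; target-known = kn ; target-public = _ ,
          t ; parent-known = root-known inv
      ; parent-public = _ , root-tag inv ; target-below = below (λ _ → t) (λ ne →
          contradiction refl ne) }
    target-ok inv (inside ℓ≢0 on-u@(onPath kn t) on-q@(onPath kn′ t′)) = record
      { target-nonroot = below-root≢0 inv ℓ≢0 on-u ; target-known = kn ; target-public = _ ,
          t ; parent-known = kn′ ; parent-public = _ , t′
      ; target-below = below (λ q≡0 → contradiction q≡0 (below-root≢0 inv ℓ≢0 on-q))
                             (λ _ → trans t (sym t′)) }
    al = alloc-leaf {θ} {w} _ refl λ { refl → target-ok inv over₀ }
    open Allocation inv al

    over-at : ∀ {w″} → Later θ w′ w″ → Overflowing w″ u q i φ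
    over-at le′ = overflowing-mono (mono-trans mono (proj₁ le′)) over₀

    help : ∀ {w op u q i φ} → Overflowing w u q i φ → Rebuild.target op ≡ u →
        Rebuild.parent op ≡ q →
      Rebuild.index op ≡ i → Known w (rebuild op) → (inv : Inv w) →
          heap w (Inner.address q) i ≡ inner u →
      let w″ = written θ w q i (rebuild op) (setChild (Inner.address q) i (rebuild op) (mem w)) in
      ∃[ φ′ ] Tr θ w φ w″ φ′ × Paid true w φ w″ φ′ × OK θ w″ φ′ Finished (run (helpRebuild op))
    help {w} {op} {u} {q} {i} (atRoot u≢0 on-u) target parent index kn inv at =
      done , tr , paid-install {q = root} inv (isAllocated (root-known inv)) (root-tag inv) kn at
          target parent index inst ,
      λ _ le _ → (known-mono (mono-trans (tr-mono tr) (proj₁ le)) kn ,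
                  sealed-mono (proj₁ le) (target-sealed (tr-inv tr) (known-mono (tr-mono tr) kn)
                    (Placed.closed (placed (tr-inv tr) {0} {0}
                        (setChild-hit 0 0 (rebuild op) (mem w)))))) ,
                 λ { _ post → post }
      where
      inst = install-at-root refl refl refl
      tr = tr-install {q = root} inv (isAllocated (root-known inv)) (root-tag inv) kn at target
          parent index inst
    help {w} {op} {u} {q} {i} (inside ℓ≢0 on-u on-q) target parent index kn inv at =
      done , tr , paid-install {q = q} inv (isAllocated (path-known on-q)) (path-tag on-q) kn at
          target parent index inst ,
      λ _ le _ → (known-mono (mono-trans (tr-mono tr) (proj₁ le)) kn ,
                  sealed-mono (proj₁ le) (target-sealed (tr-inv tr) (known-mono (tr-mono tr) kn)
                    (Placed.closed (placed (tr-inv tr) {Inner.address q} {i}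
                        (setChild-hit (Inner.address q) i (rebuild op) (mem w)))))) ,
                 λ { _ post → post }
      where
      inst = install-below (below-root≢0 inv ℓ≢0 on-q)
      tr = tr-install {q = q} inv (isAllocated (path-known on-q)) (path-tag on-q) kn at target
          parent index inst

    target-known : ∀ {w u q i φ} → Overflowing w u q i φ → Known w (inner u)
    target-known (atRoot _ on-u)  = path-known on-u
    target-known (inside _ on-u _) = path-known on-u

    give-up-main : ∀ {w u q i φ} → Overflowing w u q i φ → Inv w →
      ¬ (heap w (Inner.address q) i ≐ inner u) → Tr θ w φ w done × Paid false w φ w done
    give-up-main (atRoot _ _) inv ne = tr-read inv (improves-closed ne) , m≤n+m _ 2
    give-up-main (inside _ _ _) inv ne = tr-read inv improves-rebuilt , m≤n+m _ 2

    -- At the root this failure cannot occur, since the root is open and only closed nodes are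
    -- marked. Below the root the thread may give up in any case.
    give-up-aux : ∀ {w u q i φ} → Overflowing w u q i φ → Inv w →
      status (mem w) (Inner.address q) ≢ clean → Tr θ w φ w done × Paid false w φ w done
    give-up-aux (atRoot _ _) inv ne = contradiction top (proj₁ (marked inv ne))
    give-up-aux (inside _ _ _) inv ne = tr-read inv improves-rebuilt , m≤n+m _ 2

  -- Marking, collecting and helping are admissible

  count-ok : ∀ {θ w φ u} is n → Sealed w u → OK θ w φ (Unmoved φ) (countChildren u is n)
  count-ok []       n s = refl
  count-ok {φ = φ} {u} (i ∷ is) n s w le inv readChild
    with heap w (Inner.address u) i in eq
  ... | empty _      = φ , tr-read inv improves-refl , ≤-refl ,
      count-ok is (n + 0) (sealed-mono (proj₁ le) s)
  ... | single _ _ _ = φ , tr-read inv improves-refl , ≤-refl ,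
      count-ok is (n + 1) (sealed-mono (proj₁ le) s)
  ... | rebuild op   = φ , tr-read inv improves-refl , ≤-refl , λ _ le′ _ →
    rebuild (sealed-mono (proj₁ le′) (target-sealed inv (child-known inv eq)
        (Placed.closed (placed inv eq)))) ,
    λ { {x = k} m refl → count-ok is (n + k) (sealed-mono (mono-trans
        (mono-trans (proj₁ le) (proj₁ le′)) m) s) }
  ... | inner c      = φ , tr-read inv improves-refl , ≤-refl , λ where
      w′ le′ inv′ {x} readStatus → φ , tr-read inv′ improves-refl , ≤-refl ,
        subtree x (sealed-mono (mono-trans (proj₁ le) (proj₁ le′)) s)
            (sealed-mono (proj₁ le′) child-ok)
    where
    child-ok : Sealed w c
    child-ok = let s′ = sealed-mono (proj₁ le) s in child-sealed inv eq (sealed-public s′) (sealed-closed s′)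
    subtree : ∀ x {w} → Sealed w u → Sealed w c → OK _ w φ (Unmoved φ)
      ((case x of λ { ⟨ k , finished , _ ⟩ → if finished then return k else run (markAndCount (inner c)) }) >>=
        λ k → countChildren u is (n + k))
    subtree ⟨ k , true  , _ ⟩ s s′ = count-ok is (n + k) s
    subtree ⟨ k , false , _ ⟩ s s′ _ le _ = inner (sealed-mono (proj₁ le) s′) ,
      λ { {x = k} m refl → count-ok is (n + k) (sealed-mono (mono-trans (proj₁ le) m) s) }

  tr-cas : ∀ {θ w φ u old new b μ′} → Sealed w u → Inv w → mem w ⊢ casStatus u old new ⇓ b ⊣ μ′ →
           Tr θ w φ (after θ w (casStatus u old new) b μ′) φ
  tr-cas {u = u} {new = new} (sealed kn pub closed) inv (cas-success _) =
    tr-mark {u = u} new inv closed pub (isAllocated kn)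
  tr-cas s inv (cas-failure _) = tr-read inv improves-refl

  mark-ok : ∀ {θ w φ} c → Markable w c → OK θ w φ (Unmoved φ) (body (markAndCount c))
  mark-ok (empty _)      _           = refl
  mark-ok (single _ _ _) _           = refl
  mark-ok (rebuild op)   (rebuild s) _ le _ = inner (sealed-mono (proj₁ le) s) , λ { _ post → post }
  mark-ok {φ = φ} (inner u) (inner s) _ le inv st =
    φ , tr , ≤-refl ,
    ok-bind (countChildren u (upTo (Inner.degree u)) 0) (count-ok (upTo (Inner.degree u)) 0 s₁) λ {
        m refl _ le′ inv′ st′ →
      φ , tr-cas (sealed-mono (mono-trans m (proj₁ le′)) s₁) inv′ st′ , ≤-refl , refl }
    where
    s₀ = sealed-mono (proj₁ le) s
    tr = tr-cas s₀ inv st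
    s₁ = sealed-mono (tr-mono tr) s₀

  collectChildren-ok : ∀ {θ w φ u} is → Collectable w (inner u) →
      OK θ w φ (Unmoved φ) (collectChildren u is)
  collectChildren-ok [] _ = refl
  collectChildren-ok {φ = φ} {u} (i ∷ is) coll _ le inv readChild =
    φ , tr-read inv improves-refl , ≤-refl , λ w′ le′ inv′ →
    collectable-mono (proj₁ le′) (knowns inv _ _ , λ e → below-public (belows inv e)
        (proj₂ (collectable-mono (proj₁ le) coll) refl)) ,
    λ { m refl → ok-bind (collectChildren u is)
          (collectChildren-ok is (collectable-mono (mono-trans (mono-trans (proj₁ le) (proj₁ le′))
              m) coll))
          λ { _ refl → refl } }

  collect-ok : ∀ {θ w φ} c → Collectable w c → OK θ w φ (Unmoved φ) (body (collect c))
  collect-ok (empty _)      _ = refl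
  collect-ok (single _ _ _) _ = refl
  collect-ok (inner u)      coll = collectChildren-ok (upTo (Inner.degree u)) coll
  collect-ok (rebuild op)   (kn , _) _ le inv =
      let r = rebuild-known inv (known-mono (proj₁ le) kn) in
    (RebuildOK.target-known r , λ { refl → RebuildOK.target-public r }) , λ { _ post → post }

  helpRebuild-ok : ∀ {θ w φ op} → Known w (rebuild op) → Sealed w (Rebuild.target op) →
                   OK θ w φ (Unmoved φ) (body (helpRebuild op))
  helpRebuild-ok {θ} {φ = φ} {op} kn s w₁ le₁ inv₁ =
    inner (sealed-mono (proj₁ le₁) s) ,
    λ { m₁ refl w₂ le₂ inv₂ → let kn₂ = known-mono (mono-trans (mono-trans (proj₁ le₁) m₁) (proj₁ le₂)) kn in
      (RebuildOK.target-known (rebuild-known inv₂ kn₂) , λ { refl →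
          RebuildOK.target-public (rebuild-known inv₂ kn₂) }) ,
      λ { {x = kvs} m₂ refl → ok-bind (allocate (IdealConstruction.construct I kvs))
          (allocate-ok (IdealConstruction.construct I kvs)) λ where
        m₃ (refl , _ , o , _) w le inv (dcss-success e _) → let
            kn₃ = known-mono (mono-trans (mono-trans m₂ m₃) (proj₁ le)) kn₂
            open RebuildOK (rebuild-known inv kn₃)
            o′ = own-later le o
            at = cell-is inv kn₃ e
          in φ , tr-remove {q = Rebuild.parent op} inv (isAllocated parent-known)
              (proj₂ parent-public) o′ at ,
             paid-remove {q = Rebuild.parent op} inv (isAllocated parent-known)
                 (proj₂ parent-public) o′ at {φ} , refl
        m₃ (refl , _) w le inv (dcss-main _) → φ , tr-read inv improves-refl , ≤-refl , refl
        m₃ (refl , _) w le inv (dcss-aux _)  → φ , tr-read inv improves-refl , ≤-refl , refl } }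

  body-ok : ∀ f {θ w φ} → Pre f w φ → OK θ w φ (λ _ φ′ _ → Post f φ φ′) (body f)
  body-ok (operation (update a)) refl _ le inv =
    (0 , refl , atRoot) , λ { _ post → post }
  body-ok (descend a n path) (_ , refl , pos) = descend-ok {a = a} pos
  body-ok (rebuild u q i) over = rebuild-ok over
  body-ok (helpRebuild op) (kn , closed) = helpRebuild-ok kn closed
  body-ok (markAndCount c) m = mark-ok c m
  body-ok (collect c) coll = collect-ok c coll

  -- Termination without successful DCSS

  -- Existing child cells are written by successful DCSS only; an allocation writes cells of a node
  -- that was not there before.
  quiet-calm : ∀ {θ w π x μ′} → Inv w → mem w ⊢ π ⇓ x ⊣ μ′ → loud π x ≡ false →
      Calm w (after θ w π x μ′)
  quiet-calm inv readChild       _ = calm-refl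
  quiet-calm inv readStatus      _ = calm-refl
  quiet-calm inv readCount       _ = calm-refl
  quiet-calm inv (cas-success _) _ = calm-relabel _ _
  quiet-calm inv (cas-failure _) _ = calm-refl
  quiet-calm inv fetchAddCount   _ = calm-relabel _ _
  quiet-calm inv (dcss-main _)   _ = calm-refl
  quiet-calm inv (dcss-aux _)    _ = calm-refl
  quiet-calm inv newEmpty        _ = alloc-calm inv refl λ _ _ → refl
  quiet-calm inv newSingle       _ = alloc-calm inv refl λ _ _ → refl
  quiet-calm {w = w} inv (newInner {cs = cs}) _ =
    alloc-calm inv (cong suc (setChildren-next _ 0 cs _)) λ i ne →
        setChildren-other _ 0 cs _ (≢-sym ne)
  quiet-calm inv newRebuild      _ = alloc-calm inv refl λ _ _ → refl

  -- Termination of a command while the world only moves along _≼_ and no DCSS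
  -- of the command succeeds.
  data Term (_≼_ : World → World → Set) (θ : Fin p) {A : Set} (Q : A → Set) (w : World) : Cmd A →
      Set where
    return : ∀ {x} → Q x → Term _≼_ θ Q w (return x)
    prim   : ∀ {π g} →
      (∀ w′ → w ≼ w′ → Inv w′ → ∀ {x μ′} → mem w′ ⊢ π ⇓ x ⊣ μ′ → loud π x ≡ false →
         Term _≼_ θ Q (after θ w′ π x μ′) (g x)) →
      Term _≼_ θ Q w (prim π g)
    call   : ∀ {f g} → (∀ w′ → w ≼ w′ → Inv w′ → Term _≼_ θ Q w′ (body f >>= g)) →
      Term _≼_ θ Q w (call f g)

  Any : ∀ {A : Set} → A → Set
  Any _ = ⊤

  -- Packing a command with its termination proof turns termination into accessibility for one
  -- relation, so that the runs of all threads form a tuple to which `oneBelow-acc` applies.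
  record Run (_≼_ : Fin p → World → World → Set) (A : Set) : Set where
    constructor ⟨_,_,_,_⟩ʳ
    field
      runner  : Fin p
      start   : World
      command : Cmd A
      halts   : Term (_≼_ runner) runner Any start command

  data _≺_ {_≼_ A} : Run _≼_ A → Run _≼_ A → Set where
    prim : ∀ {θ w π g h w′ le inv x μ′ st quiet} →
      ⟨ θ , after θ w′ π x μ′ , g x , h w′ le inv {x} {μ′} st quiet ⟩ʳ ≺ ⟨ θ , w , prim π g ,
          prim h ⟩ʳ
    call : ∀ {θ w f g h w′ le inv} →
      ⟨ θ , w′ , body f >>= g , h w′ le inv ⟩ʳ ≺ ⟨ θ , w , call f g , call h ⟩ʳ

  ≺-acc : ∀ {_≼_ A θ w} {c : Cmd A} (t : Term (_≼_ θ) θ Any w c) →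
      Acc (_≺_ {_≼_} {A}) ⟨ θ , w , c , t ⟩ʳ
  ≺-acc (return q) = acc λ ()
  ≺-acc (prim h)   = acc λ { (prim {w′ = w′} {le} {inv} {st = st} {quiet}) →
      ≺-acc (h w′ le inv st quiet) }
  ≺-acc (call h)   = acc λ { (call {w′ = w′} {le} {inv}) → ≺-acc (h w′ le inv) }

  Quiet : Fin p → World → World → Set
  Quiet θ w w′ = Calm w w′ × Keep θ w w′

  Halts : ∀ {A} → Fin p → (A → Set) → World → Cmd A → Set
  Halts θ = Term (Quiet θ) θ

  -- Continuations are functions, so associativity of `>>=` holds up to pointwise equality of
  -- continuations. Termination respects this relation.
  data _≅_ {A : Set} : Cmd A → Cmd A → Set where
    return : ∀ {x} → return x ≅ return x
    prim   : ∀ {π g h} → (∀ x → g x ≅ h x) → prim π g ≅ prim π h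
    call   : ∀ {f g h} → (∀ x → g x ≅ h x) → call f g ≅ call f h

  ≅-refl : ∀ {A} (c : Cmd A) → c ≅ c
  ≅-refl (return x) = return
  ≅-refl (prim π g) = prim λ x → ≅-refl (g x)
  ≅-refl (call f g) = call λ x → ≅-refl (g x)

  >>=-congʳ : ∀ {A B} (c : Cmd A) {g h : A → Cmd B} → (∀ x → g x ≅ h x) → (c >>= g) ≅ (c >>= h)
  >>=-congʳ (return x) eq = eq x
  >>=-congʳ (prim π k) eq = prim λ x → >>=-congʳ (k x) eq
  >>=-congʳ (call f k) eq = call λ x → >>=-congʳ (k x) eq

  >>=-assoc : ∀ {A B C} (c : Cmd A) (g : A → Cmd B) (h : B → Cmd C) →
              ((c >>= g) >>= h) ≅ (c >>= λ x → g x >>= h)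
  >>=-assoc (return x) g h = ≅-refl (g x >>= h)
  >>=-assoc (prim π k) g h = prim λ x → >>=-assoc (k x) g h
  >>=-assoc (call f k) g h = call λ x → >>=-assoc (k x) g h

  term-resp : ∀ {_≼_ θ A w} {Q : A → Set} {c d : Cmd A} → c ≅ d → Term _≼_ θ Q w c →
      Term _≼_ θ Q w d
  term-resp return    (return q) = return q
  term-resp (prim eq) (prim h)   = prim λ w′ le inv st l → term-resp (eq _) (h w′ le inv st l)
  term-resp (call {f} eq) (call h) = call λ w′ le inv → term-resp (>>=-congʳ (body f) eq)
      (h w′ le inv)

  term-bind : ∀ {θ A B w} {Q : A → Set} {Q′ : B → Set} {c : Cmd A} {g : A → Cmd B} →
    Halts θ Q w c → (∀ {w′ x} → Calm w w′ → Q x → Halts θ Q′ w′ (g x)) → Halts θ Q′ w (c >>= g)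
  term-bind (return q) k = k calm-refl q
  term-bind (prim h) k = prim λ w′ le inv st l → term-bind (h w′ le inv st l) λ calm →
    k (calm-trans (calm-trans (proj₁ le) (quiet-calm inv st l)) calm)
  term-bind {g = g} (call {f} {g₀} h) k = call λ w′ le inv → term-resp (>>=-assoc (body f) g₀ g)
    (term-bind (h w′ le inv) λ calm → k (calm-trans (proj₁ le) calm))

  term-call : ∀ {θ A w f} {Q : Returns f → Set} {Q′ : A → Set} {g : Returns f → Cmd A} →
    (∀ {w′} → Calm w w′ → Inv w′ → Halts θ Q w′ (body f)) →
    (∀ {w′ x} → Calm w w′ → Q x → Halts θ Q′ w′ (g x)) → Halts θ Q′ w (call f g)
  term-call h k = call λ w′ le inv → term-bind (h (proj₁ le) inv) λ calm →
      k (calm-trans (proj₁ le) calm)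

  term-run : ∀ {θ w f} {Q : Returns f → Set} →
    (∀ {w′} → Calm w w′ → Inv w′ → Halts θ Q w′ (body f)) → Halts θ Q w (run f)
  term-run h = term-call h λ _ q → return q

  data Child : Node → Inner → Set where
    inner   : ∀ {u} → Child (inner u) u
    rebuild : ∀ {op} → Child (rebuild op) (Rebuild.target op)

  child-points : ∀ {c u} → Child c u → Points c (Inner.address u)
  child-points inner   = inner
  child-points rebuild = rebuild

  record InHeap (w : World) (u : Inner) : Set where
    constructor inHeap
    field
      heap-known  : Known w (inner u)
      heap-public : Public w (Inner.address u)
  open InHeap

  inHeap-mono : ∀ {w w′ u} → Mono w w′ → InHeap w u → InHeap w′ u
  inHeap-mono m (inHeap k pub) = inHeap (known-mono m k) (public-mono m (isAllocated k) pub)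

  child-inHeap : ∀ {w a i c u} → Inv w → Public w a → heap w a i ≡ c → Child c u → InHeap w u
  child-inHeap inv pub e inner   = inHeap (child-known inv e) (below-public (belows inv e) pub)
  child-inHeap inv pub e rebuild = let open RebuildOK (placed-known inv e) in inHeap target-known target-public

  -- The recursion follows the heap of one fixed world. In its uses `P` quantifies over all later
  -- worlds in which the relevant cells are still the same.
  heap-rec : ∀ {w} (P : Inner → Set) → Inv w →
    (∀ {u} → InHeap w u →
       (∀ {i c v} → heap w (Inner.address u) i ≡ c → Child c v → P v) → P u) →
    ∀ {u} → InHeap w u → P u
  heap-rec {w} P inv ind {u} h = go h (wf inv (Inner.address u))
    where
    go : ∀ {u} → InHeap w u → Acc (Edge (heap w)) (Inner.address u) → P u
    go h (acc rs) = ind h λ { {i} e ch →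
      go (child-inHeap inv (heap-public h) e ch)
         (rs (i , subst (λ c → Points c _) (sym e) (child-points ch))) }

  cell-same : ∀ {w w′ u} → Calm w w′ → InHeap w u → ∀ i → heap w′ (Inner.address u) i
      ≡ heap w (Inner.address u) i
  cell-same (_ , s) (inHeap k pub) i = same s i (isAllocated k) pub

  module _ {θ : Fin p} where

    allocate-term  : ∀ t {w} → Halts θ Any w (allocate t)
    allocate*-term : ∀ ts {w} → Halts θ Any w (allocate* ts)
    allocate-term empty          = prim λ _ _ _ _ _ → return tt
    allocate-term (single _ _)   = prim λ _ _ _ _ _ → return tt
    allocate-term (inner _ _ ts) = term-bind (allocate*-term ts) λ _ _ → prim λ _ _ _ _ _ →
        return tt
    allocate*-term []       = return tt
    allocate*-term (t ∷ ts) = term-bind (allocate-term t) λ _ _ →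
        term-bind (allocate*-term ts) λ _ _ → return tt

    collect-term : ∀ {w u} → Inv w → InHeap w u → Halts θ Any w (body (collect (inner u)))
    collect-term {w₀} inv₀ h₀ = heap-rec P inv₀ (λ {u} h rec calm →
        children h rec (upTo (Inner.degree u)) calm) h₀ calm-refl
      where
      P : Inner → Set
      P u = ∀ {w} → Calm w₀ w → Halts θ Any w (body (collect (inner u)))
      children : ∀ {u w} → InHeap w₀ u →
        (∀ {i c v} → heap w₀ (Inner.address u) i ≡ c → Child c v → P v) →
        ∀ is → Calm w₀ w → Halts θ Any w (collectChildren u is)
      children h rec [] calm = return tt
      children {u} h rec (i ∷ is) calm = prim λ { w′ le inv readChild _ →
          let calm′ = calm-trans calm (proj₁ le) in
        term-call (λ le′ _ → node _ (sym (cell-same calm′ h i)) (calm-trans calm′ le′))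
          λ le′ _ → term-bind (children h rec is (calm-trans calm′ le′)) λ _ _ → return tt }
        where
        node : ∀ c → heap w₀ (Inner.address u) i ≡ c → ∀ {w} → Calm w₀ w →
            Halts θ Any w (body (collect c))
        node (empty _)      e calm = return tt
        node (single _ _ _) e calm = return tt
        node (inner v)      e calm = rec e inner calm
        node (rebuild op)   e calm = term-run λ le _ → rec e rebuild (calm-trans calm le)

    mark-term : ∀ {w u} → Inv w → InHeap w u → Halts θ Any w (body (markAndCount (inner u)))
    mark-term {w₀} inv₀ h₀ = heap-rec P inv₀ (λ {u} h rec calm → prim λ w′ le inv st l →
        term-bind (children h rec (upTo (Inner.degree u)) 0 (calm-trans (calm-trans calm (proj₁ le))
            (quiet-calm {θ} inv st l)))
          λ _ _ → prim λ _ _ _ _ _ → return tt) h₀ calm-refl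
      where
      P : Inner → Set
      P u = ∀ {w} → Calm w₀ w → Halts θ Any w (body (markAndCount (inner u)))
      children : ∀ {u w} → InHeap w₀ u →
        (∀ {i c v} → heap w₀ (Inner.address u) i ≡ c → Child c v → P v) →
        ∀ is n → Calm w₀ w → Halts θ Any w (countChildren u is n)
      children h rec [] n calm = return tt
      children {u} {w} h rec (i ∷ is) n calm = prim go
        where
        go : ∀ w′ → Quiet θ w w′ → Inv w′ → ∀ {c μ′} → mem w′ ⊢ readChild u i ⇓ c ⊣ μ′ →
            false ≡ false →
             Halts θ Any (after θ w′ (readChild u i) c μ′) _
        go w′ le inv readChild _ with heap w′ (Inner.address u) i | sym
            (cell-same (calm-trans calm (proj₁ le)) h i)
        ... | empty _      | e = children h rec is (n + 0) (calm-trans calm (proj₁ le))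
        ... | single _ _ _ | e = children h rec is (n + 1) (calm-trans calm (proj₁ le))
        ... | rebuild op   | e = let calm′ = calm-trans calm (proj₁ le) in
          term-call {Q = Any} (λ le′ _ → term-run λ le″ _ → rec e rebuild
              (calm-trans (calm-trans calm′ le′) le″))
            λ {_} {k} le′ _ → children h rec is (n + k) (calm-trans calm′ le′)
        ... | inner v      | e = prim λ where
            w″ le′ inv′ {x} readStatus _ → finish x (calm-trans (calm-trans calm (proj₁ le))
                (proj₁ le′))
          where
          finish : ∀ x {w} → Calm w₀ w → Halts θ Any w
            ((case x of λ { ⟨ k , finished , _ ⟩ → if finished then return k else run (markAndCount (inner v)) }) >>=
              λ k → countChildren u is (n + k))
          finish ⟨ k , true  , _ ⟩ calm = children h rec is (n + k) calm
          finish ⟨ k , false , _ ⟩ calm = term-call {Q = Any} (λ le _ →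
              rec e inner (calm-trans calm le))
            λ {_} {k} le _ → children h rec is (n + k) (calm-trans calm le)

    restarts : Update → World → Set
    restarts a w = Halts θ Any w (run (operation (update a)))

    -- Without successful DCSS, helping ends with a failure. `Q` hands its cause to the caller, who
    -- concludes that the node it stands at is not open.
    helpRebuild-term : ∀ {Q : ⊤ → Set} {w op} → Known w (rebuild op) →
      (let q = Inner.address (Rebuild.parent op) in
       ∀ {w′} → Calm w w′ → Inv w′ →
       ¬ (heap w′ q (Rebuild.index op) ≐ rebuild op) ⊎ status (mem w′) q ≢ clean → Q tt) →
      Halts θ Q w (body (helpRebuild op))
    helpRebuild-term {op = op} kn fails =
      term-call (λ le inv → mark-term inv (target inv (known-mono (proj₁ le) kn))) λ le₁ _ →
      term-call (λ le inv → collect-term inv (target inv (known-mono (proj₁ (calm-trans le₁ le))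
          kn))) λ {_} {kvs} le₂ _ →
      term-bind (allocate-term (IdealConstruction.construct I kvs)) λ le₃ _ →
      let calm = calm-trans (calm-trans le₁ le₂) le₃ in
      prim λ where
        _ le inv (dcss-main ne) _ → return (fails (calm-trans calm (proj₁ le)) inv (inj₁ ne))
        _ le inv (dcss-aux ne)  _ → return (fails (calm-trans calm (proj₁ le)) inv (inj₂ ne))
      where
      target : ∀ {w} → Inv w → Known w (rebuild op) → InHeap w (Rebuild.target op)
      target inv kn = let open RebuildOK (rebuild-known inv kn) in inHeap target-known target-public

    -- At an open node no DCSS fails while the public cells stay the same, so a
    -- descent restarts only from a node that is not open.
    descend-term : ∀ {w u a path} → Inv w → InHeap w u →
      (∀ {w′} → Calm w w′ → ¬ Open (heap w) (Inner.address u) → restarts a w′) →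
      Halts θ Any w (body (descend a u path))
    descend-term {w₀} {a = a} inv₀ h₀ = λ restart → heap-rec P inv₀ step h₀ calm-refl restart
      where
      P : Inner → Set
      P u = ∀ {w path} → Calm w₀ w →
        (∀ {w′} → Calm w₀ w′ → ¬ Open (heap w₀) (Inner.address u) → restarts a w′) →
        Halts θ Any w (body (descend a u path))
      step : ∀ {u} → InHeap w₀ u →
        (∀ {i c v} → heap w₀ (Inner.address u) i ≡ c → Child c v → P v) → P u
      step {u} h rec {w} {path} calm restart = prim λ { w′ le inv readChild _ →
        let calm′ = calm-trans calm (proj₁ le) in visited _ (sym (cell-same calm′ h i)) calm′ }
        where
        i = interpolationSearch (keyOf a) (Inner.keys u)

        -- Calm steps preserve openness, so a status found dirty now shows that the node was closed
        -- in `w₀` already.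
        not-open : ∀ {w} → Calm w₀ w → Inv w → status (mem w) (Inner.address u) ≢ clean →
            ¬ Open (heap w₀) (Inner.address u)
        not-open {w} calm inv ne o = proj₁ (marked inv ne) (open-calm {w₀} {w} inv₀ (proj₂ calm) o)

        replaced : ∀ {c} → heap w₀ (Inner.address u) i ≡ c → ∀ m →
            m ≡ nothing ⊎ ∃[ t ] m ≡ just (allocate t) →
          ∀ {w} → Calm w₀ w → Halts θ Any w (replace a u path i c m)
        replaced e .nothing (inj₁ refl) calm = return tt
        replaced e .(just (allocate t)) (inj₂ (t , refl)) calm =
            term-bind (allocate-term t) λ le₁ _ → prim λ where
          _ le inv (dcss-main ne) _ → contradiction
            (cong address (trans (cell-same (calm-trans (calm-trans calm le₁) (proj₁ le)) h i) e))
                ne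
          _ le inv (dcss-aux ne)  _ → let calm′ = calm-trans (calm-trans calm le₁) (proj₁ le) in
            restart calm′ (not-open calm′ inv ne)

        visited : ∀ c → heap w₀ (Inner.address u) i ≡ c → ∀ {w} → Calm w₀ w →
            Halts θ Any w (visit a u path i c)
        visited (empty _)      e calm = replaced e _ (atEmpty-creates a) calm
        visited (single _ k v) e calm = replaced e _ (atSingle-creates a k v) calm
        visited (inner v)      e calm = term-run λ le _ → rec e inner (calm-trans calm le)
          λ le′ closed → restart le′ λ o → closed (down o e)
        visited (rebuild op)   e calm =
          term-call {Q = λ _ → ¬ Open (heap w₀) (Inner.address u)}
            (λ le _ → let calm′ = calm-trans calm le in
               helpRebuild-term (known-mono (proj₁ calm′) (child-known inv₀ e)) λ le′ inv →
                   failed (calm-trans calm′ le′) inv)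
            λ le closed → restart (calm-trans calm le) closed
          where
          open Placed (placed inv₀ e)
          failed : ∀ {w} → Calm w₀ w → Inv w → let q = Inner.address (Rebuild.parent op) in
            ¬ (heap w q (Rebuild.index op) ≐ rebuild op) ⊎ status (mem w) q ≢ clean →
                ¬ Open (heap w₀) (Inner.address u)
          failed {w} calm inv (inj₁ ne) = contradiction
            (trans (cong₂ (λ q j → address (heap w q j)) parent index)
                (cong address (trans (cell-same calm h i) e))) ne
          failed {w} calm inv (inj₂ ne) = not-open calm inv (subst (λ q →
              status (mem w) q ≢ clean) parent ne)

    root-inHeap : ∀ {w} → Inv w → InHeap w root
    root-inHeap inv = inHeap (root-known inv) (_ , root-tag inv)

    restart-term : ∀ {w} a → restarts a w
    restart-term a = term-run λ _ _ → term-run λ _ inv →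
      descend-term inv (root-inHeap inv) λ _ closed → contradiction top closed

    position-inHeap : ∀ {w ℓ n path} → Inv w → Position w ℓ n path → InHeap w n
    position-inHeap inv atRoot = root-inHeap inv
    position-inHeap inv (inside _ _ _ (onPath kn t)) = inHeap kn (_ , t)

    body-term : ∀ f {w φ} → Pre f w φ → Inv w → Halts θ Any w (body f)
    body-term (operation (update a)) _ inv = term-run λ _ inv′ →
      descend-term inv′ (root-inHeap inv′) λ _ closed → contradiction top closed
    body-term (descend a n path) (_ , _ , pos) inv =
      descend-term inv (position-inHeap inv pos) λ _ _ → restart-term a
    body-term (rebuild u q i) _ inv = prim λ _ _ _ _ _ → prim λ where
      _ le inv′ (dcss-main _) _ → return tt
      _ le inv′ (dcss-aux _)  _ → return tt
    body-term (helpRebuild op) (kn , _) inv = helpRebuild-term kn λ _ _ _ → tt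
    body-term (markAndCount (empty _))      _ inv = return tt
    body-term (markAndCount (single _ _ _)) _ inv = return tt
    body-term (markAndCount (inner u)) (inner s) inv = mark-term inv
        (inHeap (sealed-known s) (sealed-public s))
    body-term (markAndCount (rebuild op)) (rebuild s) inv = term-run λ le inv′ →
      mark-term inv′ (inHeap-mono (proj₁ le) (inHeap (sealed-known s) (sealed-public s)))
    body-term (collect (empty _))      _ inv = return tt
    body-term (collect (single _ _ _)) _ inv = return tt
    body-term (collect (inner u)) (kn , pub) inv = collect-term inv (inHeap kn (pub refl))
    body-term (collect (rebuild op)) (kn , _) inv = term-run λ le inv′ →
      let open RebuildOK (rebuild-known inv′ (known-mono (proj₁ le) kn)) in
      collect-term inv′ (inHeap target-known target-public)

    -- Termination ignores phases, but the continuation of a call is `OK` only in a phase that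
    -- satisfies `Post`; any such phase will do.
    post-exists : ∀ f φ → ∃[ φ′ ] Post f φ φ′
    post-exists (operation _)    φ = _ , refl
    post-exists (descend _ _ _)  φ = _ , refl
    post-exists (search _ _)     φ = _ , refl
    post-exists (rebuild _ _ _)  φ = _ , refl
    post-exists (helpRebuild _)  φ = _ , refl
    post-exists (markAndCount _) φ = _ , refl
    post-exists (collect _)      φ = _ , refl

    ok-term : ∀ {A w φ} {Q : World → Phase → A → Set} c → OK θ w φ Q c → Halts θ Any w c
    ok-term (return x) ok = return tt
    ok-term (prim π g) ok = prim λ w′ le inv st l →
      ok-term (g _) (proj₂ (proj₂ (proj₂ (ok w′ (proj₁ (proj₁ le) , proj₂ le) inv st))))
    ok-term {φ = φ} (call f g) ok = call λ w′ le inv →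
      let pre , ok′ = ok w′ (proj₁ (proj₁ le) , proj₂ le) inv in
      term-bind (body-term f pre inv) λ calm _ →
        ok-term (g _) (ok′ (proj₁ calm) (proj₂ (post-exists f φ)))

  -- Executions

  data LookupState : Cmd (Maybe V) → Set where
    calling   : ∀ {k c} → LookupState (call (search k c) return)
    reading   : ∀ {k u i} → LookupState (prim (readChild u i) λ c → call (search k c) return)
    returning : ∀ {x} → LookupState (return x)

  data ThreadOK (θ : Fin p) (w : World) : Phase → Thread → Set where
    idle     : ThreadOK θ w away idle
    updating : ∀ {φ a c} → OK θ w φ Finished c → ThreadOK θ w φ (running (update a) c)
    looking  : ∀ {k c} → LookupState c → ThreadOK θ w away (running (lookup k) c)

  data WorldStep (θ : Fin p) (w : World) : Thread → Event → World → Thread → Set where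
    invoke   : ∀ {o} → WorldStep θ w idle (invoked o) w (running o (body (operation o)))
    prim     : ∀ {o π x μ′} {g : Result π → Cmd (OpResult o)} → mem w ⊢ π ⇓ x ⊣ μ′ →
               WorldStep θ w (running o (prim π g)) (internal o) (after θ w π x μ′)
                   (running o (g x))
    call     : ∀ {o f} {g : Returns f → Cmd (OpResult o)} →
               WorldStep θ w (running o (call f g)) (internal o) w (running o (body f >>= g))
    complete : ∀ {o x} → WorldStep θ w (running o (return x)) (completed o) w idle

  worldStep : ∀ {θ w T e μ μ′ T′} → mem w ≡ μ → ThreadStep μ T e μ′ T′ →
              ∃[ w′ ] mem w′ ≡ μ′ × WorldStep θ w T e w′ T′
  worldStep refl invoke    = _ , refl , invoke
  worldStep {θ} {w} refl (prim {π = π} {x} {μ′} st) = _ , after-mem θ w π x μ′ , prim st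
  worldStep refl call      = _ , refl , call
  worldStep refl complete  = _ , refl , complete

  -- Invoking an update is charged like a successful DCSS, since the thread starts a new command,
  -- unrelated to its old run. Between completions each thread can do so only once.
  costly : ∀ {θ w T e w′ T′} → WorldStep θ w T e w′ T′ → Bool
  costly (invoke {update _})       = true
  costly (invoke {lookup _})       = false
  costly (prim {π = π} {x = x} _)  = loud π x
  costly call                      = false
  costly complete                  = false

  improves-unlabelled : ∀ {w φ φ′} → phaseLabel φ ≡ 0 → phaseLabel φ′ ≡ 0 → Improves w φ φ′
  improves-unlabelled e e′ = improves-leave e′ λ tn _ eq _ _ →
      contradiction (trans (sym eq) e) (notRoot tn)

  step-ok : ∀ {θ w φ T e w′ T′} → Inv w → ThreadOK θ w φ T → (st : WorldStep θ w T e w′ T′) →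
    ∃[ φ′ ] Tr θ w φ w′ φ′ × ThreadOK θ w′ φ′ T′ ×
      ((∃[ a ] e ≡ completed (update a)) ⊎ Paid (costly st) w φ w′ φ′)
  step-ok inv idle (invoke {update a}) = seeking 0 , tr-read inv (improves-unlabelled refl refl) ,
    updating (body-ok (operation (update a)) refl) , inj₂ ≤-refl
  step-ok inv idle (invoke {lookup k}) = away , tr-read inv improves-refl , looking calling ,
      inj₂ ≤-refl
  step-ok {w = w} inv (updating ok) (prim st) = let φ′ , tr , paid , ok′ = ok w later-refl inv st in
    φ′ , tr , updating ok′ , inj₂ paid
  step-ok {w = w} {φ} inv (updating ok) (call {f = f}) = let pre , ok′ = ok w later-refl inv in
    φ , tr-read inv improves-refl , updating (ok-bind (body f) (body-ok f pre) ok′) , inj₂ ≤-refl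
  step-ok inv (updating refl) complete =
    away , tr-read inv (improves-unlabelled refl refl) , idle , inj₁ (_ , refl)
  step-ok inv (looking reading) (prim readChild) = away , tr-read inv improves-refl ,
      looking calling , inj₂ ≤-refl
  step-ok inv (looking (calling {c = empty _}))      call = away , tr-read inv improves-refl ,
      looking returning , inj₂ ≤-refl
  step-ok inv (looking (calling {c = single _ _ _})) call = away , tr-read inv improves-refl ,
      looking returning , inj₂ ≤-refl
  step-ok inv (looking (calling {c = inner _}))      call = away , tr-read inv improves-refl ,
      looking reading , inj₂ ≤-refl
  step-ok inv (looking (calling {c = rebuild _}))    call = away , tr-read inv improves-refl ,
      looking calling , inj₂ ≤-refl
  step-ok inv (looking returning) complete = away , tr-read inv improves-refl , idle , inj₂ ≤-refl

  threadOK-later : ∀ {θ w w′ φ T} → Later θ w w′ → ThreadOK θ w φ T → ThreadOK θ w′ φ T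
  threadOK-later le idle                  = idle
  threadOK-later le (updating {c = c} ok) = updating (ok-later c ok le)
  threadOK-later le (looking l)           = looking l


  open Config
  open Step
  open Execution

  record State (C : Config p) : Set where
    field
      world   : World
      world≡  : mem world ≡ memory C
      inv     : Inv world
      phase   : Fin p → Phase
      threads-ok : ∀ θ → ThreadOK θ world (phase θ) (threads C θ)
  open State

  record Advance {C C′ : Config p} (θ : Fin p) (e : Event) (S : State C) (S′ : State C′) : Set where
    field
      world-step : WorldStep θ (world S) (threads C θ) e (world S′) (threads C′ θ)
      others-phase : ∀ j → j ≢ θ → phase S′ j ≡ phase S j
      tr         : Tr θ (world S) (phase S θ) (world S′) (phase S′ θ)
      -- Completion raises the credit of the thread from 0 back to 4 and so cannot be paid for; it
      -- is the event sought.
      paid       : (∃[ a ] e ≡ completed (update a)) ⊎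
                   Paid (costly world-step) (world S) (phase S θ) (world S′) (phase S′ θ)
  open Advance

  abstract
    advance : ∀ {C C′ θ e} (S : State C) → Step C θ e C′ → Σ (State C′) (Advance θ e S)
    advance {C} {C′} {θ} {e} S st
      with w′ , w≡ , ws ← worldStep {θ} (world≡ S) (moves st)
      with φ′ , tr′ , ok′ , paid′ ← step-ok (inv S) (threads-ok S θ) ws =
      S′ , record
        { world-step = ws
        ; others-phase = λ j ne → ≔-other (phase S) ne
        ; tr = subst (Tr θ (world S) (phase S θ) w′) (sym phase′) tr′
        ; paid = subst (λ φ → (∃[ a ] e ≡ completed (update a)) ⊎ Paid (costly ws) (world S)
            (phase S θ) w′ φ) (sym phase′) paid′
        }
      where
      phase′ : (phase S [ θ ≔ φ′ ]) θ ≡ φ′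
      phase′ = ≔-same (phase S) θ
      S′ : State C′
      S′ = record
        { world = w′ ; world≡ = w≡ ; inv = tr-inv tr′ ; phase = phase S [ θ ≔ φ′ ]
        ; threads-ok = ok }
        where
        ok : ∀ j → ThreadOK j w′ ((phase S [ θ ≔ φ′ ]) j) (threads C′ j)
        ok j with j Fin.≟ θ
        ... | yes refl = ok′
        ... | no ne = subst (ThreadOK j w′ (phase S j)) (sym (others st j ne))
          (threadOK-later (tr-mono tr′ , tr-rely tr′ ne) (threads-ok S j))

  initialWorld : World
  initialWorld = record
    { mem = initialMemory ; nodeAt = (λ _ → empty 1) [ 0 ↦ inner root ]
    ; tag = λ _ → shared 0 ; rebuilds = [] }

  initial-inv : Inv initialWorld
  initial-inv = record
    { knowns = λ _ _ → known (s≤s (s≤s z≤n)) refl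
    ; unallocated = λ _ → refl
    ; root-known = known (s≤s z≤n) refl
    ; root-tag = refl
    ; unique = λ ()
    ; nonroot = λ ()
    ; belows = λ ()
    ; rebuildOK = λ { {zero} _ () ; {suc a} _ () }
    ; placed = λ ()
    ; marked = λ ne → contradiction refl ne
    ; wf = λ _ → acc λ { (_ , ()) }
    }

  module _ (E : Execution p) where

    initialState : State (config E 0)
    initialState = record
      { world = initialWorld ; world≡ = sym (initial-memory E) ; inv = initial-inv ; phase = λ _ →
          away
      ; threads-ok = λ θ → subst (ThreadOK θ initialWorld away) (sym (initial-idle E θ)) idle }

    state : ∀ n → State (config E n)
    state zero    = initialState
    state (suc n) = proj₁ (advance (state n) (step E n))

    adv : ∀ n → Advance (thread E n) (event E n) (state n) (state (suc n))
    adv n = proj₂ (advance (state n) (step E n))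

  -- Lock-freedom of the updates

  UpdateRun : Set
  UpdateRun = Run Quiet ⊤

  -- The world of a run is that of the last step of the thread, so that steps of
  -- other threads leave the run unchanged.
  data Follows (θ : Fin p) (w : World) : Thread → UpdateRun → Set where
    idle     : ∀ {r} → Follows θ w idle r
    looking  : ∀ {k c r} → Follows θ w (running (lookup k) c) r
    updating : ∀ {a c w₀ t} → Quiet θ w₀ w → Follows θ w (running (update a) c) ⟨ θ , w₀ , c , t ⟩ʳ

  quiet-trans : ∀ {θ u v w} → Quiet θ u v → Quiet θ v w → Quiet θ u w
  quiet-trans (m , k) (n , l) = calm-trans m n , proj₂ (later-trans (proj₁ m , k) (proj₁ n , l))

  follows-quiet : ∀ {θ w w′ T r} → Quiet θ w w′ → Follows θ w T r → Follows θ w′ T r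
  follows-quiet q idle          = idle
  follows-quiet q looking       = looking
  follows-quiet q (updating q₀) = updating (quiet-trans q₀ q)

  thread-run : ∀ {θ w φ T} → ThreadOK θ w φ T → ∃[ r ] Acc _≺_ r × Follows θ w T r
  thread-run {θ} {w} idle = ⟨ θ , w , return tt , return tt ⟩ʳ , ≺-acc (return tt) , idle
  thread-run {θ} {w} (looking _) = ⟨ θ , w , return tt , return tt ⟩ʳ , ≺-acc (return tt) , looking
  thread-run {θ} {w} (updating {c = c} ok) = _ , ≺-acc (ok-term c ok) ,
      updating (calm-refl , keep-refl)

  -- A thread that `looks` is compatible with every run afterwards: its next update begins with an
  -- invocation that `pays`, and then all runs are chosen anew.
  data Effect {θ w T e w′ T′} (st : WorldStep θ w T e w′ T′) : Set where
    completes : ∀ {a} → e ≡ completed (update a) → Effect st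
    pays      : costly st ≡ true → Effect st
    continues : costly st ≡ false → Calm w w′ → (∀ {r} → Follows θ w T r →
        ∃[ r′ ] r′ ≺ r × Follows θ w′ T′ r′) → Effect st
    looks     : costly st ≡ false → Calm w w′ → ¬ IsUpdate (op e) → (∀ {r} → Follows θ w′ T′ r) →
        Effect st

  effect : ∀ {θ w φ T e w′ T′} → Inv w → ThreadOK θ w φ T → (st : WorldStep θ w T e w′ T′) →
      Effect st
  effect inv _ (invoke {update a}) = pays refl
  effect inv _ (invoke {lookup k}) = looks refl calm-refl (λ ()) looking
  effect inv (updating ok) (prim {π = π} {x = x} st) with loud π x in eq
  ... | true  = pays eq
  ... | false = continues eq (quiet-calm inv st eq) λ { (updating {t = prim h} q) → _ ,
      prim {h = h} {le = q} {inv} {st = st} {eq} , updating (calm-refl , keep-refl) }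
  effect inv (updating ok) call = continues refl calm-refl λ
    { (updating {t = call h} q) → _ , call {h = h} {le = q} {inv} ,
        updating (calm-refl , keep-refl) }
  effect inv (updating ok) complete = completes refl
  effect inv (looking reading) (prim readChild) = looks refl calm-refl (λ ()) looking
  effect inv (looking _) call = looks refl calm-refl (λ ()) looking
  effect inv (looking returning) complete = looks refl calm-refl (λ ()) idle

  module _ (E : Execution p) (often : InfinitelyOften (λ n → IsUpdate (op (event E n)))) where

    Completion : ℕ → Set
    Completion n = ∃[ m ] n ≤ m × (∃[ o ] IsUpdate o × event E m ≡ completed o)

    later-completion : ∀ {n} → Completion (suc n) → Completion n
    later-completion (m , le , c) = m , <⇒≤ le , c

    budget : ℕ → ℕ
    budget n = ∑ (credit ∘ phase (state E n)) + total (world (state E n))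

    budget-step : ∀ n → (∃[ a ] event E n ≡ completed (update a)) ⊎
                  cost (costly (world-step (adv E n))) + budget (suc n) ≤ budget n
    budget-step n with paid (adv E n)
    ... | inj₁ c = inj₁ c
    ... | inj₂ le = inj₂ (∑-shift-≤ (thread E n) {b = total (world (state E (suc n)))}
      (λ j ne → cong credit (others-phase (adv E n) j ne)) (cost (costly (world-step (adv E n))))
          le)

    Runs : ℕ → (Fin p → UpdateRun) → Set
    Runs n rs = ∀ θ → Follows θ (world (state E n)) (threads (config E n) θ) (rs θ)

    -- Three nested inductions: on a bound for the budget, on the tuple of runs, and on the number
    -- of steps until the next step of an update. The last is needed because steps of lookups may
    -- lower neither of the first two.
    from-budget : ∀ {b} → Acc _<_ b → ∀ n → budget n ≤ b → Completion n
    from-budget (acc smaller) n le = fresh-runs n le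
      where
      from-runs : ∀ {rs} → Acc (OneBelow _≺_) rs → ∀ n → Runs n rs → budget n ≤ _ → Completion n
      walk : ∀ {rs} → (∀ {rs′} → OneBelow _≺_ rs′ rs → Acc (OneBelow _≺_) rs′) →
             ∀ d n → Runs n rs → budget n ≤ _ → IsUpdate (op (event E (d + n))) → Completion n
      from-runs (acc lower) n runs le with m , n≤m , upd ← often n =
        walk lower (m ∸ n) n runs le (subst (IsUpdate ∘ op ∘ event E) (sym (m∸n+n≡m n≤m)) upd)
      walk {rs} lower d n runs le upd
        with effect (inv (state E n)) (threads-ok (state E n) (thread E n)) (world-step (adv E n))
            | budget-step n
      ... | completes e | _ = n , ≤-refl , _ , update , e
      ... | _ | inj₁ (_ , e) = n , ≤-refl , _ , update , e
      ... | pays c | inj₂ paid = later-completion (from-budget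
        (smaller (<-≤-trans (subst (λ b → cost b + budget (suc n) ≤ budget n) c paid) le)) (suc n)
            ≤-refl)
      ... | continues c calm next-run | inj₂ paid = later-completion
        (from-runs (lower one-below) (suc n) runs′ (≤-trans (subst (λ b →
            cost b + budget (suc n) ≤ budget n) c paid) le))
        where
        θ = thread E n
        r′ = next-run (runs θ)
        rs′ = rs [ θ ≔ proj₁ r′ ]
        one-below : OneBelow _≺_ rs′ rs
        one-below = θ , subst (_≺ rs θ) (sym (≔-same rs θ)) (proj₁ (proj₂ r′)) ,
            λ j ne → ≔-other rs ne
        runs′ : Runs (suc n) rs′
        runs′ j with j Fin.≟ θ
        ... | yes refl = proj₂ (proj₂ r′)
        ... | no ne = subst (λ T → Follows j (world (state E (suc n))) T (rs j))
            (sym (others (step E n) j ne))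
          (follows-quiet (calm , tr-rely (tr (adv E n)) ne) (runs j))
      ... | looks c calm not-update follows | inj₂ paid = later-completion (rest d upd)
        where
        θ = thread E n
        runs′ : Runs (suc n) rs
        runs′ j with j Fin.≟ θ
        ... | yes refl = follows
        ... | no ne = subst (λ T → Follows j (world (state E (suc n))) T (rs j))
            (sym (others (step E n) j ne))
          (follows-quiet (calm , tr-rely (tr (adv E n)) ne) (runs j))
        rest : ∀ d → IsUpdate (op (event E (d + n))) → Completion (suc n)
        rest zero    upd = contradiction upd not-update
        rest (suc d) upd = walk lower d (suc n) runs′
          (≤-trans (subst (λ b → cost b + budget (suc n) ≤ budget n) c paid) le)
          (subst (IsUpdate ∘ op ∘ event E) (sym (+-suc d n)) upd)

      fresh-runs : ∀ n → budget n ≤ _ → Completion n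
      fresh-runs n le = from-runs (oneBelow-acc _≺_ (proj₁ ∘ thread-runs)
          (proj₁ ∘ proj₂ ∘ thread-runs)) n (proj₂ ∘ proj₂ ∘ thread-runs) le
        where
        thread-runs : ∀ θ → ∃[ r ] Acc _≺_ r × Follows θ (world (state E n))
            (threads (config E n) θ) r
        thread-runs θ = thread-run (threads-ok (state E n) θ)

    update-completes : ∀ n → Completion n
    update-completes n = from-budget (<-wellFounded _) n ≤-refl

  lockFree : LockFree p IsUpdate
  lockFree = update-completes

  -- Wait-freedom of lookup

  Visible : Inner → World → Node → Set
  Visible u w c = ∀ {v} → Child c v → OnPath w (Inner.address u) v

  -- Public labels never change and are inherited by children and rebuild targets, so the lookup
  -- stays among the nodes labelled by `u`, whether or not these are still reachable.
  data LookupBelow (u : Inner) (w : World) : Cmd (Maybe V) → Set where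
    calling   : ∀ {k c} → Visible u w c → LookupBelow u w (call (search k c) return)
    reading   : ∀ {k v i} → OnPath w (Inner.address u) v →
                LookupBelow u w (prim (readChild v i) λ c → call (search k c) return)
    returning : ∀ {x} → LookupBelow u w (return x)

  lookupBelow-mono : ∀ {u w w′ c} → Mono w w′ → LookupBelow u w c → LookupBelow u w′ c
  lookupBelow-mono m (calling vis) = calling λ ch → onPath-mono m (vis ch)
  lookupBelow-mono m (reading on)  = reading (onPath-mono m on)
  lookupBelow-mono m returning     = returning

  CalmBelow : Inner → World → World → Set
  CalmBelow u w w′ = Mono w w′ × SameBelow u w w′

  calmBelow-trans : ∀ {u v w x} → CalmBelow u v w → CalmBelow u w x → CalmBelow u v x
  calmBelow-trans {u} (m , s) (n , s′) = mono-trans m n , sameCells-trans _ (λ e → _ , e) m s s′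

  onPath-child : ∀ {w ℓ v i c v′} → Inv w → ℓ ≢ 0 → OnPath w ℓ v → heap w (Inner.address v) i ≡ c →
                 Child c v′ → OnPath w ℓ v′
  onPath-child inv ℓ≢0 on@(onPath kn t) e ch = onPath
    (heap-known (child-inHeap inv (_ , t) e ch))
    (trans (deeper (points-below inv e (child-points ch)) (below-root≢0 inv ℓ≢0 on)) t)

  LookupHalts : Fin p → Inner → World → Cmd (Maybe V) → Set
  LookupHalts θ u = Term (CalmBelow u) θ Any

  module _ {θ : Fin p} {u : Inner} (u≢0 : Inner.address u ≢ 0) where

    search-term : ∀ {w v k} → Inv w → OnPath w (Inner.address u) v →
                  LookupHalts θ u w (call (search k (inner v)) return)
    search-term {w₀} {k = k} inv₀ on₀ = heap-rec P inv₀ search-step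
      (inHeap (path-known on₀) (_ , path-tag on₀)) on₀ (mono-refl , sameCells λ _ _ _ → refl)
      where
      P : Inner → Set
      P v = OnPath w₀ (Inner.address u) v → ∀ {w} → CalmBelow u w₀ w →
            LookupHalts θ u w (call (search k (inner v)) return)
      search-step : ∀ {v} → InHeap w₀ v →
        (∀ {i c v′} → heap w₀ (Inner.address v) i ≡ c → Child c v′ → P v′) → P v
      search-step {v} h rec on calm = call λ w₁ le₁ _ → prim λ { w₂ le₂ _ readChild _ →
        let calm′ = calmBelow-trans {u} (calmBelow-trans {u} calm le₁) le₂ in
        found _ (sym (same (proj₂ calm′) i (isAllocated (path-known on)) (path-tag on))) calm′ }
        where
        i = interpolationSearch k (Inner.keys v)
        found : ∀ c → heap w₀ (Inner.address v) i ≡ c → ∀ {w} → CalmBelow u w₀ w →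
                LookupHalts θ u w (call (search k c) return)
        found (empty _)      e calm = call λ _ _ _ → return tt
        found (single _ _ _) e calm = call λ _ _ _ → return tt
        found (inner v′)     e calm = rec e inner (onPath-child inv₀ u≢0 on e inner) calm
        found (rebuild op)   e calm = call λ _ le _ →
          rec e rebuild (onPath-child inv₀ u≢0 on e rebuild) (calmBelow-trans {u} calm le)

    visible-term : ∀ {w k} c → Inv w → Visible u w c → LookupHalts θ u w (call (search k c) return)
    visible-term (empty _)      inv vis = call λ _ _ _ → return tt
    visible-term (single _ _ _) inv vis = call λ _ _ _ → return tt
    visible-term (inner v)      inv vis = search-term inv (vis inner)
    visible-term (rebuild op)   inv vis = call λ _ le inv′ →
        search-term inv′ (onPath-mono (proj₁ le) (vis rebuild))

    lookup-term : ∀ {w c} → Inv w → LookupBelow u w c → LookupHalts θ u w c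
    lookup-term inv (calling {c = c} vis) = visible-term c inv vis
    lookup-term inv (reading on) = prim λ { _ le inv′ readChild _ →
      visible-term _ inv′ (onPath-child inv′ u≢0 (onPath-mono (proj₁ le) on) refl) }
    lookup-term inv returning = return tt

  LookupRun : Inner → Set
  LookupRun u = Run (λ _ → CalmBelow u) (Maybe V)

  data LookupEffect (θ : Fin p) (u : Inner) (k : K) (r : LookupRun u) : Event → World → Thread →
      Set where
    completes : ∀ {w T} → LookupEffect θ u k r (completed (lookup k)) w T
    continues : ∀ {w c} → LookupBelow u w c → (t : LookupHalts θ u w c) → ⟨ θ , w , c , t ⟩ʳ ≺ r →
                LookupEffect θ u k r (internal (lookup k)) w (running (lookup k) c)

  lookup-effect : ∀ {θ u k w e w′ T′ w₀ c} → Inner.address u ≢ 0 → Inv w →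
    WorldStep θ w (running (lookup k) c) e w′ T′ → LookupBelow u w c → CalmBelow u w₀ w →
    (t : LookupHalts θ u w₀ c) → LookupEffect θ u k ⟨ θ , w₀ , c , t ⟩ʳ e w′ T′
  lookup-effect u≢0 inv complete _ le t = completes
  lookup-effect u≢0 inv (prim readChild) (reading on) le (prim h) =
    continues (calling (onPath-child inv u≢0 on refl)) _ (prim {h = h} {le = le} {inv} {st =
        readChild} {refl})
  lookup-effect u≢0 inv call (calling {c = empty _}      vis) le (call h) =
    continues returning _ (call {h = h} {le = le} {inv})
  lookup-effect u≢0 inv call (calling {c = single _ _ _} vis) le (call h) =
    continues returning _ (call {h = h} {le = le} {inv})
  lookup-effect u≢0 inv call (calling {c = inner v}      vis) le (call h) =
    continues (reading (vis inner)) _ (call {h = h} {le = le} {inv})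
  lookup-effect u≢0 inv call (calling {c = rebuild op}   vis) le (call h) =
    continues (calling λ { inner → vis rebuild }) _ (call {h = h} {le = le} {inv})

  outside-≤ : ∀ {b b′ a} → b′ ≡ b → outside b ≤ a → outside b′ ≤ a
  outside-≤ refl le = le

  module _ (E : Execution p) (θ₀ : Fin p) (k : K) (n₀ : ℕ) (at : thread E n₀ ≡ θ₀)
           (often : InfinitelyOften (λ m → thread E m ≡ θ₀)) where

    Goal : Set
    Goal = ∃[ m ] CompletedAt E (lookup k) n₀ m

    W : ℕ → World
    W n = world (state E n)

    record InProgress (n : ℕ) : Set where
      field
        started  : n₀ < n
        internally : ∀ j → n₀ < j → j < n → thread E j ≡ θ₀ → event E j ≡ internal (lookup k)

    inProgress-suc : ∀ {n} → InProgress n → (thread E n ≡ θ₀ → event E n ≡ internal (lookup k)) →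
        InProgress (suc n)
    inProgress-suc {n} ip h = record
      { started = m≤n⇒m≤1+n started
      ; internally = λ j lt j≤n eq → case m≤n⇒m<n∨m≡n (≤-pred j≤n) of λ
          { (inj₁ j<n) → internally j lt j<n eq ; (inj₂ refl) → h eq } }
      where open InProgress ip

    completed-at : ∀ {n} → InProgress n → thread E n ≡ θ₀ → event E n ≡ completed (lookup k) → Goal
    completed-at {n} ip eq e = n , record
      { later = started ; by = trans eq (sym at) ; completes = e
      ; meanwhile = λ j lt lt′ eq′ → internally j lt lt′ (trans eq′ at) }
      where open InProgress ip

    own-step : ∀ {n T} → thread E n ≡ θ₀ → threads (config E n) θ₀ ≡ T →
               WorldStep θ₀ (W n) T (event E n) (W (suc n)) (threads (config E (suc n)) θ₀)
    own-step {n} refl refl = world-step (adv E n)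

    other-step : ∀ {n T} → thread E n ≢ θ₀ → threads (config E n) θ₀ ≡ T →
        threads (config E (suc n)) θ₀ ≡ T
    other-step {n} ne eq = trans (others (step E n) θ₀ (≢-sym ne)) eq

    module _ (u : Inner) (N : ℕ) (th : Threshold u N) where

      x = Inner.address u

      potential : ℕ → ℕ
      potential n = ∑ (rank x (attached u (W n)) (slack N u (W n)) ∘ phase (state E n)) +
          pendingBelow u (W n)

      record Bounded (a s r n : ℕ) : Set where
        constructor bounded
        field
          attached-≤  : outside (attached u (W n)) ≤ a
          slack-≤     : slack N u (W n) ≤ s
          potential-≤ : potential n ≤ r

      -- Lexicographic descent. The components after the one that falls are not bounded; they are
      -- measured afresh when the induction resumes.
      data Lower (a s r n : ℕ) : Set where
        detaches : outside (attached u (W n)) < a → Lower a s r n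
        counts   : outside (attached u (W n)) ≤ a → slack N u (W n) < s → Lower a s r n
        spends   : outside (attached u (W n)) ≤ a → slack N u (W n) ≤ s → potential n < r →
            Lower a s r n

      data Next (a s r n : ℕ) : Set where
        lowers : Lower a s r (suc n) → Next a s r n
        keeps  : Bounded a s r (suc n) → SameBelow u (W n) (W (suc n)) → Next a s r n

      -- With `attached` and `slack` unchanged, all threads are ranked by the same function before
      -- and after, so only the summand of the moving thread differs.
      shift : ∀ n → attached u (W (suc n)) ≡ attached u (W n) →
          slack N u (W (suc n)) ≡ slack N u (W n) → ∀ k →
        let f = rank x (attached u (W n)) (slack N u (W n)) in
        k + (f (phase (state E (suc n)) (thread E n)) + pendingBelow u (W (suc n))) ≤
          f (phase (state E n) (thread E n)) + pendingBelow u (W n) →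
        k + potential (suc n) ≤ potential n
      shift n eb es k le = subst₂
        (λ b s → k + (∑ (rank x b s ∘ phase (state E (suc n))) + pendingBelow u (W (suc n))) ≤
            potential n)
        (sym eb) (sym es)
        (∑-shift-≤ (thread E n) {b = pendingBelow u (W (suc n))}
          (λ j ne → cong (rank x (attached u (W n)) (slack N u (W n)))
              (others-phase (adv E n) j ne)) k le)

      next-bound : ∀ {a s r n} → TopNode (W n) u → Bounded a s r n → Next a s r n
      next-bound {a} {s} {r} {n} tn (bounded a≤ s≤ r≤) with tr-moves (tr (adv E n)) tn th
      ... | detaches b b′ = lowers (detaches (<-≤-trans (subst₂ (λ b b′ →
          outside b′ < outside b) (sym b) (sym b′) ≤-refl) a≤))
      ... | counts eb lt = lowers (counts (outside-≤ eb a≤) (<-≤-trans lt s≤))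
      ... | spends eb es lt = lowers (spends (outside-≤ eb a≤) (≤-trans (≤-reflexive es) s≤)
        (<-≤-trans (shift n eb es 1 (lt refl refl refl)) r≤))
      ... | keeps eb es le same = keeps (bounded (outside-≤ eb a≤) (≤-trans (≤-reflexive es) s≤)
        (≤-trans (shift n eb es 0 (le refl refl refl)) r≤)) same

      record Pursuit (n : ℕ) (c : Cmd (Maybe V)) : Set where
        constructor pursuit
        field
          isTopNode : TopNode (W n) u
          progress  : InProgress n
          thread≡   : threads (config E n) θ₀ ≡ running (lookup k) c
          below-u   : LookupBelow u (W n) c

      -- The inner induction is on the run of the lookup and lasts while the cells below `u` stay
      -- the same; `recurse` is the outer, lexicographic one.
      module _ {a s r : ℕ} (recurse : ∀ {n c} → Pursuit n c → Lower a s r n → Goal) where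

        from-run : ∀ {w₀ c} {t : LookupHalts θ₀ u w₀ c} → Acc _≺_ ⟨ θ₀ , w₀ , c , t ⟩ʳ →
          ∀ {n} → CalmBelow u w₀ (W n) → Bounded a s r n → Pursuit n c → Goal
        walk : ∀ {w₀ c} {t : LookupHalts θ₀ u w₀ c} →
          (∀ {r} → r ≺ ⟨ θ₀ , w₀ , c , t ⟩ʳ → Acc _≺_ r) →
          ∀ d {n} → thread E (d + n) ≡ θ₀ → CalmBelow u w₀ (W n) → Bounded a s r n → Pursuit n c →
              Goal

        from-run (acc lower) {n} calm b pu with m , n≤m , eq ← often n =
          walk lower (m ∸ n) (trans (cong (thread E) (m∸n+n≡m n≤m)) eq) calm b pu

        walk {w₀} {c} {t} lower d {n} eq calm b (pursuit tn ip T≡ lb) with thread E n Fin.≟ θ₀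
        ... | yes mine = after-own (lookup-effect (notRoot tn) (inv (state E n)) (own-step mine T≡)
            lb calm t) refl refl refl
          where
          after-own : ∀ {e w T} → LookupEffect θ₀ u k ⟨ θ₀ , w₀ , c , t ⟩ʳ e w T → e ≡ event E n →
                      w ≡ W (suc n) → T ≡ threads (config E (suc n)) θ₀ → Goal
          after-own completes e _ _ = completed-at ip mine (sym e)
          after-own (continues lb′ t lt) e refl T≡′ = go (next-bound tn b)
            where
            pu′ = pursuit (topNode-mono (tr-mono (tr (adv E n))) tn) (inProgress-suc ip λ _ →
                sym e) (sym T≡′) lb′
            go : Next a s r n → Goal
            go (lowers l)  = recurse pu′ l
            go (keeps b′ _) = from-run (lower lt) (mono-refl , sameCells λ _ _ _ → refl) b′ pu′
        ... | no ne = go d eq (next-bound tn b)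
          where
          m = tr-mono (tr (adv E n))
          pu′ = pursuit (topNode-mono m tn) (inProgress-suc ip λ eq → contradiction eq ne)
                  (other-step ne T≡) (lookupBelow-mono m lb)
          go : ∀ d → thread E (d + n) ≡ θ₀ → Next a s r n → Goal
          go _       eq (lowers l)      = recurse pu′ l
          go zero    eq (keeps _ _)     = contradiction eq ne
          go (suc d) eq (keeps b′ same) = walk lower d (trans (cong (thread E) (+-suc d n)) eq)
            (calmBelow-trans {u} calm (m , same)) b′ pu′

      lower-elim : ∀ {a s r n} {C : Set} → (outside (attached u (W n)) < a → C) →
        (outside (attached u (W n)) ≤ a → slack N u (W n) < s → C) →
        (outside (attached u (W n)) ≤ a → slack N u (W n) ≤ s → potential n < r → C) →
            Lower a s r n → C
      lower-elim f g h (detaches lt)     = f lt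
      lower-elim f g h (counts a≤ lt)    = g a≤ lt
      lower-elim f g h (spends a≤ s≤ lt) = h a≤ s≤ lt

      pursue : ∀ {a s r} → Acc _<_ a → Acc _<_ s → Acc _<_ r → ∀ {n c} → Bounded a s r n →
          Pursuit n c → Goal
      pursue acc-a@(acc ra) acc-s@(acc rs) (acc rr) {n} b pu@(pursuit tn _ _ lb) = from-run
        (λ pu → lower-elim
          (λ lt → pursue (ra lt) (<-wellFounded _) (<-wellFounded _) (bounded ≤-refl ≤-refl ≤-refl)
              pu)
          (λ a≤ lt → pursue acc-a (rs lt) (<-wellFounded _) (bounded a≤ ≤-refl ≤-refl) pu)
          (λ a≤ s≤ lt → pursue acc-a acc-s (rr lt) (bounded a≤ s≤ ≤-refl) pu))
        (≺-acc (lookup-term (notRoot tn) (inv (state E n)) lb)) (mono-refl , sameCells λ _ _ _ →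
            refl) b pu

    await : ∀ {n T} → threads (config E n) θ₀ ≡ T → InProgress n →
            ∃[ m ] InProgress m × thread E m ≡ θ₀ × threads (config E m) θ₀ ≡ T
    await {n} {T} T≡ ip with m , n≤m , eq ← often n = go (m ∸ n)
        (trans (cong (thread E) (m∸n+n≡m n≤m)) eq) T≡ ip
      where
      go : ∀ d {n} → thread E (d + n) ≡ θ₀ → threads (config E n) θ₀ ≡ T → InProgress n →
           ∃[ m ] InProgress m × thread E m ≡ θ₀ × threads (config E m) θ₀ ≡ T
      go d {n} eq T≡ ip with thread E n Fin.≟ θ₀
      ... | yes mine = n , ip , mine , T≡
      go zero    eq T≡ ip | no ne = contradiction eq ne
      go (suc d) {n} eq T≡ ip | no ne = go d (trans (cong (thread E) (+-suc d n)) eq)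
          (other-step ne T≡)
        (inProgress-suc ip λ eq → contradiction eq ne)

    called : ∀ {θ w o e w′ T′ f} {g : Returns f → Cmd (OpResult o)} →
        WorldStep θ w (running o (call f g)) e w′ T′ →
             e ≡ internal o × T′ ≡ running o (body f >>= g)
    called call = refl , refl

    returned : ∀ {θ w o e w′ T′ x} → WorldStep θ w (running o (return x)) e w′ T′ → e ≡ completed o
    returned complete = refl

    read : ∀ {θ w o e w′ T′ u i} {g : Node → Cmd (OpResult o)} →
      WorldStep θ w (running o (prim (readChild u i) g)) e w′ T′ →
      e ≡ internal o × T′ ≡ running o (g (heap w′ (Inner.address u) i))
    read (prim readChild) = refl , refl

    from-return : ∀ {n x} → threads (config E n) θ₀ ≡ running (lookup k) (return x) → InProgress n →
        Goal
    from-return T≡ ip with m , ip′ , mine , T≡′ ← await T≡ ip =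
        completed-at ip′ mine (returned (own-step mine T≡′))

    from-leaf : ∀ {n c} → Leaf c → threads (config E n) θ₀ ≡ running (lookup k)
        (call (search k c) return) →
                InProgress n → Goal
    from-leaf {c = c} leaf T≡ ip with m , ip′ , mine , T≡′ ← await T≡ ip
      with e , T≡″ ← called (own-step mine T≡′) = go leaf T≡″
      where
      go : Leaf c → threads (config E (suc m)) θ₀ ≡ running (lookup k) (body (search k c) >>=
          return) → Goal
      go empty  T≡ = from-return T≡ (inProgress-suc ip′ λ _ → e)
      go single T≡ = from-return T≡ (inProgress-suc ip′ λ _ → e)

    from-top : ∀ {n u} → TopNode (W n) u → InProgress n → ∀ {c} →
      threads (config E n) θ₀ ≡ running (lookup k) c → LookupBelow u (W n) c → Goal
    from-top {u = u} tn ip T≡ lb with N , th ← threshold R (Inner.initSize u) =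
      pursue u N th (<-wellFounded _) (<-wellFounded _) (<-wellFounded _)
          (bounded ≤-refl ≤-refl ≤-refl)
        (pursuit tn ip T≡ lb)

    from-child : ∀ {n} c → heap (W n) 0 0 ≡ c → InProgress n →
      threads (config E n) θ₀ ≡ running (lookup k) (call (search k c) return) → Goal
    from-child (empty _)      e ip T≡ = from-leaf empty T≡ ip
    from-child (single _ _ _) e ip T≡ = from-leaf single T≡ ip
    from-child {n} (inner u)  e ip T≡ = from-top tn ip T≡ (calling λ { inner →
        onPath (isKnown tn) (isTop tn) })
      where
      tn : TopNode (W n) u
      tn = record { isKnown = child-known (inv (state E n)) e
                  ; isTop = at-root (belows (inv (state E n)) e) refl ; notRoot =
                      nonroot (inv (state E n)) e }
    -- The top node is the target of the Rebuild node and is thus detached from the start.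
    from-child {n} (rebuild op) e ip T≡ = from-top tn ip T≡ (calling λ { rebuild →
        onPath (isKnown tn) (isTop tn) })
      where
      open RebuildOK (placed-known (inv (state E n)) e)
      tn : TopNode (W n) (Rebuild.target op)
      tn = record { isKnown = target-known
                  ; isTop = at-root target-below (Placed.parent (placed (inv (state E n)) e))
                  ; notRoot = target-nonroot }

    from-root : ∀ {n} → threads (config E n) θ₀ ≡ running (lookup k)
        (call (search k (inner root)) return) →
                InProgress n → Goal
    from-root T≡ ip with m₁ , ip₁ , mine₁ , T≡₁ ← await T≡ ip
      with e₁ , T≡₁′ ← called (own-step mine₁ T≡₁)
      with m₂ , ip₂ , mine₂ , T≡₂ ← await T≡₁′ (inProgress-suc ip₁ λ _ → e₁)
      with e₂ , T≡₂′ ← read (own-step mine₂ T≡₂) =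
      from-child _ refl (inProgress-suc ip₂ λ _ → e₂) T≡₂′

  invoked-thread : ∀ {θ w T e w′ T′ o} → WorldStep θ w T e w′ T′ → e ≡ invoked o →
      T′ ≡ running o (body (operation o))
  invoked-thread invoke refl = refl

  waitFree : WaitFree p IsLookup
  waitFree E n .(lookup k) (lookup {k}) e often = from-root E (thread E n) k n refl often
    (invoked-thread (world-step (adv E n)) e)
    (record { started = ≤-refl ; internally = λ j lt lt′ → contradiction (≤-pred lt′) (<⇒≱ lt) })

theorem3p13 : (𝕂 : StrictTotalOrder 0ℓ 0ℓ 0ℓ) (V : Set) (R : PositiveReal)
    (I : IST.IdealConstruction 𝕂 V) (p : ℕ) →
    let open IST 𝕂 V
        open Algorithm R I
    in LockFree p IsUpdate × WaitFree p IsLookup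
theorem3p13 𝕂 V R I p = Progress.lockFree 𝕂 V R I p , Progress.waitFree 𝕂 V R I p
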